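{- Let $L>0$ be a constant. There is a constant $C>0$ such that the following holds. Let $\mathcal{H}$ be an $r$-bounded, $\kappa$-spread hypergraph, let $X=V(\mathcal{H})$ and $N=|X|$, and let the elements of $X$ be randomly colored (uniformly and independently) from $Q=[q]$, where $q\ge r$. Suppose also that (i) $\kappa\ge Lr$, and (ii) $N\le \kappa^2 r/\log^5 r$. If $$m\ge \frac{(C\log_2 r)\,|X|}{\kappa},$$ then w.h.p. (that is, with probability tending to $1$ as $r\to\infty$) $X_m$ contains a rainbow colored edge of $\mathcal{H}$.
   Context: A hypergraph $\mathcal{H}$ with finite vertex set $X=V(\mathcal{H})$ is thought of as a (nonempty) set of edges, each a subset of $X$. It is $r$-bounded if $|e|\le r$ for every $e\in\mathcal{H}$. For $S\subseteq X$ let $\langle S\rangle=\{T: S\subseteq T\subseteq X\}$. $\mathcal{H}$ is $\kappa$-spread if $|\mathcal{H}\cap\langle S\rangle|\le |\mathcal{H}|/\kappa^{|S|}$ for all $S\subseteq X$. $X_m$ denotes a uniformly random $m$-subset of $X$ (independent of the coloring). Each element of $X$ receives a color chosen uniformly and independently from $[q]=\{1,\dots,q\}$. A set $S\subseteq X$ is rainbow colored if no two elements of $S$ have the same color. The parameters $\mathcal{H},X,\kappa,q,m$ may vary with $r$, while $L$ and $C$ are constants; all asymptotics, including w.h.p., are as $r\to\infty$. -}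

module Defs where

open import Algebra.Bundles using (CommutativeMonoid)
import Algebra.Properties.AbelianGroup as AbelianGroupProperties
import Algebra.Properties.CommutativeSemigroup as CommutativeSemigroupProperties
open import Data.Fin.Base using (Fin)
import Data.Fin.Properties as Fin
open import Data.Fin.Subset using (Subset; inside; outside; _∈_; _⊆_; ∣_∣)
open import Data.Fin.Subset.Properties using (_∈?_; _⊆?_)
open import Data.Integer.Base using (+_)
import Data.Integer.Base as ℤ
import Data.Integer.Properties as ℤ
open import Data.List.Base
  using (List; []; _∷_; [_]; length; filter; allFin; cartesianProduct; cartesianProductWith)
open import Data.List.Relation.Unary.All using (All)
open import Data.List.Relation.Unary.Any using (Any; any?)
open import Data.List.Relation.Unary.Unique.Propositional using (Unique)
open import Data.Nat.Base using (ℕ; zero; suc; NonZero; z≤n; s≤s)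
import Data.Nat.Base as ℕ
import Data.Nat.Properties as ℕ
open import Data.Nat.Logarithm
  using (⌊log₂_⌋; ⌊log₂⌋-mono-≤; ⌊log₂⌊n/2⌋⌋≡⌊log₂n⌋∸1; ⌊log₂[2^n]⌋≡n)
open import Data.Product.Base using (∃-syntax; _×_; _,_; proj₁; proj₂)
open import Data.Rational.Base using (ℚ; mkℚ; 0ℚ; 1ℚ; _/_; toℚᵘ; positive)
import Data.Rational.Base as ℚ
import Data.Rational.Properties as ℚ
import Data.Rational.Unnormalised.Base as ℚᵘ
import Data.Rational.Unnormalised.Properties as ℚᵘ
open import Data.Sum.Base using (inj₁; inj₂)
open import Data.Vec.Base using (Vec; []; _∷_; lookup)
open import Relation.Binary.PropositionalEquality
  using (_≡_; _≢_; refl; sym; trans; cong; cong₂; subst; subst₂)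
open import Relation.Nullary.Decidable using (_×-dec_; _→-dec_)
open import Relation.Nullary.Negation using (contradiction)
open import Relation.Unary using (Pred; Decidable)

Cauchy : (ℕ → ℚ) → Set
Cauchy x = ∀ ε → 0ℚ ℚ.< ε →
  ∃[ K ] (∀ m n → K ℕ.≤ m → K ℕ.≤ n → ℚ.∣ x m ℚ.- x n ∣ ℚ.< ε)

-- Distinct sequences may represent the same real: equality of reals is ≤ℝ in
-- both directions, not _≡_.
record ℝ : Set where
  constructor mkℝ
  field
    seq    : ℕ → ℚ
    cauchy : Cauchy seq

open ℝ public

infix 4 _≤ℝ_ _<ℝ_

_≤ℝ_ : ℝ → ℝ → Set
x ≤ℝ y = ∀ ε → 0ℚ ℚ.< ε → ∃[ K ] (∀ n → K ℕ.≤ n → seq x n ℚ.≤ seq y n ℚ.+ ε)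

_<ℝ_ : ℝ → ℝ → Set
x <ℝ y = ∃[ ε ] (0ℚ ℚ.< ε × ∃[ K ] (∀ n → K ℕ.≤ n → seq x n ℚ.+ ε ℚ.≤ seq y n))

fromℚ : ℚ → ℝ
fromℚ p = mkℝ (λ _ → p)
  λ ε 0<ε → 0 , λ _ _ _ _ → subst (ℚ._< ε) (cong ℚ.∣_∣ (sym (ℚ.+-inverseʳ p))) 0<ε

fromℕ : ℕ → ℝ
fromℕ n = fromℚ (+ n / 1)

0ℝ : ℝ
0ℝ = fromℕ 0

1ℝ : ℝ
1ℝ = fromℕ 1

open AbelianGroupProperties ℚ.+-0-abelianGroup using (xyx⁻¹≈y; ⁻¹-involutive)
open CommutativeSemigroupProperties
  (CommutativeMonoid.commutativeSemigroup ℚ.+-0-commutativeMonoid) using (xy∙z≈xz∙y)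

telescope : ∀ p q r → (p ℚ.- q) ℚ.+ (q ℚ.- r) ≡ p ℚ.- r
telescope p q r = trans (ℚ.+-assoc p (ℚ.- q) (q ℚ.- r)) (cong (p ℚ.+_)
  (trans (sym (ℚ.+-assoc (ℚ.- q) q (ℚ.- r)))
    (trans (cong (ℚ._- r) (ℚ.+-inverseˡ q)) (ℚ.+-identityˡ (ℚ.- r)))))

neg-minus : ∀ p q → ℚ.- (p ℚ.- q) ≡ q ℚ.- p
neg-minus p q = trans (ℚ.neg-distrib-+ p (ℚ.- q))
  (trans (cong (ℚ.- p ℚ.+_) (⁻¹-involutive q)) (ℚ.+-comm (ℚ.- p) q))

*-distribˡ-minus : ∀ p q r → p ℚ.* (q ℚ.- r) ≡ p ℚ.* q ℚ.- p ℚ.* r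
*-distribˡ-minus p q r = trans (ℚ.*-distribˡ-+ p q (ℚ.- r))
  (cong (p ℚ.* q ℚ.+_) (sym (ℚ.neg-distribʳ-* p r)))

∣p∣≤∣q∣+∣p-q∣ : ∀ p q → ℚ.∣ p ∣ ℚ.≤ ℚ.∣ q ∣ ℚ.+ ℚ.∣ p ℚ.- q ∣
∣p∣≤∣q∣+∣p-q∣ p q = subst (λ t → ℚ.∣ t ∣ ℚ.≤ ℚ.∣ q ∣ ℚ.+ ℚ.∣ p ℚ.- q ∣)
  (trans (sym (ℚ.+-assoc q p (ℚ.- q))) (xyx⁻¹≈y q p))
  (ℚ.∣p+q∣≤∣p∣+∣q∣ q (p ℚ.- q))

0<1 : 0ℚ ℚ.< 1ℚ
0<1 = ℚ.positive⁻¹ 1ℚ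

bound : ∀ x → Cauchy x →
  ∃[ B ] (0ℚ ℚ.< B × ∃[ K ] (∀ n → K ℕ.≤ n → ℚ.∣ x n ∣ ℚ.≤ B))
bound x c with c 1ℚ 0<1
... | K , h = ℚ.∣ x K ∣ ℚ.+ 1ℚ
  , ℚ.+-mono-≤-< (ℚ.0≤∣p∣ (x K)) 0<1
  , K
  , λ n K≤n → ℚ.≤-trans (∣p∣≤∣q∣+∣p-q∣ (x n) (x K))
      (ℚ.+-monoʳ-≤ ℚ.∣ x K ∣ (ℚ.<⇒≤ (h n K K≤n ℕ.≤-refl)))

*-cauchy : ∀ x y → Cauchy x → Cauchy y → Cauchy (λ n → x n ℚ.* y n)
*-cauchy x y cx cy ε 0<ε with bound x cx | bound y cy
... | A , 0<A , I , hA | B , 0<B , J , hB = K , λ m n K≤m K≤n → let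
    I≤m = ℕ.≤-trans I≤K K≤m
    J≤n = ℕ.≤-trans J≤K K≤n
    U≤m = ℕ.≤-trans U≤K K≤m
    U≤n = ℕ.≤-trans U≤K K≤n
    V≤m = ℕ.≤-trans V≤K K≤m
    V≤n = ℕ.≤-trans V≤K K≤n
    open ℚ.≤-Reasoning
    in begin-strict
      ℚ.∣ x m ℚ.* y m ℚ.- x n ℚ.* y n ∣
        ≡⟨ cong ℚ.∣_∣ (split (x m) (y m) (x n) (y n)) ⟩
      ℚ.∣ x m ℚ.* (y m ℚ.- y n) ℚ.+ y n ℚ.* (x m ℚ.- x n) ∣
        ≤⟨ ℚ.∣p+q∣≤∣p∣+∣q∣ (x m ℚ.* (y m ℚ.- y n)) (y n ℚ.* (x m ℚ.- x n)) ⟩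
      ℚ.∣ x m ℚ.* (y m ℚ.- y n) ∣ ℚ.+ ℚ.∣ y n ℚ.* (x m ℚ.- x n) ∣
        <⟨ ℚ.+-mono-<
             (prod (x m) (y m ℚ.- y n) A 0<A (hA m I≤m) (hV m n V≤m V≤n))
             (prod (y n) (x m ℚ.- x n) B 0<B (hB n J≤n) (hU m n U≤m U≤n)) ⟩
      A ℚ.* δ ℚ.+ B ℚ.* δ
        ≡⟨ sym (ℚ.*-distribʳ-+ δ A B) ⟩
      (A ℚ.+ B) ℚ.* (inv ℚ.* ε)
        ≡⟨ sym (ℚ.*-assoc (A ℚ.+ B) inv ε) ⟩
      (A ℚ.+ B) ℚ.* inv ℚ.* ε
        ≡⟨ cong (ℚ._* ε) (ℚ.*-inverseʳ (A ℚ.+ B)) ⟩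
      1ℚ ℚ.* ε
        ≡⟨ ℚ.*-identityˡ ε ⟩
      ε ∎
  where
  instance
    A+B-pos : ℚ.Positive (A ℚ.+ B)
    A+B-pos = positive (ℚ.+-mono-< 0<A 0<B)
    A+B-nonZero : ℚ.NonZero (A ℚ.+ B)
    A+B-nonZero = ℚ.pos⇒nonZero (A ℚ.+ B)
    ε-pos : ℚ.Positive ε
    ε-pos = positive 0<ε
  inv δ : ℚ
  inv = ℚ.1/ (A ℚ.+ B)
  δ = inv ℚ.* ε
  0<δ : 0ℚ ℚ.< δ
  0<δ = ℚ.positive⁻¹ δ ⦃ ℚ.pos*pos⇒pos inv ⦃ ℚ.1/pos⇒pos (A ℚ.+ B) ⦄ ε ⦄
  U = proj₁ (cx δ 0<δ)
  hU = proj₂ (cx δ 0<δ)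
  V = proj₁ (cy δ 0<δ)
  hV = proj₂ (cy δ 0<δ)
  K = (I ℕ.⊔ J) ℕ.⊔ (U ℕ.⊔ V)
  I≤K : I ℕ.≤ K
  I≤K = ℕ.≤-trans (ℕ.m≤m⊔n I J) (ℕ.m≤m⊔n (I ℕ.⊔ J) (U ℕ.⊔ V))
  J≤K : J ℕ.≤ K
  J≤K = ℕ.≤-trans (ℕ.m≤n⊔m I J) (ℕ.m≤m⊔n (I ℕ.⊔ J) (U ℕ.⊔ V))
  U≤K : U ℕ.≤ K
  U≤K = ℕ.≤-trans (ℕ.m≤m⊔n U V) (ℕ.m≤n⊔m (I ℕ.⊔ J) (U ℕ.⊔ V))
  V≤K : V ℕ.≤ K
  V≤K = ℕ.≤-trans (ℕ.m≤n⊔m U V) (ℕ.m≤n⊔m (I ℕ.⊔ J) (U ℕ.⊔ V))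
  split : ∀ a b c d → a ℚ.* b ℚ.- c ℚ.* d ≡ a ℚ.* (b ℚ.- d) ℚ.+ d ℚ.* (a ℚ.- c)
  split a b c d = sym (trans
    (cong₂ ℚ._+_ (*-distribˡ-minus a b d)
      (trans (*-distribˡ-minus d a c) (cong₂ ℚ._-_ (ℚ.*-comm d a) (ℚ.*-comm d c))))
    (telescope (a ℚ.* b) (a ℚ.* d) (c ℚ.* d)))
  prod : ∀ a d E → 0ℚ ℚ.< E → ℚ.∣ a ∣ ℚ.≤ E → ℚ.∣ d ∣ ℚ.< δ →
    ℚ.∣ a ℚ.* d ∣ ℚ.< E ℚ.* δ
  prod a d E 0<E a≤E d<δ = subst (ℚ._< E ℚ.* δ) (sym (ℚ.∣p*q∣≡∣p∣*∣q∣ a d))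
    (ℚ.≤-<-trans
      (ℚ.*-monoʳ-≤-nonNeg ℚ.∣ d ∣ ⦃ ℚ.∣-∣-nonNeg d ⦄ a≤E)
      (ℚ.*-monoʳ-<-pos E ⦃ positive 0<E ⦄ d<δ))

infixl 7 _*ℝ_
infixr 8 _^ℝ_

_*ℝ_ : ℝ → ℝ → ℝ
x *ℝ y = mkℝ (λ n → seq x n ℚ.* seq y n) (*-cauchy (seq x) (seq y) (cauchy x) (cauchy y))

_^ℝ_ : ℝ → ℕ → ℝ
x ^ℝ zero  = 1ℝ
x ^ℝ suc n = x *ℝ (x ^ℝ n)

frac-≤ : ∀ a b c d .{{_ : NonZero b}} .{{_ : NonZero d}} →
  a ℕ.* d ℕ.≤ c ℕ.* b → + a / b ℚ.≤ + c / d
frac-≤ a b@(suc _) c d@(suc _) h = ℚ.toℚᵘ-cancel-≤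
  (ℚᵘ.≤-respˡ-≃ (ℚᵘ.≃-sym (ℚ.toℚᵘ-fromℚᵘ (ℚᵘ.mkℚᵘ (+ a) _)))
  (ℚᵘ.≤-respʳ-≃ (ℚᵘ.≃-sym (ℚ.toℚᵘ-fromℚᵘ (ℚᵘ.mkℚᵘ (+ c) _)))
  (ℚᵘ.*≤* (subst₂ ℤ._≤_ (ℤ.pos-* a d) (ℤ.pos-* c b) (ℤ.+≤+ h)))))

frac-+ : ∀ a b d .{{_ : NonZero d}} → + (a ℕ.+ b) / d ≡ + a / d ℚ.+ + b / d
frac-+ a b d@(suc d-1) = ℚ.toℚᵘ-injective (begin
  toℚᵘ (+ (a ℕ.+ b) / d)                   ≈⟨ ℚ.toℚᵘ-fromℚᵘ (ℚᵘ.mkℚᵘ (+ (a ℕ.+ b)) d-1) ⟩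
  ℚᵘ.mkℚᵘ (+ (a ℕ.+ b)) d-1                ≈⟨ ℚᵘ.*≡* eq ⟩
  ℚᵘ.mkℚᵘ (+ a) d-1 ℚᵘ.+ ℚᵘ.mkℚᵘ (+ b) d-1 ≈⟨ ℚᵘ.+-cong
                                                (ℚᵘ.≃-sym (ℚ.toℚᵘ-fromℚᵘ (ℚᵘ.mkℚᵘ (+ a) d-1)))
                                                (ℚᵘ.≃-sym (ℚ.toℚᵘ-fromℚᵘ (ℚᵘ.mkℚᵘ (+ b) d-1))) ⟩
  toℚᵘ (+ a / d) ℚᵘ.+ toℚᵘ (+ b / d)       ≈⟨ ℚᵘ.≃-sym (ℚ.toℚᵘ-homo-+ (+ a / d) (+ b / d)) ⟩
  toℚᵘ (+ a / d ℚ.+ + b / d)               ∎)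
  where
  open ℚᵘ.≃-Reasoning
  eq : + (a ℕ.+ b) ℤ.* + (d ℕ.* d) ≡ (+ a ℤ.* + d ℤ.+ + b ℤ.* + d) ℤ.* + d
  eq = trans (cong₂ ℤ._*_ (ℤ.pos-+ a b) (ℤ.pos-* d d))
       (trans (sym (ℤ.*-assoc (+ a ℤ.+ + b) (+ d) (+ d)))
              (cong (ℤ._* + d) (ℤ.*-distribʳ-+ (+ d) (+ a) (+ b))))

archimedes : ∀ ε → 0ℚ ℚ.< ε → ∃[ K ] (∀ n → K ℕ.≤ n → + 1 / suc n ℚ.< ε)
archimedes ε@(mkℚ (+ zero)     d _) 0<ε = contradiction (positive 0<ε) λ ()
archimedes ε@(mkℚ (ℤ.-[1+ _ ]) d _) 0<ε = contradiction (positive 0<ε) λ ()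
archimedes ε@(mkℚ (+ suc a)    d _) 0<ε = suc d , λ n d<n →
  ℚ.toℚᵘ-cancel-< (ℚᵘ.<-respˡ-≃ (ℚᵘ.≃-sym (ℚ.toℚᵘ-fromℚᵘ (ℚᵘ.mkℚᵘ (+ 1) n)))
    (ℚᵘ.*<* (subst₂ ℤ._<_ (ℤ.pos-* 1 (suc d)) (ℤ.pos-* (suc a) (suc n))
      (ℤ.+<+ (subst (ℕ._< suc a ℕ.* suc n) (sym (ℕ.*-identityˡ (suc d)))
        (ℕ.≤-trans (s≤s d<n) (ℕ.m≤n*m (suc n) (suc a))))))))

slow⇒cauchy : ∀ x → (∀ m n → x m ℚ.≤ x n ℚ.+ + 1 / suc n) → Cauchy x
slow⇒cauchy x h ε 0<ε with archimedes ε 0<ε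
... | K , hK = K , λ m n K≤m K≤n → lemma m n K≤m K≤n
  where
  diff : ∀ m n → K ℕ.≤ n → x m ℚ.- x n ℚ.< ε
  diff m n K≤n = ℚ.≤-<-trans
    (subst (x m ℚ.- x n ℚ.≤_)
      (xyx⁻¹≈y (x n) (+ 1 / suc n))
      (ℚ.+-monoˡ-≤ (ℚ.- x n) (h m n)))
    (hK n K≤n)
  lemma : ∀ m n → K ℕ.≤ m → K ℕ.≤ n → ℚ.∣ x m ℚ.- x n ∣ ℚ.< ε
  lemma m n K≤m K≤n with ℚ.∣p∣≡p∨∣p∣≡-p (x m ℚ.- x n)
  ... | inj₁ eq = subst (ℚ._< ε) (sym eq) (diff m n K≤n)
  ... | inj₂ eq = subst (ℚ._< ε)
    (sym (trans eq (neg-minus (x m) (x n))))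
    (diff n m K≤m)

⌊log₂n⌋≡l⇒2^l≤n : ∀ l n .{{_ : NonZero n}} → ⌊log₂ n ⌋ ≡ l → 2 ℕ.^ l ℕ.≤ n
⌊log₂n⌋≡l⇒2^l≤n zero    (suc _)         _  = s≤s z≤n
⌊log₂n⌋≡l⇒2^l≤n (suc l) n@(suc (suc _)) eq = begin
  2 ℕ.* 2 ℕ.^ l               ≤⟨ ℕ.*-monoʳ-≤ 2 (⌊log₂n⌋≡l⇒2^l≤n l ℕ.⌊ n /2⌋
                                   (trans (⌊log₂⌊n/2⌋⌋≡⌊log₂n⌋∸1 n) (cong ℕ.pred eq))) ⟩
  2 ℕ.* ℕ.⌊ n /2⌋             ≡⟨ cong (ℕ.⌊ n /2⌋ ℕ.+_) (ℕ.+-identityʳ ℕ.⌊ n /2⌋) ⟩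
  ℕ.⌊ n /2⌋ ℕ.+ ℕ.⌊ n /2⌋     ≤⟨ ℕ.+-monoʳ-≤ ℕ.⌊ n /2⌋ (ℕ.⌊n/2⌋≤⌈n/2⌉ n) ⟩
  ℕ.⌊ n /2⌋ ℕ.+ ℕ.⌈ n /2⌉     ≡⟨ ℕ.⌊n/2⌋+⌈n/2⌉≡n n ⟩
  n                           ∎
  where open ℕ.≤-Reasoning

n<2^[1+⌊log₂n⌋] : ∀ n → n ℕ.< 2 ℕ.^ suc ⌊log₂ n ⌋
n<2^[1+⌊log₂n⌋] n = ℕ.≰⇒> λ 2^≤n → contradiction
  (subst (ℕ._≤ ⌊log₂ n ⌋) (⌊log₂[2^n]⌋≡n (suc ⌊log₂ n ⌋)) (⌊log₂⌋-mono-≤ 2^≤n))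
  ℕ.1+n≰n

⌊log₂⌋-^ : ∀ r m n → ⌊log₂ r ℕ.^ suc m ⌋ ℕ.* suc n ℕ.≤ suc ⌊log₂ r ℕ.^ suc n ⌋ ℕ.* suc m
⌊log₂⌋-^ zero m n = z≤n
⌊log₂⌋-^ r@(suc _) m n = ℕ.<⇒≤ (ℕ.≰⇒> λ le → ℕ.<-irrefl refl (begin-strict
  2 ℕ.^ (suc b ℕ.* suc m)     ≤⟨ ℕ.^-monoʳ-≤ 2 le ⟩
  2 ℕ.^ (a ℕ.* suc n)         ≡⟨ sym (ℕ.^-*-assoc 2 a (suc n)) ⟩
  (2 ℕ.^ a) ℕ.^ suc n         ≤⟨ ℕ.^-monoˡ-≤ (suc n)
                                   (⌊log₂n⌋≡l⇒2^l≤n a (r ℕ.^ suc m) ⦃ ℕ.m^n≢0 r (suc m) ⦄ refl) ⟩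
  (r ℕ.^ suc m) ℕ.^ suc n     ≡⟨ ℕ.^-*-assoc r (suc m) (suc n) ⟩
  r ℕ.^ (suc m ℕ.* suc n)     ≡⟨ cong (r ℕ.^_) (ℕ.*-comm (suc m) (suc n)) ⟩
  r ℕ.^ (suc n ℕ.* suc m)     ≡⟨ sym (ℕ.^-*-assoc r (suc n) (suc m)) ⟩
  (r ℕ.^ suc n) ℕ.^ suc m     <⟨ ℕ.^-monoˡ-< (suc m) (n<2^[1+⌊log₂n⌋] (r ℕ.^ suc n)) ⟩
  (2 ℕ.^ suc b) ℕ.^ suc m     ≡⟨ ℕ.^-*-assoc 2 (suc b) (suc m) ⟩
  2 ℕ.^ (suc b ℕ.* suc m)     ∎))
  where
  open ℕ.≤-Reasoning
  a = ⌊log₂ r ℕ.^ suc m ⌋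
  b = ⌊log₂ r ℕ.^ suc n ⌋

-- ⌊ k log₂ r ⌋ / k → log₂ r as k → ∞.  The value at r = 0 is 0.
log₂ : ℕ → ℝ
log₂ r = mkℝ x (slow⇒cauchy x slow)
  where
  x : ℕ → ℚ
  x n = + ⌊log₂ r ℕ.^ suc n ⌋ / suc n
  slow : ∀ m n → x m ℚ.≤ x n ℚ.+ + 1 / suc n
  slow m n = subst (x m ℚ.≤_)
    (trans (cong (λ t → + t / suc n) (ℕ.+-comm 1 ⌊log₂ r ℕ.^ suc n ⌋))
           (frac-+ ⌊log₂ r ℕ.^ suc n ⌋ 1 (suc n)))
    (frac-≤ ⌊log₂ r ℕ.^ suc m ⌋ (suc m) (suc ⌊log₂ r ℕ.^ suc n ⌋) (suc n) (⌊log₂⌋-^ r m n))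

-- 1/(n+1) + 1/(n+2) + ⋯ + 1/(n+d)
harmonic : ℕ → ℕ → ℚ
harmonic n zero    = 0ℚ
harmonic n (suc d) = harmonic n d ℚ.+ + 1 / suc (n ℕ.+ d)

harmonic-split : ∀ n d e → harmonic n (d ℕ.+ e) ≡ harmonic n d ℚ.+ harmonic (n ℕ.+ d) e
harmonic-split n d zero =
  trans (cong (harmonic n) (ℕ.+-identityʳ d)) (sym (ℚ.+-identityʳ _))
harmonic-split n d (suc e) = trans (cong (harmonic n) (ℕ.+-suc d e))
  (trans (cong₂ ℚ._+_ (harmonic-split n d e)
           (cong (λ t → + 1 / suc t) (sym (ℕ.+-assoc n d e))))
         (ℚ.+-assoc (harmonic n d) (harmonic (n ℕ.+ d) e) _))

harmonic-lower : ∀ n e p .{{_ : NonZero p}} → n ℕ.+ e ℕ.≤ p → + e / p ℚ.≤ harmonic n e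
harmonic-lower n zero    p h = ℚ.≤-reflexive (ℚ.0/n≡0 p)
harmonic-lower n (suc e) p h = subst (ℚ._≤ harmonic n (suc e))
  (trans (sym (frac-+ e 1 p)) (cong (λ t → + t / p) (ℕ.+-comm e 1)))
  (ℚ.+-mono-≤ (harmonic-lower n e p (ℕ.≤-trans (ℕ.+-monoʳ-≤ n (ℕ.n≤1+n e)) h))
    (frac-≤ 1 p 1 (suc (n ℕ.+ e)) (ℕ.*-monoʳ-≤ 1 (subst (ℕ._≤ p) (ℕ.+-suc n e) h))))

harmonic-upper : ∀ n e .{{_ : NonZero n}} → harmonic n e ℚ.≤ + e / n
harmonic-upper n zero    = ℚ.≤-reflexive (sym (ℚ.0/n≡0 n))
harmonic-upper n (suc e) = subst (harmonic n (suc e) ℚ.≤_)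
  (trans (sym (frac-+ e 1 n)) (cong (λ t → + t / n) (ℕ.+-comm e 1)))
  (ℚ.+-mono-≤ (harmonic-upper n e)
    (frac-≤ 1 (suc (n ℕ.+ e)) 1 n
      (ℕ.*-monoʳ-≤ 1 (ℕ.≤-trans (ℕ.m≤m+n n e) (ℕ.n≤1+n (n ℕ.+ e))))))

harmonic-block : ∀ m n d →
  harmonic (m ℕ.* n) (m ℕ.* suc d) ≡ harmonic (m ℕ.* n) (m ℕ.* d) ℚ.+ harmonic (m ℕ.* (n ℕ.+ d)) m
harmonic-block m n d = trans
  (cong (harmonic (m ℕ.* n)) (trans (ℕ.*-suc m d) (ℕ.+-comm m (m ℕ.* d))))
  (trans (harmonic-split (m ℕ.* n) (m ℕ.* d) m)
    (cong (λ t → harmonic (m ℕ.* n) (m ℕ.* d) ℚ.+ harmonic t m)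
      (sym (ℕ.*-distribˡ-+ m n d))))

refine-lower : ∀ m n d → .{{_ : NonZero m}} →
  harmonic n d ℚ.≤ harmonic (m ℕ.* n) (m ℕ.* d)
refine-lower m n zero = ℚ.≤-reflexive (cong (harmonic (m ℕ.* n)) (sym (ℕ.*-zeroʳ m)))
refine-lower m@(suc _) n (suc d) = subst (harmonic n (suc d) ℚ.≤_)
  (sym (harmonic-block m n d))
  (ℚ.+-mono-≤ (refine-lower m n d)
    (ℚ.≤-trans
      (frac-≤ 1 (suc k) m (m ℕ.* suc k) (ℕ.≤-reflexive (ℕ.*-identityˡ (m ℕ.* suc k))))
      (harmonic-lower (m ℕ.* k) m (m ℕ.* suc k)
        (ℕ.≤-reflexive (trans (ℕ.+-comm (m ℕ.* k) m) (sym (ℕ.*-suc m k)))))))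
  where k = n ℕ.+ d

refine-upper : ∀ m n d → .{{_ : NonZero m}} →
  harmonic (m ℕ.* suc n) (m ℕ.* d) ℚ.+ + 1 / suc (n ℕ.+ d) ℚ.≤ harmonic (suc n) d ℚ.+ + 1 / suc n
refine-upper m n zero = ℚ.≤-reflexive (cong₂ ℚ._+_
  (cong (harmonic (m ℕ.* suc n)) (ℕ.*-zeroʳ m))
  (cong (λ t → + 1 / suc t) (ℕ.+-identityʳ n)))
refine-upper m@(suc _) n (suc d) = begin
  harmonic (m ℕ.* suc n) (m ℕ.* suc d) ℚ.+ + 1 / suc (n ℕ.+ suc d)
    ≡⟨ cong₂ ℚ._+_ (harmonic-block m (suc n) d) (cong (λ t → + 1 / suc t) (ℕ.+-suc n d)) ⟩
  G ℚ.+ harmonic (m ℕ.* k) m ℚ.+ u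
    ≤⟨ ℚ.+-monoˡ-≤ u (ℚ.+-monoʳ-≤ G (ℚ.≤-trans (harmonic-upper (m ℕ.* k) m)
         (frac-≤ m (m ℕ.* k) 1 k (ℕ.≤-reflexive (sym (ℕ.*-identityˡ (m ℕ.* k))))))) ⟩
  G ℚ.+ + 1 / k ℚ.+ u
    ≤⟨ ℚ.+-monoˡ-≤ u (refine-upper m n d) ⟩
  harmonic (suc n) d ℚ.+ + 1 / suc n ℚ.+ u
    ≡⟨ xy∙z≈xz∙y (harmonic (suc n) d) (+ 1 / suc n) u ⟩
  harmonic (suc n) d ℚ.+ u ℚ.+ + 1 / suc n
    ∎
  where
  open ℚ.≤-Reasoning
  k = suc n ℕ.+ d
  u = + 1 / suc k
  G = harmonic (m ℕ.* suc n) (m ℕ.* d)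

-- ∑ 1/i over k < i ≤ r k, which is the lower Riemann sum with mesh 1/k of
-- ∫₁ʳ dt/t, so tends to ln r as k → ∞.  The value at r = 0 is 0.
ln : ℕ → ℝ
ln r = mkℝ x (slow⇒cauchy x slow)
  where
  s : ℕ
  s = ℕ.pred r
  x : ℕ → ℚ
  x n = harmonic (suc n) (s ℕ.* suc n)
  swap : ∀ m n → suc n ℕ.* (s ℕ.* suc m) ≡ suc m ℕ.* (s ℕ.* suc n)
  swap m n = trans (sym (ℕ.*-assoc (suc n) s (suc m)))
    (trans (ℕ.*-comm (suc n ℕ.* s) (suc m))
           (cong (suc m ℕ.*_) (ℕ.*-comm (suc n) s)))
  slow : ∀ m n → x m ℚ.≤ x n ℚ.+ + 1 / suc n
  slow m n = begin
    x m
      ≤⟨ refine-lower (suc n) (suc m) (s ℕ.* suc m) ⟩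
    harmonic (suc n ℕ.* suc m) (suc n ℕ.* (s ℕ.* suc m))
      ≡⟨ cong₂ harmonic (ℕ.*-comm (suc n) (suc m)) (swap m n) ⟩
    y
      ≡⟨ sym (ℚ.+-identityʳ y) ⟩
    y ℚ.+ 0ℚ
      ≤⟨ ℚ.+-monoʳ-≤ y (frac-≤ 0 1 1 (suc (n ℕ.+ s ℕ.* suc n)) z≤n) ⟩
    y ℚ.+ + 1 / suc (n ℕ.+ s ℕ.* suc n)
      ≤⟨ refine-upper (suc m) n (s ℕ.* suc n) ⟩
    x n ℚ.+ + 1 / suc n
      ∎
    where
    open ℚ.≤-Reasoning
    y = harmonic (suc m ℕ.* suc n) (suc m ℕ.* (s ℕ.* suc n))

-- The vertex set is Fin N; isolated vertices are allowed.
record Hypergraph (N : ℕ) : Set where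
  field
    edges    : List (Subset N)
    unique   : Unique edges
    nonempty : edges ≢ []

open Hypergraph public

Bounded : ∀ {N} → ℕ → Hypergraph N → Set
Bounded r H = All (λ e → ∣ e ∣ ℕ.≤ r) (edges H)

-- ∣ H ∩ ⟨S⟩ ∣
degree : ∀ {N} → Hypergraph N → Subset N → ℕ
degree H S = length (filter (S ⊆?_) (edges H))

-- Cleared of the denominator κ ^ ∣S∣; meant for κ > 0.
Spread : ∀ {N} → ℝ → Hypergraph N → Set
Spread κ H = ∀ S → fromℕ (degree H S) *ℝ (κ ^ℝ ∣ S ∣) ≤ℝ fromℕ (length (edges H))

Coloring : ℕ → ℕ → Set
Coloring q N = Vec (Fin q) N

Rainbow : ∀ {q N} → Coloring q N → Subset N → Set
Rainbow c S = ∀ x y → x ∈ S → y ∈ S → lookup c x ≡ lookup c y → x ≡ y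

rainbow? : ∀ {q N} (c : Coloring q N) → Decidable (Rainbow c)
rainbow? c S = Fin.all? λ x → Fin.all? λ y →
  (x ∈? S) →-dec (y ∈? S) →-dec (lookup c x Fin.≟ lookup c y) →-dec (x Fin.≟ y)

allVecs : ∀ {a} {A : Set a} → List A → ∀ n → List (Vec A n)
allVecs xs zero    = [ [] ]
allVecs xs (suc n) = cartesianProductWith _∷_ xs (allVecs xs n)

subsetsOfSize : ∀ N → ℕ → List (Subset N)
subsetsOfSize N m = filter (λ M → ∣ M ∣ ℕ.≟ m) (allVecs (inside ∷ outside ∷ []) N)

colorings : ∀ q N → List (Coloring q N)
colorings q N = allVecs (allFin q) N

-- The uniform measure on this product makes the m-subset and the coloring
-- independent, each uniform, and the colors of the vertices i.i.d. uniform.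
outcomes : ∀ N q m → List (Subset N × Coloring q N)
outcomes N q m = cartesianProduct (subsetsOfSize N m) (colorings q N)

-- Probability of P at a uniformly random entry of a list (0 if it is empty).
ℙ : ∀ {a p} {A : Set a} {P : Pred A p} → List A → Decidable P → ℚ
ℙ []            P? = 0ℚ
ℙ Ω@(_ ∷ _) P? = + length (filter P? Ω) / length Ω

ContainsRainbowEdge : ∀ {N q} → Hypergraph N → Subset N × Coloring q N → Set
ContainsRainbowEdge H (M , c) = Any (λ e → e ⊆ M × Rainbow c e) (edges H)

containsRainbowEdge? : ∀ {N q} (H : Hypergraph N) →
  Decidable (ContainsRainbowEdge {q = q} H)
containsRainbowEdge? H (M , c) = any? (λ e → (e ⊆? M) ×-dec rainbow? c e) (edges H)

{-# OPTIONS --safe #-}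
module Submission where

-- Replace H by the family of its injectively colored edges, a family of partial
-- colorings of X: if every edge carries a uniformly random injective coloring,
-- the probability of extending a given T is at most (4 / (κ q))^∣T∣.  The
-- revealed colored vertices contain a member of this family exactly when X_m
-- contains a rainbow edge, so it suffices to prove the bound for spread families
-- of partial colorings.
--
-- The vertices are revealed in rounds.  For a revealed W, every edge g is
-- replaced by its minimum fragment, the smallest g′ ∖ W with g′ ⊆ W ∪ g; the
-- fragments again form a spread family, with the same constants.  A pair
-- (W , T) with T a fragment of W is determined by the union Z of W and T
-- together with T itself, which is a subset of any edge contained in Z.  Hence
-- large fragments are rare, and in one round of density of order 1 / κ the
-- sizes are halved, except on a small part of the family.  After about log₂ r
-- such rounds the sizes are bounded by a constant 2^s, and one last round of
-- density of order (log₂ r) / κ leaves empty fragments.  As the total loss is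
-- less than the mass of the family, the union of the rounds contains an edge.
--
-- A vertex may get different colors in different rounds, while it has one color
-- in the actual model; vertex by vertex, the latter is more likely to contain an
-- edge, since an edge uses at most one color of each vertex.  A binomial random
-- subset of mean size m / 2 finally has size at most m with probability 1 / 2,
-- so that it fails at least half as often as X_m.

open import Defs
open import Data.Nat.Base using (ℕ; _≤_)
open import Data.Product.Base using (∃-syntax; _×_)
open import Data.Rational.Base using (ℚ; 0ℚ; 1ℚ) renaming (_<_ to _<ℚ_; _≤_ to _≤ℚ_; _-_ to _-ℚ_)
import Algebra.Properties.CommutativeSemigroup as CommutativeSemigroupProperties
open import Data.Bool.Base using (Bool; if_then_else_)
open import Data.Fin.Base using (Fin; zero; suc; toℕ; fromℕ<)
import Data.Fin.Properties as Fin
open import Data.Fin.Subset using (Subset; inside; outside; _⊆_; ⊤; ∣_∣) renaming (_∈_ to _∈ₛ_)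
open import Data.Fin.Subset.Properties
  using (_∈?_; _⊆?_; drop-∷-⊆; drop-there; ∣⊤∣≡n; ∣p∣≤n; s⊆s; out⊆; ⊆-refl)
import Data.Integer.Base as ℤ
import Data.Integer.Properties as ℤ
open import Data.List.Base
  using (List; []; _∷_; _++_; map; filter; length; concatMap; allFin; cartesianProductWith)
open import Data.List.Extrema.Nat using (argmin; argmin-all; f[argmin]≤f[xs])
open import Data.List.Membership.Propositional using (_∈_; find; lose)
open import Data.List.Membership.Propositional.Properties
  using (∈-filter⁺; ∈-filter⁻; ∈-concatMap⁻; ∈-cartesianProductWith⁺; ∈-map⁺; ∈-map⁻; ∈-allFin)
open import Data.List.Properties using (map-tabulate; length-tabulate)
open import Data.List.Relation.Unary.All as All using (All)
open import Data.List.Relation.Unary.Any as Any using (Any; any?; here; there)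
open import Data.Maybe.Base using (Maybe; just; nothing; _<∣>_; is-just)
open import Data.Nat.Base hiding (_≤_; ℕ)
open import Data.Nat.DivMod using (m/n*n≤m; m≡m%n+[m/n]*n; m%n<n)
open import Data.Nat.Logarithm using (⌊log₂_⌋; ⌊log₂⌋-mono-≤; ⌊log₂[2^n]⌋≡n)
open import Data.Nat.Properties
open import Data.Nat.Tactic.RingSolver using (solve-∀)
open import Data.Product.Base using (_,_; proj₁; proj₂)
open import Data.Rational.Base using (mkℚ; ½; toℚᵘ)
import Data.Rational.Base as ℚ
import Data.Rational.Properties as ℚ
import Data.Rational.Unnormalised.Base as ℚᵘ
import Data.Rational.Unnormalised.Properties as ℚᵘ
open import Data.Sum.Base using (_⊎_; inj₁; inj₂; [_,_]; map₂)
open import Data.Vec.Base using (Vec; []; _∷_; here; there; lookup; zipWith; replicate; _[_]≔_)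
import Data.Vec.Base as Vec
open import Data.Vec.Properties
  using (lookup-zipWith; lookup-replicate; lookup∘update; lookup∘update′; []=⇒lookup; lookup⇒[]=; []≔-commutes)
open import Function.Base using (_∘_; id; it)
open import Relation.Binary.PropositionalEquality hiding ([_])
open import Relation.Nullary.Decidable using (Dec; yes; no; does; _⊎-dec_; ¬?)
open import Relation.Nullary.Negation using (¬_; contradiction)
open import Relation.Unary using (Pred; Decidable)

open CommutativeSemigroupProperties *-commutativeSemigroup using (x∙yz≈y∙xz)

-- Finite sums

infix 5 ∑
∑ : ∀ {a} {A : Set a} → List A → (A → ℕ) → ℕ
∑ []       f = 0
∑ (x ∷ xs) f = f x + ∑ xs f

syntax ∑ xs (λ x → e) = ∑[ x ← xs ] e

∑-mono : ∀ {a} {A : Set a} (xs : List A) {f g : A → ℕ} →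
  (∀ x → x ∈ xs → f x ≤ g x) → ∑ xs f ≤ ∑ xs g
∑-mono []       h = z≤n
∑-mono (x ∷ xs) h = +-mono-≤ (h x (here refl)) (∑-mono xs (λ y → h y ∘ there))

∑-cong : ∀ {a} {A : Set a} (xs : List A) {f g : A → ℕ} →
  (∀ x → f x ≡ g x) → ∑ xs f ≡ ∑ xs g
∑-cong []       h = refl
∑-cong (x ∷ xs) h = cong₂ _+_ (h x) (∑-cong xs h)

∑-+ : ∀ {a} {A : Set a} (xs : List A) (f g : A → ℕ) →
  (∑[ x ← xs ] (f x + g x)) ≡ ∑ xs f + ∑ xs g
∑-+ []       f g = refl
∑-+ (x ∷ xs) f g = trans (cong ((f x + g x) +_) (∑-+ xs f g))
  (rearrange (f x) (g x) (∑ xs f) (∑ xs g))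
  where
  rearrange : ∀ a b c d → (a + b) + (c + d) ≡ (a + c) + (b + d)
  rearrange = solve-∀

∑-*ˡ : ∀ {a} {A : Set a} (xs : List A) (k : ℕ) (f : A → ℕ) →
  (∑[ x ← xs ] (k * f x)) ≡ k * ∑ xs f
∑-*ˡ []       k f = sym (*-zeroʳ k)
∑-*ˡ (x ∷ xs) k f = trans (cong (k * f x +_) (∑-*ˡ xs k f)) (sym (*-distribˡ-+ k (f x) (∑ xs f)))

∑-*ʳ : ∀ {a} {A : Set a} (xs : List A) (k : ℕ) (f : A → ℕ) →
  (∑[ x ← xs ] (f x * k)) ≡ ∑ xs f * k
∑-*ʳ xs k f = trans (∑-cong xs (λ x → *-comm (f x) k)) (trans (∑-*ˡ xs k f) (*-comm k (∑ xs f)))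

∑-const : ∀ {a} {A : Set a} (xs : List A) (k : ℕ) → (∑[ _ ← xs ] k) ≡ length xs * k
∑-const []       k = refl
∑-const (x ∷ xs) k = cong (k +_) (∑-const xs k)

∑-0 : ∀ {a} {A : Set a} (xs : List A) → (∑[ _ ← xs ] 0) ≡ 0
∑-0 xs = trans (∑-const xs 0) (*-zeroʳ (length xs))

∑-swap : ∀ {a b} {A : Set a} {B : Set b} (xs : List A) (ys : List B) (f : A → B → ℕ) →
  (∑[ x ← xs ] ∑[ y ← ys ] f x y) ≡ (∑[ y ← ys ] ∑[ x ← xs ] f x y)
∑-swap []       ys f = sym (∑-0 ys)
∑-swap (x ∷ xs) ys f = trans (cong (∑ ys (f x) +_) (∑-swap xs ys f))
  (sym (∑-+ ys (f x) (λ y → ∑[ x ← xs ] f x y)))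

∑-∈ : ∀ {a} {A : Set a} {xs : List A} {x} (f : A → ℕ) → x ∈ xs → f x ≤ ∑ xs f
∑-∈ f (here refl) = m≤m+n _ _
∑-∈ f (there p)   = ≤-trans (∑-∈ f p) (m≤n+m _ _)

∑-map : ∀ {a b} {A : Set a} {B : Set b} (g : A → B) (xs : List A) (f : B → ℕ) →
  ∑ (map g xs) f ≡ ∑ xs (f ∘ g)
∑-map g []       f = refl
∑-map g (x ∷ xs) f = cong (f (g x) +_) (∑-map g xs f)

∑-++ : ∀ {a} {A : Set a} (xs ys : List A) (f : A → ℕ) → ∑ (xs ++ ys) f ≡ ∑ xs f + ∑ ys f
∑-++ []       ys f = refl
∑-++ (x ∷ xs) ys f = trans (cong (f x +_) (∑-++ xs ys f)) (sym (+-assoc (f x) _ _))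

∑-cartesianProductWith : ∀ {a b c} {A : Set a} {B : Set b} {C : Set c} (g : A → B → C)
  (xs : List A) (ys : List B) (f : C → ℕ) →
  ∑ (cartesianProductWith g xs ys) f ≡ (∑[ x ← xs ] ∑[ y ← ys ] f (g x y))
∑-cartesianProductWith g []       ys f = refl
∑-cartesianProductWith g (x ∷ xs) ys f = trans (∑-++ (map (g x) ys) _ f)
  (cong₂ _+_ (∑-map (g x) ys f) (∑-cartesianProductWith g xs ys f))

-- Indicators of decidable propositions

ind : ∀ {p} {P : Set p} → Dec P → ℕ
ind P? = if does P? then 1 else 0

ind-yes : ∀ {p} {P : Set p} (P? : Dec P) → P → ind P? ≡ 1
ind-yes (yes _) _ = refl
ind-yes (no ¬p) p = contradiction p ¬p

ind-no : ∀ {p} {P : Set p} (P? : Dec P) → ¬ P → ind P? ≡ 0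
ind-no (yes p) ¬p = contradiction p ¬p
ind-no (no _)  _  = refl

ind≤1 : ∀ {p} {P : Set p} (P? : Dec P) → ind P? ≤ 1
ind≤1 (yes _) = ≤-refl
ind≤1 (no _)  = z≤n

ind-mono : ∀ {p q} {P : Set p} {Q : Set q} (P? : Dec P) (Q? : Dec Q) → (P → Q) → ind P? ≤ ind Q?
ind-mono (yes p) Q? f = ≤-reflexive (sym (ind-yes Q? (f p)))
ind-mono (no _)  Q? f = z≤n

ind-cong : ∀ {p q} {P : Set p} {Q : Set q} (P? : Dec P) (Q? : Dec Q) →
  (P → Q) → (Q → P) → ind P? ≡ ind Q?
ind-cong P? Q? f g = ≤-antisym (ind-mono P? Q? f) (ind-mono Q? P? g)

ind-elim : ∀ {p} {P : Set p} (P? : Dec P) {m n : ℕ} → (P → m ≤ n) → ind P? * m ≤ n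
ind-elim (yes p) {m} h = ≤-trans (≤-reflexive (*-identityˡ m)) (h p)
ind-elim (no _)  h = z≤n

∑-filter : ∀ {a p} {A : Set a} {P : Pred A p} (P? : Decidable P) (xs : List A) (f : A → ℕ) →
  ∑ (filter P? xs) f ≡ (∑[ x ← xs ] ind (P? x) * f x)
∑-filter P? []       f = refl
∑-filter P? (x ∷ xs) f with P? x
... | yes _ = cong₂ _+_ (sym (+-identityʳ (f x))) (∑-filter P? xs f)
... | no _  = ∑-filter P? xs f

length-∑ : ∀ {a} {A : Set a} (xs : List A) → length xs ≡ (∑[ _ ← xs ] 1)
length-∑ xs = sym (trans (∑-const xs 1) (*-identityʳ (length xs)))

length-filter-∑ : ∀ {a p} {A : Set a} {P : Pred A p} (P? : Decidable P) (xs : List A) →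
  length (filter P? xs) ≡ (∑[ x ← xs ] ind (P? x))
length-filter-∑ P? xs = trans (length-∑ (filter P? xs))
  (trans (∑-filter P? xs _) (∑-cong xs (λ x → *-identityʳ (ind (P? x)))))

-- Product weights on vectors

weight : ∀ {a} {A : Set a} → (A → ℕ) → ∀ {n} → Vec A n → ℕ
weight w []      = 1
weight w (x ∷ v) = w x * weight w v

∑-allVecs : ∀ {a} {A : Set a} (xs : List A) n (f : Vec A (suc n) → ℕ) →
  ∑ (allVecs xs (suc n)) f ≡ (∑[ x ← xs ] ∑[ v ← allVecs xs n ] f (x ∷ v))
∑-allVecs xs n f = ∑-cartesianProductWith _∷_ xs (allVecs xs n) f

∑-weight : ∀ {a} {A : Set a} (w : A → ℕ) (xs : List A) n (f : Vec A (suc n) → ℕ) →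
  (∑[ v ← allVecs xs (suc n) ] weight w v * f v)
    ≡ (∑[ x ← xs ] w x * (∑[ v ← allVecs xs n ] weight w v * f (x ∷ v)))
∑-weight w xs n f = trans (∑-allVecs xs n (λ v → weight w v * f v))
  (∑-cong xs λ x → trans (∑-cong (allVecs xs n) λ v → *-assoc (w x) (weight w v) (f (x ∷ v)))
    (∑-*ˡ (allVecs xs n) (w x) _))

∑-weight-1 : ∀ {a} {A : Set a} (w : A → ℕ) (xs : List A) n →
  ∑ (allVecs xs n) (weight w) ≡ ∑ xs w ^ n
∑-weight-1 w xs zero    = refl
∑-weight-1 w xs (suc n) = trans (∑-allVecs xs n (weight w))
  (trans (∑-cong xs λ x → trans (∑-*ˡ (allVecs xs n) (w x) (weight w))
            (cong (w x *_) (∑-weight-1 w xs n)))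
    (∑-*ʳ xs (∑ xs w ^ n) w))

-- Partial colorings and fragments

infix 4 _≼_ _≼?_ _⊑_ _⊑?_

data _≼_ {A : Set} : Maybe A → Maybe A → Set where
  nothing≼ : ∀ {y} → nothing ≼ y
  just≼    : ∀ {c} → just c ≼ just c

≼-refl : ∀ {A : Set} (x : Maybe A) → x ≼ x
≼-refl nothing  = nothing≼
≼-refl (just _) = just≼

≼-trans : ∀ {A : Set} {x y z : Maybe A} → x ≼ y → y ≼ z → x ≼ z
≼-trans nothing≼ _ = nothing≼
≼-trans just≼    p = p

_≼?_ : ∀ {q} (x y : Maybe (Fin q)) → Dec (x ≼ y)
nothing ≼? y       = yes nothing≼
just c  ≼? nothing = no λ ()
just c  ≼? just d with c Fin.≟ d
... | yes refl = yes just≼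
... | no c≢d   = no λ { just≼ → c≢d refl }

-- Both the colored edges and the random sets of revealed colored vertices are
-- partial colorings.
Partial : ℕ → ℕ → Set
Partial q N = Vec (Maybe (Fin q)) N

_⊑_ : ∀ {q N} → Partial q N → Partial q N → Set
g ⊑ h = ∀ x → lookup g x ≼ lookup h x

_⊑?_ : ∀ {q N} (g h : Partial q N) → Dec (g ⊑ h)
g ⊑? h = Fin.all? λ x → lookup g x ≼? lookup h x

⊑-trans : ∀ {q N} {g h k : Partial q N} → g ⊑ h → h ⊑ k → g ⊑ k
⊑-trans p r x = ≼-trans (p x) (r x)

size : ∀ {q N} → Partial q N → ℕ
size []            = 0
size (nothing ∷ g) = size g
size (just _ ∷ g)  = suc (size g)

⊑⇒size≤ : ∀ {q N} (g h : Partial q N) → g ⊑ h → size g ≤ size h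
⊑⇒size≤ []            []            p = z≤n
⊑⇒size≤ (nothing ∷ g) (nothing ∷ h) p = ⊑⇒size≤ g h (p ∘ suc)
⊑⇒size≤ (nothing ∷ g) (just _ ∷ h)  p = m≤n⇒m≤1+n (⊑⇒size≤ g h (p ∘ suc))
⊑⇒size≤ (just _ ∷ g)  (nothing ∷ h) p with () ← p zero
⊑⇒size≤ (just _ ∷ g)  (just _ ∷ h)  p = s≤s (⊑⇒size≤ g h (p ∘ suc))

⊑-antisym-size : ∀ {q N} (g h : Partial q N) → g ⊑ h → size h ≤ size g → h ⊑ g
⊑-antisym-size (nothing ∷ g) (nothing ∷ h) p s zero    = nothing≼
⊑-antisym-size (nothing ∷ g) (nothing ∷ h) p s (suc x) = ⊑-antisym-size g h (p ∘ suc) s x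
⊑-antisym-size (nothing ∷ g) (just _ ∷ h)  p s x =
  contradiction (≤-trans s (⊑⇒size≤ g h (p ∘ suc))) 1+n≰n
⊑-antisym-size (just _ ∷ g)  (nothing ∷ h) p s x with () ← p zero
⊑-antisym-size (just _ ∷ g)  (just _ ∷ h)  p s zero with just≼ ← p zero = just≼
⊑-antisym-size (just _ ∷ g)  (just _ ∷ h)  p s (suc x) = ⊑-antisym-size g h (p ∘ suc) (s≤s⁻¹ s) x

size≡0⇒⊑ : ∀ {q N} (g h : Partial q N) → size g ≡ 0 → g ⊑ h
size≡0⇒⊑ (nothing ∷ g) (_ ∷ h) s zero    = nothing≼
size≡0⇒⊑ (nothing ∷ g) (_ ∷ h) s (suc x) = size≡0⇒⊑ g h s x

empty : ∀ {q} N → Partial q N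
empty N = replicate N nothing

empty-⊑ : ∀ {q N} (h : Partial q N) → empty N ⊑ h
empty-⊑ {q} {N} h x = subst (_≼ lookup h x) (sym (lookup-replicate x (nothing {A = Fin q}))) nothing≼

size-empty : ∀ q N → size (empty {q} N) ≡ 0
size-empty q zero    = refl
size-empty q (suc N) = size-empty q N

-- A color in `x` survives also when `y` holds a different color: what is taken away is a colored
-- vertex, not a vertex.
remove : ∀ {q} → Maybe (Fin q) → Maybe (Fin q) → Maybe (Fin q)
remove x y with x ≼? y
... | yes _ = nothing
... | no _  = x

remove-≼ : ∀ {q} (x y : Maybe (Fin q)) → remove x y ≼ x
remove-≼ x y with x ≼? y
... | yes _ = nothing≼
... | no _  = ≼-refl x

remove-cover : ∀ {q} (x y : Maybe (Fin q)) → x ≼ y ⊎ x ≼ remove x y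
remove-cover x y with x ≼? y
... | yes p = inj₁ p
... | no _  = inj₂ (≼-refl x)

remove-min : ∀ {q} (x y z : Maybe (Fin q)) → x ≼ y ⊎ x ≼ z → remove x y ≼ z
remove-min x y z h with x ≼? y
remove-min x y z h        | yes _ = nothing≼
remove-min x y z (inj₁ p) | no ¬p = contradiction p ¬p
remove-min x y z (inj₂ p) | no _  = p

_∖_ : ∀ {q N} → Partial q N → Partial q N → Partial q N
_∖_ = zipWith remove

-- As sets of colored vertices, two partial colorings may have a union with two colors at one
-- vertex. Then the left color is kept, and `T ▷ W` serves as the union of `W` and `T`.
_▷_ : ∀ {q N} → Partial q N → Partial q N → Partial q N
_▷_ = zipWith _<∣>_

-- The true union of `W` and `T`, in which `g` may use either color of a vertex; no single partial
-- coloring records it.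
Covered : ∀ {q N} → Partial q N → Partial q N → Partial q N → Set
Covered g W T = ∀ x → lookup g x ≼ lookup W x ⊎ lookup g x ≼ lookup T x

Covered? : ∀ {q N} (g W T : Partial q N) → Dec (Covered g W T)
Covered? g W T = Fin.all? λ x → (lookup g x ≼? lookup W x) ⊎-dec (lookup g x ≼? lookup T x)

∖-⊑ : ∀ {q N} (g W : Partial q N) → (g ∖ W) ⊑ g
∖-⊑ g W x = subst (_≼ lookup g x) (sym (lookup-zipWith remove x g W)) (remove-≼ _ _)

∖-cover : ∀ {q N} (g W : Partial q N) → Covered g W (g ∖ W)
∖-cover g W x = subst (λ t → lookup g x ≼ lookup W x ⊎ lookup g x ≼ t)
  (sym (lookup-zipWith remove x g W)) (remove-cover _ _)

∖-min : ∀ {q N} (g W T : Partial q N) → Covered g W T → (g ∖ W) ⊑ T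
∖-min g W T h x = subst (_≼ lookup T x) (sym (lookup-zipWith remove x g W)) (remove-min _ _ _ (h x))

⊑-▷⇒cover : ∀ {q N} (g T W : Partial q N) → g ⊑ T ▷ W → Covered g W T
⊑-▷⇒cover g T W p x = case (lookup T x) (lookup W x) (subst (lookup g x ≼_) (lookup-zipWith _<∣>_ x T W) (p x))
  where
  case : ∀ {A : Set} {y : Maybe A} t w → y ≼ (t <∣> w) → y ≼ w ⊎ y ≼ t
  case nothing  w p = inj₁ p
  case (just _) w p = inj₂ p

-- Where `T` overrides `W`, its color is that of `h`, as `T` lies inside `h`; so no color that `h`
-- needs is overwritten.
cover⇒⊑-▷ : ∀ {q N} (h T W : Partial q N) → Covered h W T → (∀ x → lookup T x ≼ lookup h x) → h ⊑ T ▷ W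
cover⇒⊑-▷ g T W p r x = subst (lookup g x ≼_) (sym (lookup-zipWith _<∣>_ x T W))
  (case (lookup T x) (lookup W x) (p x) (r x))
  where
  case : ∀ {A : Set} {y : Maybe A} t w → y ≼ w ⊎ y ≼ t → t ≼ y → y ≼ (t <∣> w)
  case nothing  w (inj₁ p)        _     = p
  case nothing  w (inj₂ nothing≼) _     = nothing≼
  case (just _) w _               just≼ = just≼

module Fragments {A : Set} {q N : ℕ} (xs : List A) (ed : A → Partial q N) (W : Partial q N) where

  candidates : A → List A
  candidates a = filter (λ a′ → Covered? (ed a′) W (ed a)) xs

  chosen : A → A
  chosen a = argmin (λ a′ → size (ed a′ ∖ W)) a (candidates a)

  -- Park and Pham's minimum fragment: the smallest g′ ∖ W over all edges g′ ⊆ W ∪ ed a.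
  fragment : A → Partial q N
  fragment a = ed (chosen a) ∖ W

  chosen-spec : ∀ {a} → a ∈ xs → chosen a ∈ xs × Covered (ed (chosen a)) W (ed a)
  -- The default `a` of `argmin` is admissible as well, since `ed a` covers itself.
  chosen-spec {a} a∈ = argmin-all (λ a′ → size (ed a′ ∖ W)) {P = λ a′ → a′ ∈ xs × Covered (ed a′) W (ed a)}
    (a∈ , λ x → inj₂ (≼-refl _))
    (All.tabulate λ p → ∈-filter⁻ (λ a′ → Covered? (ed a′) W (ed a)) {xs = xs} p)

  chosen-min : ∀ {a} b → b ∈ xs → Covered (ed b) W (ed a) → size (fragment a) ≤ size (ed b ∖ W)
  chosen-min {a} b b∈ c = All.lookup (f[argmin]≤f[xs] a (candidates a))
    (∈-filter⁺ (λ a′ → Covered? (ed a′) W (ed a)) b∈ c)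

  fragment-⊑ : ∀ {a} → a ∈ xs → fragment a ⊑ ed a
  fragment-⊑ {a} a∈ = ∖-min (ed (chosen a)) W (ed a) (proj₂ (chosen-spec a∈))

  -- Otherwise ed b ∖ W, which lies inside the fragment, would be smaller.
  fragment-minimal : ∀ {a b} → a ∈ xs → b ∈ xs → ed b ⊑ fragment a ▷ W → fragment a ⊑ ed b
  fragment-minimal {a} {b} a∈ b∈ p = ⊑-trans {g = fragment a} {ed b ∖ W} {ed b}
    (⊑-antisym-size (ed b ∖ W) (fragment a) (∖-min (ed b) W (fragment a) cover) (chosen-min b b∈ cover′))
    (∖-⊑ (ed b) W)
    where
    cover : Covered (ed b) W (fragment a)
    cover = ⊑-▷⇒cover (ed b) (fragment a) W p
    cover′ : Covered (ed b) W (ed a)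
    cover′ x = [ inj₁ , (λ t → inj₂ (≼-trans t (fragment-⊑ a∈ x))) ] (cover x)

  chosen-cover : ∀ a → Covered (ed (chosen a)) W (fragment a)
  chosen-cover a = ∖-cover (ed (chosen a)) W

ind-× : ∀ {p q r} {P : Set p} {Q : Set q} {R : Set r} (P? : Dec P) (Q? : Dec Q) (R? : Dec R) →
  (P → Q) → (P → R) → ind P? ≤ ind Q? * ind R?
ind-× (yes p) Q? R? f g rewrite ind-yes Q? (f p) | ind-yes R? (g p) = ≤-refl
ind-× (no _)  Q? R? f g = z≤n

-- Weighted sums over partial colorings

∑-allFin : ∀ n (f : Fin (suc n) → ℕ) → ∑ (allFin (suc n)) f ≡ f zero + ∑ (allFin n) (f ∘ suc)
∑-allFin n f = cong (f zero +_) (trans (cong (λ ys → ∑ ys f) (sym (map-tabulate id suc)))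
  (∑-map suc (allFin n) f))

∑-allFin-const : ∀ n k → (∑[ _ ← allFin n ] k) ≡ n * k
∑-allFin-const n k = trans (∑-const (allFin n) k) (cong (_* k) (length-tabulate {n = n} id))

∑-δ : ∀ n (d : Fin n) → (∑[ c ← allFin n ] ind (c Fin.≟ d)) ≤ 1
∑-δ (suc n) zero = ≤-reflexive (trans (∑-allFin n (λ c → ind (c Fin.≟ zero))) (cong suc (∑-0 (allFin n))))
∑-δ (suc n) (suc d) = ≤-trans
  (≤-reflexive (∑-allFin n (λ c → ind (c Fin.≟ suc d))))
  (≤-trans (∑-mono (allFin n) λ c _ → ind-mono (suc c Fin.≟ suc d) (c Fin.≟ d) Fin.suc-injective) (∑-δ n d))

states : ∀ q → List (Maybe (Fin q))
states q = nothing ∷ map just (allFin q)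

∑-states : ∀ q (f : Maybe (Fin q) → ℕ) → ∑ (states q) f ≡ f nothing + (∑[ c ← allFin q ] f (just c))
∑-states q f = cong (f nothing +_) (∑-map just (allFin q) f)

partials : ∀ q N → List (Partial q N)
partials q N = allVecs (states q) N

∈-states : ∀ {q} (x : Maybe (Fin q)) → x ∈ states q
∈-states nothing  = here refl
∈-states (just c) = there (∈-map⁺ just (∈-allFin c))

∈-partials : ∀ {q N} (g : Partial q N) → g ∈ partials q N
∈-partials []      = here refl
∈-partials (x ∷ g) = ∈-cartesianProductWith⁺ _∷_ (∈-states x) (∈-partials g)

-- The weight α per color and β for nothing; normalized by β + q α, a vertex is
-- colored with probability q α / (β + q α).
stateWeight : ∀ {q} → ℕ → ℕ → Maybe (Fin q) → ℕ
stateWeight α β nothing  = β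
stateWeight α β (just _) = α

wt : ∀ {q N} → ℕ → ℕ → Partial q N → ℕ
wt α β = weight (stateWeight α β)

∑-stateWeight : ∀ q α β → ∑ (states q) (stateWeight α β) ≡ β + q * α
∑-stateWeight q α β = trans (∑-states q _) (cong (β +_) (∑-allFin-const q α))

∑-wt : ∀ q N α β → ∑ (partials q N) (wt α β) ≡ (β + q * α) ^ N
∑-wt q N α β = trans (∑-weight-1 (stateWeight α β) (states q) N) (cong (_^ N) (∑-stateWeight q α β))

-- Vertex by vertex, `T` has two states to choose from where `g` is colored, and one elsewhere.
∑-⊑ : ∀ {q N} (g : Partial q N) → (∑[ T ← partials q N ] ind (T ⊑? g)) ≤ 2 ^ size g
∑-⊑ {q} {zero}  []      = ≤-refl
∑-⊑ {q} {suc N} (x ∷ g) = begin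
  (∑[ T ← partials q (suc N) ] ind (T ⊑? (x ∷ g)))
    ≡⟨ ∑-allVecs (states q) N _ ⟩
  (∑[ t ← states q ] ∑[ T ← partials q N ] ind ((t ∷ T) ⊑? (x ∷ g)))
    ≤⟨ ∑-mono (states q) (λ t _ → ∑-mono (partials q N) λ T _ →
         ind-× ((t ∷ T) ⊑? (x ∷ g)) (t ≼? x) (T ⊑? g) (λ p → p zero) (_∘ suc)) ⟩
  (∑[ t ← states q ] ∑[ T ← partials q N ] (ind (t ≼? x) * ind (T ⊑? g)))
    ≡⟨ ∑-cong (states q) (λ t → ∑-*ˡ (partials q N) (ind (t ≼? x)) _) ⟩
  (∑[ t ← states q ] (ind (t ≼? x) * (∑[ T ← partials q N ] ind (T ⊑? g))))
    ≡⟨ ∑-*ʳ (states q) _ (λ t → ind (t ≼? x)) ⟩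
  (∑[ t ← states q ] ind (t ≼? x)) * (∑[ T ← partials q N ] ind (T ⊑? g))
    ≤⟨ *-mono-≤ (first x) (∑-⊑ g) ⟩
  (2 ^ size (x ∷ [])) * 2 ^ size g
    ≡⟨ combine x ⟩
  2 ^ size (x ∷ g)
    ∎
  where
  open ≤-Reasoning
  first : ∀ x → (∑[ t ← states q ] ind (t ≼? x)) ≤ 2 ^ size (x ∷ [])
  first nothing  = ≤-reflexive (trans (∑-states q (λ t → ind (t ≼? nothing))) (cong suc (∑-0 (allFin q))))
  first (just d) = ≤-trans (≤-reflexive (∑-states q (λ t → ind (t ≼? just d))))
    (s≤s (≤-trans (∑-mono (allFin q) λ c _ → ind-mono (just c ≼? just d) (c Fin.≟ d) λ { just≼ → refl }) (∑-δ q d)))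
  combine : ∀ x → 2 ^ size (x ∷ []) * 2 ^ size g ≡ 2 ^ size (x ∷ g)
  combine nothing  = *-identityˡ _
  combine (just _) = refl

-- A given `Z` extending `T` equals `T ▷ W` for all `W` that agree with it outside `T`. Their
-- weights add up to the weight of `Z` with its factor `α ^ size T` replaced by the same power of
-- the total weight `β + q * α` of a vertex.
∑-overwrite : ∀ {q N} α β (T : Partial q N) (f : Partial q N → ℕ) →
  α ^ size T * (∑[ W ← partials q N ] wt α β W * f (T ▷ W))
    ≤ (β + q * α) ^ size T * (∑[ Z ← partials q N ] wt α β Z * f Z)
∑-overwrite {q} {zero}  α β []            f = ≤-refl
∑-overwrite {q} {suc N} α β (nothing ∷ T) f = begin
  α ^ size T * (∑[ W ← partials q (suc N) ] wt α β W * f ((nothing ∷ T) ▷ W))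
    ≡⟨ cong (α ^ size T *_) (∑-weight (stateWeight α β) (states q) N _) ⟩
  α ^ size T * (∑[ w ← states q ] stateWeight α β w * (∑[ W ← partials q N ] wt α β W * f (w ∷ (T ▷ W))))
    ≡⟨ ∑-*ˡ (states q) (α ^ size T) _ ⟨
  (∑[ w ← states q ] α ^ size T * (stateWeight α β w * (∑[ W ← partials q N ] wt α β W * f (w ∷ (T ▷ W)))))
    ≤⟨ ∑-mono (states q) (λ w _ → begin
         α ^ size T * (stateWeight α β w * (∑[ W ← partials q N ] wt α β W * f (w ∷ (T ▷ W))))
           ≡⟨ x∙yz≈y∙xz (α ^ size T) (stateWeight α β w) _ ⟩
         stateWeight α β w * (α ^ size T * (∑[ W ← partials q N ] wt α β W * f (w ∷ (T ▷ W))))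
           ≤⟨ *-monoʳ-≤ (stateWeight α β w) (∑-overwrite α β T (f ∘ (w ∷_))) ⟩
         stateWeight α β w * ((β + q * α) ^ size T * (∑[ Z ← partials q N ] wt α β Z * f (w ∷ Z)))
           ≡⟨ x∙yz≈y∙xz (stateWeight α β w) ((β + q * α) ^ size T) _ ⟩
         (β + q * α) ^ size T * (stateWeight α β w * (∑[ Z ← partials q N ] wt α β Z * f (w ∷ Z)))
           ∎) ⟩
  (∑[ w ← states q ] (β + q * α) ^ size T * (stateWeight α β w * (∑[ Z ← partials q N ] wt α β Z * f (w ∷ Z))))
    ≡⟨ ∑-*ˡ (states q) ((β + q * α) ^ size T) _ ⟩
  (β + q * α) ^ size T * (∑[ w ← states q ] stateWeight α β w * (∑[ Z ← partials q N ] wt α β Z * f (w ∷ Z)))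
    ≡⟨ cong ((β + q * α) ^ size T *_) (∑-weight (stateWeight α β) (states q) N _) ⟨
  (β + q * α) ^ size T * (∑[ Z ← partials q (suc N) ] wt α β Z * f Z)
    ∎
  where
  open ≤-Reasoning
∑-overwrite {q} {suc N} α β (just d ∷ T)  f = begin
  α ^ suc (size T) * (∑[ W ← partials q (suc N) ] wt α β W * f ((just d ∷ T) ▷ W))
    ≡⟨ cong (α ^ suc (size T) *_) (∑-weight (stateWeight α β) (states q) N _) ⟩
  α ^ suc (size T) * (∑[ w ← states q ] stateWeight α β w * X)
    ≡⟨ cong (α ^ suc (size T) *_) (trans (∑-*ʳ (states q) X (stateWeight α β)) (cong (_* X) (∑-stateWeight q α β))) ⟩
  α ^ suc (size T) * (τ * X)
    ≡⟨ rearrange α (α ^ size T) τ X ⟩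
  α * (τ * (α ^ size T * X))
    ≤⟨ *-monoʳ-≤ α (*-monoʳ-≤ τ (∑-overwrite α β T (f ∘ (just d ∷_)))) ⟩
  α * (τ * (τ ^ size T * Z (just d)))
    ≡⟨ rearrange′ α τ (τ ^ size T) (Z (just d)) ⟩
  τ ^ suc (size T) * (α * Z (just d))
    -- Of the states of this vertex, only the color `d` of `T` is kept.
    ≤⟨ *-monoʳ-≤ (τ ^ suc (size T)) (∑-∈ (λ w → stateWeight α β w * Z w) (∈-states (just d))) ⟩
  τ ^ suc (size T) * (∑[ w ← states q ] stateWeight α β w * Z w)
    ≡⟨ cong (τ ^ suc (size T) *_) (∑-weight (stateWeight α β) (states q) N f) ⟨
  τ ^ suc (size T) * (∑[ Z ← partials q (suc N) ] wt α β Z * f Z)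
    ∎
  where
  open ≤-Reasoning
  τ X : ℕ
  τ = β + q * α
  X = ∑[ W ← partials q N ] wt α β W * f (just d ∷ (T ▷ W))
  Z : Maybe (Fin q) → ℕ
  Z w = ∑[ Z ← partials q N ] wt α β Z * f (w ∷ Z)
  rearrange : ∀ a b t x → a * b * (t * x) ≡ a * (t * (b * x))
  rearrange = solve-∀
  rearrange′ : ∀ a t s z → a * (t * (s * z)) ≡ t * s * (a * z)
  rearrange′ = solve-∀

-- One round: the cost of large fragments

^-distrib-* : ∀ n m k → (m * k) ^ n ≡ m ^ n * k ^ n
^-distrib-* zero    m k = refl
^-distrib-* (suc n) m k = trans (cong (m * k *_) (^-distrib-* n m k)) ([m*n]*[o*p]≡[m*o]*[n*p] m k (m ^ n) (k ^ n))

-- A list of partial colorings ed a with multiplicities μ a.  Relative to μ₀ the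
-- total multiplicity of those extending T is at most (B / K) ^ size T.
record Family (q N K B μ₀ b : ℕ) : Set₁ where
  field
    {Index} : Set
    indices : List Index
    μ       : Index → ℕ
    ed      : Index → Partial q N
    bounded : ∀ a → a ∈ indices → size (ed a) ≤ b
    spread  : ∀ T → (∑[ a ← indices ] ind (T ⊑? ed a) * μ a) * K ^ size T ≤ μ₀ * B ^ size T

module Round {q N K B μ₀ b : ℕ} (F : Family q N K B μ₀ b) where
  open Family F

  mass : ℕ
  mass = ∑ indices μ

  Hit : Partial q N → Set
  Hit W = Any (λ a → ed a ⊑ W) indices

  hit? : ∀ W → Dec (Hit W)
  hit? W = any? (λ a → ed a ⊑? W) indices

  miss : Partial q N → ℕ
  miss W = ind (¬? (hit? W))

  missWeight : ℕ → ℕ → ℕ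
  missWeight α β = ∑[ W ← partials q N ] wt α β W * miss W

  -- Spread at the empty partial coloring, which every edge extends.
  mass≤ : mass ≤ μ₀
  mass≤ = begin
    mass
      ≡⟨ ∑-cong indices (λ a → sym (trans (cong (_* μ a) (ind-yes (empty N ⊑? ed a) (empty-⊑ (ed a)))) (*-identityˡ (μ a)))) ⟩
    S
      ≡⟨ *-identityʳ S ⟨
    S * K ^ 0
      ≡⟨ cong (λ t → S * K ^ t) (size-empty q N) ⟨
    S * K ^ size (empty {q} N)
      ≤⟨ spread (empty N) ⟩
    μ₀ * B ^ size (empty {q} N)
      ≡⟨ cong (λ t → μ₀ * B ^ t) (size-empty q N) ⟩
    μ₀ * 1
      ≡⟨ *-identityʳ μ₀ ⟩
    μ₀ ∎
    where
    open ≤-Reasoning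
    S = ∑[ a ← indices ] ind (empty N ⊑? ed a) * μ a

  -- Some edge inside `Z`, found from `Z` alone: this is what makes a fragment recoverable from its
  -- union with `W`. The default `empty N` respects the size bound. The decision is an argument so
  -- that proofs can split on it.
  pickFrom : ∀ {Z} → Dec (Hit Z) → Partial q N
  pickFrom (yes h) = ed (proj₁ (find h))
  pickFrom (no _)  = empty N

  pick : Partial q N → Partial q N
  pick Z = pickFrom {Z} (hit? Z)

  size-pick : ∀ Z → size (pick Z) ≤ b
  size-pick Z = go (hit? Z)
    where
    go : (d : Dec (Hit Z)) → size (pickFrom {Z} d) ≤ b
    go (yes h) = bounded _ (proj₁ (proj₂ (find h)))
    go (no _)  = ≤-trans (≤-reflexive (size-empty q N)) z≤n

  pick-spec : ∀ Z → Hit Z → ∃[ a ] (a ∈ indices × ed a ⊑ Z × pick Z ≡ ed a)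
  pick-spec Z h = go (hit? Z)
    where
    go : (d : Dec (Hit Z)) → ∃[ a ] (a ∈ indices × ed a ⊑ Z × pickFrom {Z} d ≡ ed a)
    go (yes h′) = let (a , a∈ , p) = find h′ in a , a∈ , p , refl
    go (no ¬h)  = contradiction h ¬h

  open Fragments indices ed public

  -- The union of the fragment and `W` contains the chosen edge, so `pick` does find an edge there.
  -- Whichever edge that is, minimality places the fragment inside it.
  fragment-⊑-pick : ∀ W {a} → a ∈ indices → fragment W a ⊑ pick (fragment W a ▷ W)
  fragment-⊑-pick W {a} a∈ with pick-spec (fragment W a ▷ W)
    (lose (proj₁ (chosen-spec W a∈))
      (cover⇒⊑-▷ (ed (chosen W a)) (fragment W a) W (chosen-cover W a) (∖-⊑ (ed (chosen W a)) W)))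
  ... | b , b∈ , p , eq = subst (fragment W a ⊑_) (sym eq) (fragment-minimal W a∈ b∈ p)

  -- By `dense`, a given colored vertex is revealed with probability α / (β + q α), at least c times
  -- the spread ratio B / K.
  module _ (α β c : ℕ) .{{_ : NonZero K}} .{{_ : NonZero (β + q * α)}}
           (dense : c * B * (β + q * α) ≤ α * K) where

    private
      τ : ℕ
      τ = β + q * α
      Σₚ : (Partial q N → ℕ) → ℕ
      Σₚ = ∑ (partials q N)
      G : Partial q N → ℕ
      G T = ∑[ a ← indices ] ind (T ⊑? ed a) * μ a
      I : Partial q N → Partial q N → ℕ
      I T Z = ind (T ⊑? pick Z)

    weighted-spread : ∀ T → τ ^ size T * (c ^ size T * G T) ≤ μ₀ * α ^ size T
    weighted-spread T = *-cancelʳ-≤ _ _ (K ^ t) {{m^n≢0 K t}} (begin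
      τ ^ t * (c ^ t * G T) * K ^ t
        ≡⟨ r₁ (τ ^ t) (c ^ t) (G T) (K ^ t) ⟩
      τ ^ t * c ^ t * (G T * K ^ t)
        ≤⟨ *-monoʳ-≤ (τ ^ t * c ^ t) (spread T) ⟩
      τ ^ t * c ^ t * (μ₀ * B ^ t)
        ≡⟨ r₂ (τ ^ t) (c ^ t) μ₀ (B ^ t) ⟩
      μ₀ * (c ^ t * B ^ t * τ ^ t)
        ≡⟨ cong (μ₀ *_) (trans (cong (_* τ ^ t) (sym (^-distrib-* t c B))) (sym (^-distrib-* t (c * B) τ))) ⟩
      μ₀ * (c * B * τ) ^ t
        ≤⟨ *-monoʳ-≤ μ₀ (^-monoˡ-≤ t dense) ⟩
      μ₀ * (α * K) ^ t
        ≡⟨ cong (μ₀ *_) (^-distrib-* t α K) ⟩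
      μ₀ * (α ^ t * K ^ t)
        ≡⟨ *-assoc μ₀ (α ^ t) (K ^ t) ⟨
      μ₀ * α ^ t * K ^ t ∎)
      where
      open ≤-Reasoning
      t = size T
      r₁ : ∀ a b g k → a * (b * g) * k ≡ a * b * (g * k)
      r₁ = solve-∀
      r₂ : ∀ a b m k → a * b * (m * k) ≡ m * (b * k * a)
      r₂ = solve-∀

    -- Overwriting by `T` costs the factor `(τ / α) ^ size T`. By `weighted-spread`, the mass of the
    -- edges above `T` is below `μ₀` by the same factor, with `c ^ size T` to spare.
    term-bound : ∀ T → (Σₚ λ W → wt α β W * I T (T ▷ W)) * (c ^ size T * G T)
      ≤ μ₀ * (Σₚ λ Z → wt α β Z * I T Z)
    term-bound T = *-cancelˡ-≤ (τ ^ t) {{m^n≢0 τ t}} (begin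
      τ ^ t * (X * (c ^ t * G T))
        ≡⟨ r₁ (τ ^ t) X (c ^ t * G T) ⟩
      X * (τ ^ t * (c ^ t * G T))
        ≤⟨ *-monoʳ-≤ X (weighted-spread T) ⟩
      X * (μ₀ * α ^ t)
        ≡⟨ r₂ X μ₀ (α ^ t) ⟩
      μ₀ * (α ^ t * X)
        ≤⟨ *-monoʳ-≤ μ₀ (∑-overwrite α β T (I T)) ⟩
      μ₀ * (τ ^ t * Y)
        ≡⟨ r₁ μ₀ (τ ^ t) Y ⟩
      τ ^ t * (μ₀ * Y) ∎)
      where
      open ≤-Reasoning
      t = size T
      X = Σₚ λ W → wt α β W * I T (T ▷ W)
      Y = Σₚ λ Z → wt α β Z * I T Z
      r₁ : ∀ a x y → a * (x * y) ≡ x * (a * y)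
      r₁ = solve-∀
      r₂ : ∀ x m a → x * (m * a) ≡ m * (a * x)
      r₂ = solve-∀

    -- The pair (W , T) with T = fragment W a is recovered from Z = T ▷ W and the
    -- subset T of pick Z, for which there are at most 2 ^ b choices.
    fragment-cost : (Σₚ λ W → wt α β W * (∑[ a ← indices ] c ^ size (fragment W a) * μ a))
      ≤ μ₀ * τ ^ N * 2 ^ b
    fragment-cost = begin
      (Σₚ λ W → wt α β W * (∑[ a ← indices ] c ^ size (fragment W a) * μ a))
        ≤⟨ ∑-mono (partials q N) (λ W _ → *-monoʳ-≤ (wt α β W) (pointwise W)) ⟩
      (Σₚ λ W → wt α β W * (Σₚ λ T → I T (T ▷ W) * (c ^ size T * G T)))
        ≡⟨ ∑-cong (partials q N) (λ W → trans (sym (∑-*ˡ (partials q N) (wt α β W) _))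
             (∑-cong (partials q N) λ T → sym (*-assoc (wt α β W) (I T (T ▷ W)) (c ^ size T * G T)))) ⟩
      (Σₚ λ W → Σₚ λ T → wt α β W * I T (T ▷ W) * (c ^ size T * G T))
        ≡⟨ ∑-swap (partials q N) (partials q N) _ ⟩
      (Σₚ λ T → Σₚ λ W → wt α β W * I T (T ▷ W) * (c ^ size T * G T))
        ≡⟨ ∑-cong (partials q N) (λ T → ∑-*ʳ (partials q N) (c ^ size T * G T) (λ W → wt α β W * I T (T ▷ W))) ⟩
      (Σₚ λ T → (Σₚ λ W → wt α β W * I T (T ▷ W)) * (c ^ size T * G T))
        ≤⟨ ∑-mono (partials q N) (λ T _ → term-bound T) ⟩
      (Σₚ λ T → μ₀ * (Σₚ λ Z → wt α β Z * I T Z))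
        ≡⟨ ∑-*ˡ (partials q N) μ₀ _ ⟩
      μ₀ * (Σₚ λ T → Σₚ λ Z → wt α β Z * I T Z)
        ≡⟨ cong (μ₀ *_) (trans (∑-swap (partials q N) (partials q N) _)
             (∑-cong (partials q N) λ Z → ∑-*ˡ (partials q N) (wt α β Z) _)) ⟩
      μ₀ * (Σₚ λ Z → wt α β Z * (Σₚ λ T → I T Z))
        ≤⟨ *-monoʳ-≤ μ₀ (∑-mono (partials q N) λ Z _ → *-monoʳ-≤ (wt α β Z)
             (≤-trans (∑-⊑ (pick Z)) (^-monoʳ-≤ 2 (size-pick Z)))) ⟩
      μ₀ * (Σₚ λ Z → wt α β Z * 2 ^ b)
        ≡⟨ cong (μ₀ *_) (trans (∑-*ʳ (partials q N) (2 ^ b) (wt α β)) (cong (_* 2 ^ b) (∑-wt q N α β))) ⟩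
      μ₀ * (τ ^ N * 2 ^ b)
        ≡⟨ *-assoc μ₀ (τ ^ N) (2 ^ b) ⟨
      μ₀ * τ ^ N * 2 ^ b ∎
      where
      open ≤-Reasoning
      -- Every edge is charged to its own fragment, for which both indicators in `h` are 1. Summing
      -- over all `T` instead and exchanging the sums, the edges above `T` contribute `G T`.
      pointwise : ∀ W → (∑[ a ← indices ] c ^ size (fragment W a) * μ a)
        ≤ (Σₚ λ T → I T (T ▷ W) * (c ^ size T * G T))
      pointwise W = begin
        (∑[ a ← indices ] c ^ size (fragment W a) * μ a)
          ≤⟨ ∑-mono indices (λ a a∈ → ≤-trans (single a a∈) (∑-∈ (h a) (∈-partials (fragment W a)))) ⟩
        (∑[ a ← indices ] Σₚ (h a))
          ≡⟨ ∑-swap indices (partials q N) h ⟩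
        (Σₚ λ T → ∑[ a ← indices ] h a T)
          ≡⟨ ∑-cong (partials q N) (λ T → trans (∑-*ˡ indices (I T (T ▷ W)) _)
               (cong (I T (T ▷ W) *_) (∑-*ˡ indices (c ^ size T) _))) ⟩
        (Σₚ λ T → I T (T ▷ W) * (c ^ size T * G T)) ∎
        where
        h : Index → Partial q N → ℕ
        h a T = I T (T ▷ W) * (c ^ size T * (ind (T ⊑? ed a) * μ a))
        single : ∀ a → a ∈ indices → c ^ size (fragment W a) * μ a ≤ h a (fragment W a)
        single a a∈ = ≤-reflexive (sym (trans
          (cong (_* (c ^ size T * (ind (T ⊑? ed a) * μ a))) (ind-yes (T ⊑? pick (T ▷ W)) (fragment-⊑-pick W a∈)))
          (trans (*-identityˡ _) (cong (c ^ size T *_)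
            (trans (cong (_* μ a) (ind-yes (T ⊑? ed a) (fragment-⊑ W a∈))) (*-identityˡ (μ a)))))))
          where T = fragment W a

-- Merging two rounds

∑-exchange : ∀ {a b} {A : Set a} {B : Set b} (xs : List A) (ys : List B) (f : A → ℕ) (g : B → ℕ) (h : A → B → ℕ) →
  (∑[ x ← xs ] f x * (∑[ y ← ys ] g y * h x y)) ≡ (∑[ y ← ys ] g y * (∑[ x ← xs ] f x * h x y))
∑-exchange xs ys f g h = begin
  (∑[ x ← xs ] f x * (∑[ y ← ys ] g y * h x y))
    ≡⟨ ∑-cong xs (λ x → ∑-*ˡ ys (f x) _) ⟨
  (∑[ x ← xs ] ∑[ y ← ys ] f x * (g y * h x y))
    ≡⟨ ∑-swap xs ys _ ⟩
  (∑[ y ← ys ] ∑[ x ← xs ] f x * (g y * h x y))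
    ≡⟨ ∑-cong ys (λ y → trans (∑-cong xs λ x → x∙yz≈y∙xz (f x) (g y) (h x y)) (∑-*ˡ xs (g y) _)) ⟩
  (∑[ y ← ys ] g y * (∑[ x ← xs ] f x * h x y)) ∎
  where
  open ≡-Reasoning

-- Satisfied by the indicator of a miss: an edge has at most one color at `x`, so that it is covered
-- through `u` or through `v`. In both factors the color stands in the first argument, so that one
-- function of a single state is evaluated twice.
Splits : ∀ {q N} → (Partial q N → Partial q N → ℕ) → Set
Splits f = ∀ x W V u v →
  f (W [ x ]≔ u) (V [ x ]≔ v) ≡ f (W [ x ]≔ u) (V [ x ]≔ nothing) * f (W [ x ]≔ v) (V [ x ]≔ nothing)

-- With D the number of colors c with d (just c) = 1, the two sides
-- differ by α₁ α₂ (q − D)² if d nothing = 1, and vanish otherwise.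
merge-vertex : ∀ {q} α₁ α₂ β (d : Maybe (Fin q) → ℕ) →
  (∀ u → d u ≤ 1) → (∀ u → d u ≡ d u * d nothing) →
  (β + q * (α₁ + α₂)) * (∑[ w ← states q ] stateWeight (α₁ + α₂) β w * d w)
    ≤ (∑[ u ← states q ] stateWeight α₁ (β + q * α₂) u *
        (∑[ v ← states q ] stateWeight α₂ (β + q * α₁) v * (d u * d v)))
merge-vertex {q} α₁ α₂ β d d≤1 d-idem = begin
  τ * (∑[ w ← states q ] stateWeight (α₁ + α₂) β w * d w)
    ≡⟨ cong (τ *_) (S≡ (α₁ + α₂) β) ⟩
  τ * (β * e + (α₁ + α₂) * D)
    ≤⟨ main e refl (d≤1 nothing) ⟩
  ((β + q * α₂) * e + α₁ * D) * ((β + q * α₁) * e + α₂ * D)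
    ≡⟨ cong₂ _*_ (S≡ α₁ (β + q * α₂)) (S≡ α₂ (β + q * α₁)) ⟨
  (∑[ u ← states q ] stateWeight α₁ (β + q * α₂) u * d u) *
    (∑[ v ← states q ] stateWeight α₂ (β + q * α₁) v * d v)
    ≡⟨ ∑-*ʳ (states q) S₂ (λ u → stateWeight α₁ (β + q * α₂) u * d u) ⟨
  (∑[ u ← states q ] (stateWeight α₁ (β + q * α₂) u * d u) * S₂)
    ≡⟨ ∑-cong (states q) (λ u → trans (*-assoc (stateWeight α₁ (β + q * α₂) u) (d u) S₂)
         (cong (stateWeight α₁ (β + q * α₂) u *_) (trans (sym (∑-*ˡ (states q) (d u) _))
           (∑-cong (states q) λ v → x∙yz≈y∙xz (d u) (stateWeight α₂ (β + q * α₁) v) (d v))))) ⟩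
  (∑[ u ← states q ] stateWeight α₁ (β + q * α₂) u *
    (∑[ v ← states q ] stateWeight α₂ (β + q * α₁) v * (d u * d v))) ∎
  where
  open ≤-Reasoning
  τ e D S₂ : ℕ
  τ = β + q * (α₁ + α₂)
  e = d nothing
  D = ∑[ c ← allFin q ] d (just c)
  S₂ = ∑[ v ← states q ] stateWeight α₂ (β + q * α₁) v * d v
  S≡ : ∀ α β → (∑[ w ← states q ] stateWeight α β w * d w) ≡ β * e + α * D
  S≡ α β = trans (∑-states q λ w → stateWeight α β w * d w) (cong (β * e +_) (∑-*ˡ (allFin q) α (d ∘ just)))
  D≤q : D ≤ q
  D≤q = ≤-trans (∑-mono (allFin q) λ c _ → d≤1 (just c)) (≤-reflexive (trans (∑-allFin-const q 1) (*-identityʳ q)))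
  -- Here `r` stands for `q ∸ D`; the last summand on the left is what the inequality gives away.
  square : ∀ α₁ α₂ β D r →
    (β * 1 + (α₁ + α₂) * D) * (β + (D + r) * (α₁ + α₂)) + α₁ * α₂ * (r * r)
      ≡ ((β + (D + r) * α₂) * 1 + α₁ * D) * ((β + (D + r) * α₁) * 1 + α₂ * D)
  square = solve-∀
  main : ∀ e₀ → e ≡ e₀ → e₀ ≤ 1 → τ * (β * e₀ + (α₁ + α₂) * D)
    ≤ ((β + q * α₂) * e₀ + α₁ * D) * ((β + q * α₁) * e₀ + α₂ * D)
  -- By `d-idem`, `d` vanishes everywhere if it vanishes at `nothing`: for misses, a hit without
  -- this vertex remains a hit.
  main zero eq _ = ≤-trans (≤-reflexive (trans (cong (τ *_) (cong₂ _+_ (*-zeroʳ β)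
      (trans (cong ((α₁ + α₂) *_) D≡0) (*-zeroʳ (α₁ + α₂))))) (*-zeroʳ τ))) z≤n
    where
    D≡0 : D ≡ 0
    D≡0 = trans
      (∑-cong (allFin q) λ c → trans (d-idem (just c)) (trans (cong (d (just c) *_) eq) (*-zeroʳ (d (just c)))))
      (∑-0 (allFin q))
  main (suc zero) _ _ = subst (λ q → (β + q * (α₁ + α₂)) * (β * 1 + (α₁ + α₂) * D)
      ≤ ((β + q * α₂) * 1 + α₁ * D) * ((β + q * α₁) * 1 + α₂ * D)) (m+[n∸m]≡n D≤q)
      (≤-trans (≤-trans (≤-reflexive (*-comm (β + (D + (q ∸ D)) * (α₁ + α₂)) _)) (m≤m+n _ _))
        (≤-reflexive (square α₁ α₂ β D (q ∸ D))))
  main (suc (suc _)) _ (s≤s ())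

-- Revealing each vertex once at the rate α₁ + α₂ hits more often than revealing it
-- independently at the rates α₁ and α₂.
merge : ∀ {q N} α₁ α₂ β (f : Partial q N → Partial q N → ℕ) → (∀ W V → f W V ≤ 1) → Splits f →
  (β + q * (α₁ + α₂)) ^ N * (∑[ W ← partials q N ] wt (α₁ + α₂) β W * f W (empty N))
    ≤ (∑[ W ← partials q N ] wt α₁ (β + q * α₂) W *
        (∑[ V ← partials q N ] wt α₂ (β + q * α₁) V * f W V))
merge {q} {zero}  α₁ α₂ β f f≤1 sp = ≤-reflexive (base (f [] []))
  where
  base : ∀ y → 1 * (1 * y + 0) ≡ 1 * (1 * y + 0) + 0
  base = solve-∀
merge {q} {suc N} α₁ α₂ β f f≤1 sp = begin
  τ * τ ^ N * (∑[ W ← partials q (suc N) ] wt (α₁ + α₂) β W * f W (empty (suc N)))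
    ≡⟨ cong (τ * τ ^ N *_) (∑-weight s (states q) N _) ⟩
  τ * τ ^ N * (∑[ w ← states q ] s w * (∑[ W ← Ps ] wt (α₁ + α₂) β W * f (w ∷ W) (nothing ∷ empty N)))
    ≡⟨ trans (*-assoc τ (τ ^ N) _) (cong (τ *_) (trans (sym (∑-*ˡ (states q) (τ ^ N) _))
         (∑-cong (states q) λ w → x∙yz≈y∙xz (τ ^ N) (s w) _))) ⟩
  τ * (∑[ w ← states q ] s w * (τ ^ N * (∑[ W ← Ps ] wt (α₁ + α₂) β W * f (w ∷ W) (nothing ∷ empty N))))
    -- The other vertices are split by induction while the first one keeps its merged state `w`.
    -- After the sums are exchanged, `W` and `V` are fixed and the first vertex is split by
    -- `merge-vertex`.
    ≤⟨ *-monoʳ-≤ τ (∑-mono (states q) λ w _ → *-monoʳ-≤ (s w)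
         (merge α₁ α₂ β (λ W V → f (w ∷ W) (nothing ∷ V)) (λ W V → f≤1 (w ∷ W) (nothing ∷ V))
           (λ x W V → sp (suc x) (w ∷ W) (nothing ∷ V)))) ⟩
  τ * (∑[ w ← states q ] s w * (∑[ W ← Ps ] wt₁ W * (∑[ V ← Ps ] wt₂ V * f (w ∷ W) (nothing ∷ V))))
    ≡⟨ cong (τ *_) (trans (∑-exchange (states q) Ps s wt₁ _)
         (∑-cong Ps λ W → cong (wt₁ W *_) (∑-exchange (states q) Ps s wt₂ _))) ⟩
  τ * (∑[ W ← Ps ] wt₁ W * (∑[ V ← Ps ] wt₂ V * (∑[ w ← states q ] s w * f (w ∷ W) (nothing ∷ V))))
    ≡⟨ trans (sym (∑-*ˡ Ps τ _)) (∑-cong Ps λ W → trans (x∙yz≈y∙xz τ (wt₁ W) _)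
         (cong (wt₁ W *_) (trans (sym (∑-*ˡ Ps τ _)) (∑-cong Ps λ V → x∙yz≈y∙xz τ (wt₂ V) _)))) ⟩
  (∑[ W ← Ps ] wt₁ W * (∑[ V ← Ps ] wt₂ V * (τ * (∑[ w ← states q ] s w * f (w ∷ W) (nothing ∷ V)))))
    ≤⟨ ∑-mono Ps (λ W _ → *-monoʳ-≤ (wt₁ W) (∑-mono Ps λ V _ → *-monoʳ-≤ (wt₂ V) (vertex W V))) ⟩
  (∑[ W ← Ps ] wt₁ W * (∑[ V ← Ps ] wt₂ V * (∑[ u ← states q ] s₁ u * (∑[ v ← states q ] s₂ v * f (u ∷ W) (v ∷ V)))))
    ≡⟨ ∑-cong Ps (λ W → cong (wt₁ W *_) (trans (sym (∑-exchange (states q) Ps s₁ wt₂ _))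
         (∑-cong (states q) λ u → cong (s₁ u *_) (sym (∑-exchange (states q) Ps s₂ wt₂ _))))) ⟩
  (∑[ W ← Ps ] wt₁ W * (∑[ u ← states q ] s₁ u * (∑[ v ← states q ] s₂ v * (∑[ V ← Ps ] wt₂ V * f (u ∷ W) (v ∷ V)))))
    ≡⟨ ∑-exchange (states q) Ps s₁ wt₁ _ ⟨
  (∑[ u ← states q ] s₁ u * (∑[ W ← Ps ] wt₁ W * (∑[ v ← states q ] s₂ v * (∑[ V ← Ps ] wt₂ V * f (u ∷ W) (v ∷ V)))))
    ≡⟨ ∑-cong (states q) (λ u → cong (s₁ u *_) (∑-cong Ps λ W → cong (wt₁ W *_) (∑-weight s₂ (states q) N (f (u ∷ W))))) ⟨
  (∑[ u ← states q ] s₁ u * (∑[ W ← Ps ] wt₁ W * (∑[ V ← partials q (suc N) ] weight s₂ V * f (u ∷ W) V)))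
    ≡⟨ ∑-weight s₁ (states q) N (λ W → ∑[ V ← partials q (suc N) ] weight s₂ V * f W V) ⟨
  (∑[ W ← partials q (suc N) ] weight s₁ W * (∑[ V ← partials q (suc N) ] weight s₂ V * f W V)) ∎
  where
  open ≤-Reasoning
  τ : ℕ
  τ = β + q * (α₁ + α₂)
  Ps : List (Partial q N)
  Ps = partials q N
  -- In each of the two rounds, the colors revealed only by the other one are added to the weight of
  -- `nothing`, so that all three have total weight `τ` per vertex.
  s s₁ s₂ : Maybe (Fin q) → ℕ
  s = stateWeight (α₁ + α₂) β
  s₁ = stateWeight α₁ (β + q * α₂)
  s₂ = stateWeight α₂ (β + q * α₁)
  wt₁ wt₂ : Partial q N → ℕ
  wt₁ = weight s₁
  wt₂ = weight s₂
  vertex : ∀ W V → τ * (∑[ w ← states q ] s w * f (w ∷ W) (nothing ∷ V))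
    ≤ (∑[ u ← states q ] s₁ u * (∑[ v ← states q ] s₂ v * f (u ∷ W) (v ∷ V)))
  vertex W V = ≤-trans
    -- Splitting with `v = nothing` gives the idempotence required of `d`.
    (merge-vertex α₁ α₂ β d (λ u → f≤1 (u ∷ W) (nothing ∷ V)) (λ u → sp zero (nothing ∷ W) (nothing ∷ V) u nothing))
    (≤-reflexive (∑-cong (states q) λ u → cong (s₁ u *_) (∑-cong (states q) λ v →
      cong (s₂ v *_) (sym (sp zero (nothing ∷ W) (nothing ∷ V) u v)))))
    where
    d : Maybe (Fin q) → ℕ
    d u = f (u ∷ W) (nothing ∷ V)

ind-¬-⊎ : ∀ {p q r} {P : Set p} {Q : Set q} {R : Set r} (P? : Dec P) (Q? : Dec Q) (R? : Dec R) →
  (P → Q ⊎ R) → (Q → P) → (R → P) → ind (¬? P?) ≡ ind (¬? Q?) * ind (¬? R?)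
ind-¬-⊎ (yes p) (yes q) R?      f g h = refl
ind-¬-⊎ (yes p) (no _)  (yes r) f g h = refl
ind-¬-⊎ (yes p) (no ¬q) (no ¬r) f g h with f p
... | inj₁ q = contradiction q ¬q
... | inj₂ r = contradiction r ¬r
ind-¬-⊎ (no ¬p) (yes q) R?      f g h = contradiction (g q) ¬p
ind-¬-⊎ (no ¬p) (no _)  (yes r) f g h = contradiction (h r) ¬p
ind-¬-⊎ (no ¬p) (no _)  (no _)  f g h = refl

module _ {A : Set} {q N} (xs : List A) (ed : A → Partial q N) where

  Hit₂ : Partial q N → Partial q N → Set
  Hit₂ W V = Any (λ a → Covered (ed a) W V) xs

  hit₂? : ∀ W V → Dec (Hit₂ W V)
  hit₂? W V = any? (λ a → Covered? (ed a) W V) xs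

  miss₂ : Partial q N → Partial q N → ℕ
  miss₂ W V = ind (¬? (hit₂? W V))

  -- The hypothesis at `x` tells which of `u` and `v` matches the entry of `g`; that color alone
  -- does for `x`, and nothing changes at the other vertices.
  Covered-split : ∀ g x (W V : Partial q N) u v → Covered g (W [ x ]≔ u) (V [ x ]≔ v) →
    Covered g (W [ x ]≔ u) (V [ x ]≔ nothing) ⊎ Covered g (W [ x ]≔ v) (V [ x ]≔ nothing)
  Covered-split g x W V u v h =
    [ (λ p → inj₁ (fill u (subst (lookup g x ≼_) (lookup∘update x W u) p)))
    , (λ p → inj₂ (fill v (subst (lookup g x ≼_) (lookup∘update x V v) p))) ] (h x)
    where
    fill : ∀ w → lookup g x ≼ w → Covered g (W [ x ]≔ w) (V [ x ]≔ nothing)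
    fill w p y with y Fin.≟ x
    ... | yes refl = inj₁ (subst (lookup g x ≼_) (sym (lookup∘update x W w)) p)
    ... | no y≢x rewrite lookup∘update′ y≢x W w | lookup∘update′ y≢x V nothing
                       | sym (lookup∘update′ y≢x W u) | sym (lookup∘update′ y≢x V v) = h y

  Covered-merge : ∀ g x (W V : Partial q N) u v w → w ≡ u ⊎ w ≡ v →
    Covered g (W [ x ]≔ w) (V [ x ]≔ nothing) → Covered g (W [ x ]≔ u) (V [ x ]≔ v)
  Covered-merge g x W V u v w w≡ h y with y Fin.≟ x
  ... | no y≢x rewrite lookup∘update′ y≢x W u | lookup∘update′ y≢x V v
                     | sym (lookup∘update′ y≢x W w) | sym (lookup∘update′ y≢x V nothing) = h y
  ... | yes refl rewrite lookup∘update x W u | lookup∘update x V v = go w≡ (h x)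
    where
    go : w ≡ u ⊎ w ≡ v → lookup g x ≼ lookup (W [ x ]≔ w) x ⊎ lookup g x ≼ lookup (V [ x ]≔ nothing) x →
      lookup g x ≼ u ⊎ lookup g x ≼ v
    go _           (inj₂ p) with lookup g x | subst (lookup g x ≼_) (lookup∘update x V nothing) p
    ... | nothing | _ = inj₁ nothing≼
    go (inj₁ refl) (inj₁ p) = inj₁ (subst (lookup g x ≼_) (lookup∘update x W w) p)
    go (inj₂ refl) (inj₁ p) = inj₂ (subst (lookup g x ≼_) (lookup∘update x W w) p)

  miss₂-splits : Splits miss₂
  miss₂-splits x W V u v = ind-¬-⊎ (hit₂? (W [ x ]≔ u) (V [ x ]≔ v))
    (hit₂? (W [ x ]≔ u) (V [ x ]≔ nothing)) (hit₂? (W [ x ]≔ v) (V [ x ]≔ nothing))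
    split
    (Any.map λ {a} → Covered-merge (ed a) x W V u v u (inj₁ refl))
    (Any.map λ {a} → Covered-merge (ed a) x W V u v v (inj₂ refl))
    where
    split : Hit₂ (W [ x ]≔ u) (V [ x ]≔ v) → Hit₂ (W [ x ]≔ u) (V [ x ]≔ nothing) ⊎ Hit₂ (W [ x ]≔ v) (V [ x ]≔ nothing)
    split h with find h
    ... | a , a∈ , c with Covered-split (ed a) x W V u v c
    ...   | inj₁ p = inj₁ (lose a∈ p)
    ...   | inj₂ p = inj₂ (lose a∈ p)

-- Iterating the rounds

ind+ind¬ : ∀ {p} {P : Set p} (P? : Dec P) → ind P? + ind (¬? P?) ≡ 1
ind+ind¬ (yes _) = refl
ind+ind¬ (no _)  = refl

module Shrink {q N K B μ₀ b : ℕ} (F : Family q N K B μ₀ b) (b′ : ℕ) where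
  open Family F
  open Round F

  small? : ∀ W a → Dec (size (fragment W a) ≤ b′)
  small? W a = size (fragment W a) ≤? b′

  -- Fragments lie inside their edges and large ones are dropped, so the mass above any `T` can only
  -- decrease. The reference value `μ₀` stays fixed while the mass goes down, which keeps `K` and
  -- `B` the same through all rounds.
  shrink : Partial q N → Family q N K B μ₀ b′
  shrink W = record
    { indices = filter (small? W) indices
    ; μ       = μ
    ; ed      = fragment W
    ; bounded = λ a a∈ → proj₂ (∈-filter⁻ (small? W) {xs = indices} a∈)
    ; spread  = λ T → ≤-trans (*-monoˡ-≤ (K ^ size T) (sub T)) (spread T)
    }
    where
    sub : ∀ T → (∑[ a ← filter (small? W) indices ] ind (T ⊑? fragment W a) * μ a)
      ≤ (∑[ a ← indices ] ind (T ⊑? ed a) * μ a)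
    sub T = begin
      (∑[ a ← filter (small? W) indices ] ind (T ⊑? fragment W a) * μ a)
        ≡⟨ ∑-filter (small? W) indices _ ⟩
      (∑[ a ← indices ] ind (small? W a) * (ind (T ⊑? fragment W a) * μ a))
        ≤⟨ ∑-mono indices (λ a a∈ → ind-elim (small? W a) λ _ →
             *-monoˡ-≤ (μ a) (ind-mono (T ⊑? fragment W a) (T ⊑? ed a)
               λ p → ⊑-trans {g = T} {fragment W a} {ed a} p (fragment-⊑ W a∈))) ⟩
      (∑[ a ← indices ] ind (T ⊑? ed a) * μ a) ∎
      where open ≤-Reasoning

  lost : Partial q N → ℕ
  lost W = ∑[ a ← indices ] ind (¬? (small? W a)) * μ a

  mass-shrink : ∀ W → Round.mass (shrink W) + lost W ≡ mass
  mass-shrink W = begin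
    ∑ (filter (small? W) indices) μ + lost W
      ≡⟨ cong (_+ lost W) (∑-filter (small? W) indices μ) ⟩
    (∑[ a ← indices ] ind (small? W a) * μ a) + lost W
      ≡⟨ ∑-+ indices _ _ ⟨
    (∑[ a ← indices ] (ind (small? W a) * μ a + ind (¬? (small? W a)) * μ a))
      ≡⟨ ∑-cong indices (λ a → trans (sym (*-distribʳ-+ (μ a) (ind (small? W a)) _))
           (trans (cong (_* μ a) (ind+ind¬ (small? W a))) (*-identityˡ (μ a)))) ⟩
    ∑ indices μ ∎
    where open ≡-Reasoning

  -- Markov's inequality for `c ^ size`: a lost edge has a fragment of size at least `suc b′`.
  lost-cost : ∀ c .{{_ : NonZero c}} W →
    c ^ suc b′ * lost W ≤ (∑[ a ← indices ] c ^ size (fragment W a) * μ a)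
  lost-cost c W = ≤-trans (≤-reflexive (sym (∑-*ˡ indices (c ^ suc b′) _)))
    (∑-mono indices λ a _ → ≤-trans (≤-reflexive (x∙yz≈y∙xz (c ^ suc b′) (ind (¬? (small? W a))) (μ a)))
      (ind-elim (¬? (small? W a)) λ ¬s → *-monoˡ-≤ (μ a) (^-monoʳ-≤ c (≰⇒> ¬s))))

  -- If `V` contains the fragment of an edge, then `W` and `V` together cover the edge chosen for
  -- it.
  miss-shrink : ∀ W V → miss₂ indices ed W V ≤ Round.miss (shrink W) V
  miss-shrink W V = ind-mono (¬? (hit₂? indices ed W V)) (¬? (Round.hit? (shrink W) V)) (_∘ hit)
    where
    hit : Round.Hit (shrink W) V → Hit₂ indices ed W V
    hit h with find h
    ... | a , a∈ , p = lose
      (proj₁ (chosen-spec W (proj₁ (∈-filter⁻ (small? W) {xs = indices} a∈))))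
      λ x → map₂ (λ t → ≼-trans t (p x)) (chosen-cover W a x)

  miss-single : ∀ W → miss W ≤ miss₂ indices ed W (empty N)
  miss-single W = ind-mono (¬? (hit? W)) (¬? (hit₂? indices ed W (empty N)))
    (_∘ Any.map λ {a} c x → single (c x))
    where
    single : ∀ {x y} → y ≼ lookup W x ⊎ y ≼ lookup (empty {q} N) x → y ≼ lookup W x
    single         (inj₁ p) = p
    single {x} {y} (inj₂ p) with y | subst (y ≼_) (lookup-replicate x nothing) p
    ... | nothing | _ = nothing≼

-- A round in which every color has weight c * u makes fragments of size t rarer by
-- a factor c ^ t.
module Rounds (q N K B μ₀ τ u : ℕ) .{{_ : NonZero K}} .{{_ : NonZero τ}} (Bτ≤uK : B * τ ≤ u * K) where

  -- With τ ^ N and μ₀ normalized to 1:  mass F + ℙ(miss) ≤ S / Q.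
  MissBound : (b C Q S : ℕ) → Set₁
  MissBound b C Q S = ∀ α β → β + q * α ≡ τ → C * u ≤ α → (F : Family q N K B μ₀ b) →
    Q * (Round.mass F * τ ^ N + μ₀ * Round.missWeight F α β) ≤ S * (μ₀ * τ ^ N)

  -- When all edges are empty, either there are none and the mass is 0, or every `W` is a hit and
  -- the miss weight is 0.
  missBound-zero : ∀ Q → MissBound 0 0 Q Q
  missBound-zero Q α β eq _ F = *-monoʳ-≤ Q main
    where
    open ≤-Reasoning
    open Family F
    open Round F
    total : missWeight α β ≤ τ ^ N
    total = begin
      missWeight α β
        ≤⟨ ∑-mono (partials q N) (λ W _ → ≤-trans (*-monoʳ-≤ (wt α β W) (ind≤1 (¬? (hit? W)))) (≤-reflexive (*-identityʳ _))) ⟩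
      ∑ (partials q N) (wt α β)
        ≡⟨ ∑-wt q N α β ⟩
      (β + q * α) ^ N
        ≡⟨ cong (_^ N) eq ⟩
      τ ^ N ∎
    none : ∀ {xs : List Index} → (∀ a → a ∈ xs → a ∈ indices) → ∑ xs μ ≡ 0 ⊎ (∀ W → Hit W)
    none {[]}     h = inj₁ refl
    none {a ∷ xs} h = inj₂ λ W → lose (h a (here refl))
      (size≡0⇒⊑ (ed a) W (n≤0⇒n≡0 (bounded a (h a (here refl)))))
    main : mass * τ ^ N + μ₀ * missWeight α β ≤ μ₀ * τ ^ N
    main with none {indices} (λ _ p → p)
    ... | inj₁ mass≡0 = subst (λ m → m * τ ^ N + μ₀ * missWeight α β ≤ μ₀ * τ ^ N) (sym mass≡0) (*-monoʳ-≤ μ₀ total)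
    ... | inj₂ hit = begin
      mass * τ ^ N + μ₀ * missWeight α β
        ≡⟨ cong (λ t → mass * τ ^ N + μ₀ * t) (trans (∑-cong (partials q N) λ W →
             trans (cong (wt α β W *_) (ind-no (¬? (hit? W)) λ ¬h → ¬h (hit W))) (*-zeroʳ (wt α β W))) (∑-0 (partials q N))) ⟩
      mass * τ ^ N + μ₀ * 0
        ≡⟨ trans (cong (mass * τ ^ N +_) (*-zeroʳ μ₀)) (+-identityʳ _) ⟩
      mass * τ ^ N
        ≤⟨ *-monoˡ-≤ (τ ^ N) mass≤ ⟩
      μ₀ * τ ^ N ∎

  -- The part `c * u` of the weight `α` is spent on a first round `W`, and `bound′` is averaged over
  -- `W` with the rest. The mass of `F` is that of `shrink W` plus the loss, whose mean is at most
  -- μ₀ / (2 Q) by `fragment-cost` and `cost`. So S / Q turns into S / Q + 1 / (2 Q), and `merge`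
  -- joins the two rounds into one.
  missBound-round : ∀ b b′ C Q S c .{{_ : NonZero c}} → 2 ^ b * (2 * Q) ≤ c ^ suc b′ →
    MissBound b′ C Q S → MissBound b (c + C) (2 * Q) (2 * S + 1)
  missBound-round b b′ C Q S c cost bound′ α β eq le F =
    *-cancelˡ-≤ (τ ^ N) {{m^n≢0 τ N}} combined
    where
    open ≤-Reasoning
    open Family F
    open Round F
    open Shrink F b′
    α₁ α₂ β₁ β₂ : ℕ
    α₁ = c * u
    α₂ = α ∸ α₁
    β₁ = β + q * α₂
    β₂ = β + q * α₁
    α₁≤α : α₁ ≤ α
    α₁≤α = ≤-trans (*-monoˡ-≤ u (m≤m+n c C)) le
    α≡ : α₁ + α₂ ≡ α
    α≡ = m+[n∸m]≡n α₁≤α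
    Cu≤α₂ : C * u ≤ α₂
    Cu≤α₂ = ≤-trans (≤-reflexive (sym (m+n∸m≡n α₁ (C * u))))
      (∸-monoˡ-≤ α₁ (≤-trans (≤-reflexive (sym (*-distribʳ-+ u c C))) le))
    tot : β + q * (α₁ + α₂) ≡ τ
    tot = trans (cong (λ t → β + q * t) α≡) eq
    tot₁ : β₁ + q * α₁ ≡ τ
    tot₁ = trans (r β q α₁ α₂) tot
      where
      r : ∀ β q a b → β + q * b + q * a ≡ β + q * (a + b)
      r = solve-∀
    tot₂ : β₂ + q * α₂ ≡ τ
    tot₂ = trans (r β q α₁ α₂) tot
      where
      r : ∀ β q a b → β + q * a + q * b ≡ β + q * (a + b)
      r = solve-∀
    Ps : List (Partial q N)
    Ps = partials q N
    M E₁ E₂ E₃ t : ℕ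
    t  = τ ^ N
    M  = missWeight α β
    E₁ = ∑[ W ← Ps ] wt α₁ β₁ W * Round.mass (shrink W)
    E₂ = ∑[ W ← Ps ] wt α₁ β₁ W * Round.missWeight (shrink W) α₂ β₂
    E₃ = ∑[ W ← Ps ] wt α₁ β₁ W * lost W
    dominated : t * M ≤ E₂
    dominated = begin
      t * M
        ≡⟨ cong₂ (λ s a → s ^ N * missWeight a β) (sym tot) (sym α≡) ⟩
      (β + q * (α₁ + α₂)) ^ N * (∑[ W ← Ps ] wt (α₁ + α₂) β W * miss W)
        ≤⟨ *-monoʳ-≤ ((β + q * (α₁ + α₂)) ^ N) (∑-mono Ps λ W _ → *-monoʳ-≤ (wt (α₁ + α₂) β W) (miss-single W)) ⟩
      (β + q * (α₁ + α₂)) ^ N * (∑[ W ← Ps ] wt (α₁ + α₂) β W * miss₂ indices ed W (empty N))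
        ≤⟨ merge α₁ α₂ β (miss₂ indices ed) (λ W V → ind≤1 (¬? (hit₂? indices ed W V))) (miss₂-splits indices ed) ⟩
      (∑[ W ← Ps ] wt α₁ β₁ W * (∑[ V ← Ps ] wt α₂ β₂ V * miss₂ indices ed W V))
        ≤⟨ ∑-mono Ps (λ W _ → *-monoʳ-≤ (wt α₁ β₁ W) (∑-mono Ps λ V _ → *-monoʳ-≤ (wt α₂ β₂ V) (miss-shrink W V))) ⟩
      E₂ ∎
    wt-total : ∑ Ps (wt α₁ β₁) ≡ t
    wt-total = trans (∑-wt q N α₁ β₁) (cong (_^ N) tot₁)
    mass-split : E₁ + E₃ ≡ t * mass
    mass-split = begin-equality
      E₁ + E₃
        ≡⟨ ∑-+ Ps _ _ ⟨
      (∑[ W ← Ps ] (wt α₁ β₁ W * Round.mass (shrink W) + wt α₁ β₁ W * lost W))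
        ≡⟨ ∑-cong Ps (λ W → trans (sym (*-distribˡ-+ (wt α₁ β₁ W) _ _)) (cong (wt α₁ β₁ W *_) (mass-shrink W))) ⟩
      (∑[ W ← Ps ] wt α₁ β₁ W * mass)
        ≡⟨ trans (∑-*ʳ Ps mass (wt α₁ β₁)) (cong (_* mass) wt-total) ⟩
      t * mass ∎
    averaged : Q * (E₁ * t + μ₀ * E₂) ≤ S * (μ₀ * t) * t
    averaged = begin
      Q * (E₁ * t + μ₀ * E₂)
        ≡⟨ cong (Q *_) (cong₂ _+_ (sym (∑-*ʳ Ps t (λ W → wt α₁ β₁ W * Round.mass (shrink W)))) (sym (∑-*ˡ Ps μ₀ _))) ⟩
      Q * ((∑[ W ← Ps ] (wt α₁ β₁ W * Round.mass (shrink W) * t)) +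
        (∑[ W ← Ps ] (μ₀ * (wt α₁ β₁ W * Round.missWeight (shrink W) α₂ β₂))))
        ≡⟨ cong (Q *_) (∑-+ Ps _ _) ⟨
      Q * (∑[ W ← Ps ] (wt α₁ β₁ W * Round.mass (shrink W) * t + μ₀ * (wt α₁ β₁ W * Round.missWeight (shrink W) α₂ β₂)))
        ≡⟨ ∑-*ˡ Ps Q _ ⟨
      (∑[ W ← Ps ] Q * (wt α₁ β₁ W * Round.mass (shrink W) * t + μ₀ * (wt α₁ β₁ W * Round.missWeight (shrink W) α₂ β₂)))
        ≡⟨ ∑-cong Ps (λ W → r Q (wt α₁ β₁ W) (Round.mass (shrink W)) t μ₀ (Round.missWeight (shrink W) α₂ β₂)) ⟩
      (∑[ W ← Ps ] wt α₁ β₁ W * (Q * (Round.mass (shrink W) * t + μ₀ * Round.missWeight (shrink W) α₂ β₂)))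
        ≤⟨ ∑-mono Ps (λ W _ → *-monoʳ-≤ (wt α₁ β₁ W) (bound′ α₂ β₂ tot₂ Cu≤α₂ (shrink W))) ⟩
      (∑[ W ← Ps ] wt α₁ β₁ W * (S * (μ₀ * t)))
        ≡⟨ trans (∑-*ʳ Ps (S * (μ₀ * t)) (wt α₁ β₁)) (trans (cong (_* (S * (μ₀ * t))) wt-total) (*-comm t _)) ⟩
      S * (μ₀ * t) * t ∎
      where
      r : ∀ Q w m t μ z → Q * (w * m * t + μ * (w * z)) ≡ w * (Q * (m * t + μ * z))
      r = solve-∀
    lost-total : 2 * Q * E₃ ≤ μ₀ * t
    lost-total = *-cancelˡ-≤ (2 ^ b) {{m^n≢0 2 b}} (begin
      2 ^ b * (2 * Q * E₃)
        ≡⟨ *-assoc (2 ^ b) (2 * Q) E₃ ⟨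
      2 ^ b * (2 * Q) * E₃
        ≤⟨ *-monoˡ-≤ E₃ cost ⟩
      c ^ suc b′ * E₃
        ≡⟨ trans (sym (∑-*ˡ Ps (c ^ suc b′) _)) (∑-cong Ps λ W → x∙yz≈y∙xz (c ^ suc b′) (wt α₁ β₁ W) (lost W)) ⟩
      (∑[ W ← Ps ] wt α₁ β₁ W * (c ^ suc b′ * lost W))
        ≤⟨ ∑-mono Ps (λ W _ → *-monoʳ-≤ (wt α₁ β₁ W) (lost-cost c W)) ⟩
      (∑[ W ← Ps ] wt α₁ β₁ W * (∑[ a ← indices ] c ^ size (fragment W a) * μ a))
        ≤⟨ fragment-cost α₁ β₁ c {{it}} {{subst NonZero (sym tot₁) it}} dense ⟩
      μ₀ * (β₁ + q * α₁) ^ N * 2 ^ b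
        ≡⟨ cong (λ s → μ₀ * s ^ N * 2 ^ b) tot₁ ⟩
      μ₀ * t * 2 ^ b
        ≡⟨ *-comm (μ₀ * t) (2 ^ b) ⟩
      2 ^ b * (μ₀ * t) ∎)
      where
      dense : c * B * (β₁ + q * α₁) ≤ α₁ * K
      dense = begin
        c * B * (β₁ + q * α₁) ≡⟨ cong (c * B *_) tot₁ ⟩
        c * B * τ             ≡⟨ *-assoc c B τ ⟩
        c * (B * τ)           ≤⟨ *-monoʳ-≤ c Bτ≤uK ⟩
        c * (u * K)           ≡⟨ *-assoc c u K ⟨
        α₁ * K                ∎
    combined : t * (2 * Q * (mass * t + μ₀ * M)) ≤ t * ((2 * S + 1) * (μ₀ * t))
    combined = begin
      t * (2 * Q * (mass * t + μ₀ * M))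
        ≡⟨ r₁ t Q mass μ₀ M ⟩
      2 * Q * (t * mass * t + μ₀ * (t * M))
        ≤⟨ *-monoʳ-≤ (2 * Q) (+-mono-≤ (≤-reflexive (cong (_* t) (sym mass-split))) (*-monoʳ-≤ μ₀ dominated)) ⟩
      2 * Q * ((E₁ + E₃) * t + μ₀ * E₂)
        ≡⟨ r₂ Q E₁ E₃ t μ₀ E₂ ⟩
      2 * (Q * (E₁ * t + μ₀ * E₂)) + 2 * Q * E₃ * t
        ≤⟨ +-mono-≤ (*-monoʳ-≤ 2 averaged) (*-monoˡ-≤ t lost-total) ⟩
      2 * (S * (μ₀ * t) * t) + μ₀ * t * t
        ≡⟨ r₃ S μ₀ t ⟩
      t * ((2 * S + 1) * (μ₀ * t)) ∎
      where
      r₁ : ∀ t Q m μ M → t * (2 * Q * (m * t + μ * M)) ≡ 2 * Q * (t * m * t + μ * (t * M))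
      r₁ = solve-∀
      r₂ : ∀ Q a c t μ e → 2 * Q * ((a + c) * t + μ * e) ≡ 2 * (Q * (a * t + μ * e)) + 2 * Q * c * t
      r₂ = solve-∀
      r₃ : ∀ S μ t → 2 * (S * (μ * t) * t) + μ * t * t ≡ t * ((2 * S + 1) * (μ * t))
      r₃ = solve-∀

-- The schedule of the rounds

n<2^n : ∀ n → n < 2 ^ n
n<2^n zero    = s≤s z≤n
n<2^n (suc n) = ≤-trans (+-mono-≤ (m^n>0 2 n) (n<2^n n)) (≤-reflexive (2^suc n))
  where
  2^suc : ∀ n → 2 ^ n + 2 ^ n ≡ 2 ^ suc n
  2^suc n = cong (2 ^ n +_) (sym (+-identityʳ (2 ^ n)))

-- The condition `cost` of `missBound-round` for sizes falling from `2 ^ suc n` to `2 ^ n` with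
-- `Q = 2 ^ n`. As 16 is 2 ^ 4, the right-hand side has room for two factors `2 ^ (2 ^ suc n)`.
halving-cost : ∀ n → 2 ^ (2 ^ suc n) * 2 ^ suc n ≤ 16 ^ suc (2 ^ n)
halving-cost n = begin
  2 ^ (2 ^ suc n) * 2 ^ suc n       ≤⟨ *-monoʳ-≤ (2 ^ (2 ^ suc n)) (^-monoʳ-≤ 2 (<⇒≤ (n<2^n (suc n)))) ⟩
  2 ^ (2 ^ suc n) * 2 ^ (2 ^ suc n) ≡⟨ ^-distribˡ-+-* 2 (2 ^ suc n) (2 ^ suc n) ⟨
  2 ^ (2 ^ suc n + 2 ^ suc n)       ≡⟨ cong (2 ^_) (quadruple (2 ^ n)) ⟩
  2 ^ (4 * 2 ^ n)                   ≡⟨ ^-*-assoc 2 4 (2 ^ n) ⟨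
  16 ^ (2 ^ n)                      ≤⟨ ^-monoʳ-≤ 16 (n≤1+n (2 ^ n)) ⟩
  16 ^ suc (2 ^ n)                  ∎
  where
  open ≤-Reasoning
  quadruple : ∀ x → 2 * x + 2 * x ≡ 4 * x
  quadruple = solve-∀

module _ (q N K B μ₀ τ u : ℕ) .{{_ : NonZero K}} .{{_ : NonZero τ}} (Bτ≤uK : B * τ ≤ u * K) where

  open Rounds q N K B μ₀ τ u Bτ≤uK

  -- Rounds are counted back from the last one. A round put in front doubles `Q`, so its loss is
  -- half that of the round after it. The losses form a geometric series with first term 1 / 2 ^ (s
  -- + 1) and stay below 2 / 2 ^ (s + 1), however large `i` is.
  missBound-halving : ∀ s ℓ → 2 ^ (2 ^ suc s) * 2 ^ suc s ≤ ℓ → ∀ i →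
    ∃[ S ] (suc S ≡ 2 ^ i * 2 ^ suc s + 2 * 2 ^ i ×
      MissBound (2 ^ (suc s + i)) (i * 16 + ℓ) (2 ^ i * 2 ^ suc s) S)
  missBound-halving s ℓ large zero =
    2 * 2 ^ s + 1 , count (2 ^ s) ,
    subst₂ (λ b Q → MissBound b ℓ Q (2 * 2 ^ s + 1))
      (cong (2 ^_) (sym (+-identityʳ (suc s)))) (sym (*-identityˡ (2 ^ suc s)))
      (subst (λ C → MissBound (2 ^ suc s) C (2 ^ suc s) (2 * 2 ^ s + 1)) (+-identityʳ ℓ)
        -- In the last round the size bound drops to 0, so `c = ℓ` enters with exponent 1 and the
        -- cost condition is `large` itself.
        (missBound-round (2 ^ suc s) 0 0 (2 ^ s) (2 ^ s) ℓ
          {{>-nonZero (≤-trans (*-mono-≤ (m^n>0 2 (2 ^ suc s)) (m^n>0 2 (suc s))) large)}}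
          (≤-trans large (≤-reflexive (sym (*-identityʳ ℓ))))
          (missBound-zero (2 ^ s))))
    where
    count : ∀ x → suc (2 * x + 1) ≡ 1 * (2 * x) + 2 * 1
    count = solve-∀
  missBound-halving s ℓ large (suc i) with missBound-halving s ℓ large i
  ... | S , eq , bound =
    2 * S + 1 , trans (double S) (trans (cong (2 *_) eq) (dist (2 ^ i) (2 ^ suc s))) ,
    subst₂ (λ b Q → MissBound b (16 + (i * 16 + ℓ)) Q (2 * S + 1))
      (cong (2 ^_) (sym (+-suc (suc s) i))) (sym (*-assoc 2 (2 ^ i) (2 ^ suc s)))
      (missBound-round (2 ^ suc (suc s + i)) (2 ^ (suc s + i)) (i * 16 + ℓ) (2 ^ i * 2 ^ suc s) S 16 cost bound)
    where
    double : ∀ x → suc (2 * x + 1) ≡ 2 * suc x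
    double = solve-∀
    dist : ∀ x y → 2 * (x * y + 2 * x) ≡ 2 * x * y + 2 * (2 * x)
    dist = solve-∀
    cost : 2 ^ (2 ^ suc (suc s + i)) * (2 * (2 ^ i * 2 ^ suc s)) ≤ 16 ^ suc (2 ^ (suc s + i))
    cost = ≤-trans (≤-reflexive (cong (λ t → 2 ^ (2 ^ suc (suc s + i)) * (2 * t))
      (trans (*-comm (2 ^ i) (2 ^ suc s)) (sym (^-distribˡ-+-* 2 (suc s) i))))) (halving-cost (suc s + i))

  -- A family of full mass uses up the 1 in S / Q < 1 + 2 / 2 ^ (s + 1), and the remainder bounds
  -- the probability of a miss.
  missWeight-bound : ∀ {b} s ℓ → 2 ^ (2 ^ suc s) * 2 ^ suc s ≤ ℓ → ∀ i → b ≤ 2 ^ (suc s + i) →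
    ∀ α β → β + q * α ≡ τ → (i * 16 + ℓ) * u ≤ α → (F : Family q N K B μ₀ b) →
    Round.mass F ≡ μ₀ → .{{_ : NonZero μ₀}} → 2 ^ suc s * Round.missWeight F α β ≤ 2 * τ ^ N
  missWeight-bound {b} s ℓ large i b≤ α β eq le F mass≡ with missBound-halving s ℓ large i
  ... | S , S≡ , bound = *-cancelˡ-≤ (2 ^ i * μ₀) {{m*n≢0 (2 ^ i) μ₀ {{m^n≢0 2 i}}}}
    (+-cancelˡ-≤ (Q * (μ₀ * t)) _ _ (begin
      Q * (μ₀ * t) + 2 ^ i * μ₀ * (2 ^ suc s * M)
        ≡⟨ r₁ (2 ^ i) (2 ^ suc s) μ₀ t M ⟩
      Q * (μ₀ * t + μ₀ * M)
        ≡⟨ cong (λ m → Q * (m * t + μ₀ * M)) mass≡ ⟨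
      Q * (Round.mass F * t + μ₀ * M)
        ≤⟨ bound α β eq le widened ⟩
      S * (μ₀ * t)
        ≤⟨ *-monoˡ-≤ (μ₀ * t) (≤-trans (n≤1+n S) (≤-reflexive S≡)) ⟩
      (Q + 2 * 2 ^ i) * (μ₀ * t)
        ≡⟨ r₂ Q (2 ^ i) μ₀ t ⟩
      Q * (μ₀ * t) + 2 ^ i * μ₀ * (2 * t) ∎))
    where
    open ≤-Reasoning
    widened : Family q N K B μ₀ (2 ^ (suc s + i))
    widened = record
      { indices = Family.indices F
      ; μ       = Family.μ F
      ; ed      = Family.ed F
      ; bounded = λ a a∈ → ≤-trans (Family.bounded F a a∈) b≤
      ; spread  = Family.spread F
      }
    Q t M : ℕ
    Q = 2 ^ i * 2 ^ suc s
    t = τ ^ N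
    M = Round.missWeight F α β
    r₁ : ∀ x y m t M → x * y * (m * t) + x * m * (y * M) ≡ x * y * (m * t + m * M)
    r₁ = solve-∀
    r₂ : ∀ Q x m t → (Q + 2 * x) * (m * t) ≡ Q * (m * t) + x * m * (2 * t)
    r₂ = solve-∀

-- Injective colorings of the edges

falling : ℕ → ℕ → ℕ
falling n       zero    = 1
falling zero    (suc k) = 0
falling (suc n) (suc k) = suc n * falling n k

falling-suc : ∀ n k → n * falling (n ∸ 1) k ≡ falling n (suc k)
falling-suc zero    k = refl
falling-suc (suc n) k = refl

falling-+ : ∀ n j k → falling n (j + k) ≡ falling n j * falling (n ∸ j) k
falling-+ n       zero    k = sym (+-identityʳ (falling n k))
falling-+ zero    (suc j) k = refl
falling-+ (suc n) (suc j) k = trans (cong (suc n *_) (falling-+ n j k)) (sym (*-assoc (suc n) (falling n j) _))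

falling-pos : ∀ {n k} → k ≤ n → NonZero (falling n k)
falling-pos {n}     {zero}  z≤n     = _
falling-pos {suc n} {suc k} (s≤s p) = m*n≢0 (suc n) (falling n k) {{_}} {{falling-pos p}}

-- Bernoulli's inequality (1 - 1 / (n + 1)) ^ t ≥ 1 - t / (n + 1), multiplied by (n + 1) ^ (t + 1).
bernoulli : ∀ n t → suc n ^ suc t ≤ n ^ t * suc n + t * suc n ^ t
bernoulli n zero    = ≤-reflexive (r n)
  where
  r : ∀ n → (1 + n) * 1 ≡ 1 * (1 + n) + 0
  r = solve-∀
bernoulli n (suc t) = begin
  suc n * suc n ^ suc t
    ≤⟨ *-monoʳ-≤ (suc n) (bernoulli n t) ⟩
  suc n * (n ^ t * suc n + t * suc n ^ t)
    ≡⟨ r₁ n (n ^ t) t (suc n ^ t) ⟩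
  n * n ^ t * suc n + suc n * n ^ t + t * (suc n * suc n ^ t)
    ≤⟨ +-monoˡ-≤ (t * (suc n * suc n ^ t)) (+-monoʳ-≤ (n * n ^ t * suc n)
         (*-monoʳ-≤ (suc n) (^-monoˡ-≤ t (n≤1+n n)))) ⟩
  n * n ^ t * suc n + suc n * suc n ^ t + t * (suc n * suc n ^ t)
    ≡⟨ r₂ (n * n ^ t * suc n) (suc n * suc n ^ t) t ⟩
  n ^ suc t * suc n + suc t * suc n ^ suc t ∎
  where
  open ≤-Reasoning
  r₁ : ∀ n x t y → (1 + n) * (x * (1 + n) + t * y) ≡ n * x * (1 + n) + (1 + n) * x + t * ((1 + n) * y)
  r₁ = solve-∀
  r₂ : ∀ a b t → a + b + t * b ≡ a + (1 + t) * b
  r₂ = solve-∀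

-- Bernoulli's lower bound is at least 1/2 as long as t is at most half of n + 1.
power-half : ∀ n t → t + t ≤ suc n → suc n ^ t ≤ 2 * n ^ t
power-half n t h = *-cancelˡ-≤ (suc n) (+-cancelʳ-≤ (suc n * suc n ^ t) _ _ (begin
  suc n * suc n ^ t + suc n * suc n ^ t
    ≡⟨ double (suc n * suc n ^ t) ⟩
  2 * (suc n * suc n ^ t)
    ≤⟨ *-monoʳ-≤ 2 (bernoulli n t) ⟩
  2 * (n ^ t * suc n + t * suc n ^ t)
    ≡⟨ r (n ^ t) (suc n) t (suc n ^ t) ⟩
  suc n * (2 * n ^ t) + (t + t) * suc n ^ t
    ≤⟨ +-monoʳ-≤ (suc n * (2 * n ^ t)) (*-monoˡ-≤ (suc n ^ t) h) ⟩
  suc n * (2 * n ^ t) + suc n * suc n ^ t ∎))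
  where
  open ≤-Reasoning
  double : ∀ x → x + x ≡ 2 * x
  double = solve-∀
  r : ∀ x m t y → 2 * (x * m + t * y) ≡ m * (2 * x) + (t + t) * y
  r = solve-∀

-- The two rounded halves of `t` are at most (n + 1) / 2, and `power-half` applies to each. The 4
-- stands in for e in (1 + 1 / n) ^ n ≤ e.
power-step : ∀ n t → t ≤ n → suc n ^ t ≤ 4 * n ^ t
power-step n t t≤n = begin
  suc n ^ t
    ≡⟨ cong (suc n ^_) (⌊n/2⌋+⌈n/2⌉≡n t) ⟨
  suc n ^ (⌊ t /2⌋ + ⌈ t /2⌉)
    ≡⟨ ^-distribˡ-+-* (suc n) ⌊ t /2⌋ ⌈ t /2⌉ ⟩
  suc n ^ ⌊ t /2⌋ * suc n ^ ⌈ t /2⌉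
    ≤⟨ *-mono-≤ (power-half n ⌊ t /2⌋ lower) (power-half n ⌈ t /2⌉ upper) ⟩
  2 * n ^ ⌊ t /2⌋ * (2 * n ^ ⌈ t /2⌉)
    ≡⟨ r (n ^ ⌊ t /2⌋) (n ^ ⌈ t /2⌉) ⟩
  4 * (n ^ ⌊ t /2⌋ * n ^ ⌈ t /2⌉)
    ≡⟨ cong (4 *_) (^-distribˡ-+-* n ⌊ t /2⌋ ⌈ t /2⌉) ⟨
  4 * n ^ (⌊ t /2⌋ + ⌈ t /2⌉)
    ≡⟨ cong (λ s → 4 * n ^ s) (⌊n/2⌋+⌈n/2⌉≡n t) ⟩
  4 * n ^ t ∎
  where
  open ≤-Reasoning
  r : ∀ x y → 2 * x * (2 * y) ≡ 4 * (x * y)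
  r = solve-∀
  upper : ⌈ t /2⌉ + ⌈ t /2⌉ ≤ suc n
  upper = ≤-trans (+-monoˡ-≤ ⌈ t /2⌉ (⌈n/2⌉-mono (n≤1+n t)))
    (≤-trans (≤-reflexive (cong (_+ ⌈ t /2⌉) refl)) (≤-trans (≤-reflexive (ceil-sum t)) (s≤s t≤n)))
    where
    ceil-sum : ∀ t → ⌈ suc t /2⌉ + ⌈ t /2⌉ ≡ suc t
    ceil-sum t = cong suc (⌊n/2⌋+⌈n/2⌉≡n t)
  lower : ⌊ t /2⌋ + ⌊ t /2⌋ ≤ suc n
  lower = ≤-trans (+-mono-≤ (⌊n/2⌋≤⌈n/2⌉ t) (⌊n/2⌋≤⌈n/2⌉ t)) upper

-- This is the origin of the constant 4 of the spread: a uniformly random injective coloring with q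
-- colors takes prescribed values at t vertices with probability at most 1 / `falling q t`, hence at
-- most (4 / q) ^ t.
power≤falling : ∀ n t → t ≤ n → n ^ t ≤ 4 ^ t * falling n t
power≤falling n       zero    _         = ≤-refl
power≤falling (suc n) (suc t) (s≤s t≤n) = begin
  suc n * suc n ^ t
    ≤⟨ *-monoʳ-≤ (suc n) (power-step n t t≤n) ⟩
  suc n * (4 * n ^ t)
    ≤⟨ *-monoʳ-≤ (suc n) (*-monoʳ-≤ 4 (power≤falling n t t≤n)) ⟩
  suc n * (4 * (4 ^ t * falling n t))
    ≡⟨ r (suc n) (4 ^ t) (falling n t) ⟩
  4 * 4 ^ t * (suc n * falling n t) ∎
  where
  open ≤-Reasoning
  r : ∀ m x f → m * (4 * (x * f)) ≡ 4 * x * (m * f)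
  r = solve-∀

∑-concatMap : ∀ {a b} {A : Set a} {B : Set b} (g : A → List B) (xs : List A) (f : B → ℕ) →
  ∑ (concatMap g xs) f ≡ (∑[ x ← xs ] ∑ (g x) f)
∑-concatMap g []       f = refl
∑-concatMap g (x ∷ xs) f = trans (∑-++ (g x) (concatMap g xs) f) (cong (∑ (g x) f +_) (∑-concatMap g xs f))

infixl 6 _without_
_without_ : ∀ {q} → Subset q → Fin q → Subset q
A without c = A [ c ]≔ outside

∈-without⁺ : ∀ {q} {A : Subset q} {c d} → c ∈ₛ A → c ≢ d → c ∈ₛ A without d
∈-without⁺ {A = A} {c} {d} c∈ c≢d = lookup⇒[]= c _ (trans (lookup∘update′ c≢d A outside) ([]=⇒lookup c∈))

∈-without⁻ : ∀ {q} {A : Subset q} {c d} → c ∈ₛ A without d → c ∈ₛ A × c ≢ d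
∈-without⁻ {A = A} {c} {d} c∈ = lookup⇒[]= c A (trans (sym (lookup∘update′ c≢d A outside)) ([]=⇒lookup c∈)) , c≢d
  where
  c≢d : c ≢ d
  c≢d refl with () ← trans (sym (lookup∘update c A outside)) ([]=⇒lookup c∈)

∣without∣ : ∀ {q} (A : Subset q) {c} → c ∈ₛ A → ∣ A without c ∣ ≡ ∣ A ∣ ∸ 1
∣without∣ (_ ∷ A)       here       = refl
∣without∣ (inside ∷ A)  (there c∈) = trans (cong suc (∣without∣ A c∈)) (m+[n∸m]≡n (nonempty′ c∈))
  where
  nonempty′ : ∀ {q c} {A : Subset q} → c ∈ₛ A → 1 ≤ ∣ A ∣
  nonempty′ here = s≤s z≤n
  nonempty′ {A = inside ∷ A}  (there p) = s≤s z≤n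
  nonempty′ {A = outside ∷ A} (there p) = nonempty′ p
∣without∣ (outside ∷ A) (there c∈) = ∣without∣ A c∈

∑-∈? : ∀ {q} (A : Subset q) → (∑[ c ← allFin q ] ind (c ∈? A)) ≡ ∣ A ∣
∑-∈? {zero}  []            = refl
∑-∈? {suc q} (inside ∷ A)  = trans (∑-allFin q λ c → ind (c ∈? (inside ∷ A)))
  (cong suc (trans (∑-cong (allFin q) λ c → ind-cong (suc c ∈? (inside ∷ A)) (c ∈? A) drop-there there) (∑-∈? A)))
∑-∈? {suc q} (outside ∷ A) = trans (∑-allFin q λ c → ind (c ∈? (outside ∷ A)))
  (trans (∑-cong (allFin q) λ c → ind-cong (suc c ∈? (outside ∷ A)) (c ∈? A) drop-there there) (∑-∈? A))

injections : ∀ {q N} → Subset q → Subset N → List (Partial q N)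
injections A []            = [] ∷ []
injections A (outside ∷ e) = map (nothing ∷_) (injections A e)
injections {q} A (inside ∷ e) =
  concatMap (λ c → map (just c ∷_) (injections (A without c) e)) (filter (_∈? A) (allFin q))

∑-injections : ∀ {q N} A (e : Subset N) (f : Partial q (suc N) → ℕ) →
  ∑ (injections A (inside ∷ e)) f
    ≡ (∑[ c ← allFin q ] ind (c ∈? A) * (∑[ h ← injections (A without c) e ] f (just c ∷ h)))
∑-injections {q} A e f = trans (∑-concatMap _ (filter (_∈? A) (allFin q)) f)
  (trans (∑-filter (_∈? A) (allFin q) _)
    (∑-cong (allFin q) λ c → cong (ind (c ∈? A) *_) (∑-map (just c ∷_) (injections (A without c) e) f)))

data Injection {q} : ∀ {N} → Subset q → Subset N → Partial q N → Set where
  []   : ∀ {A} → Injection A [] []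
  skip : ∀ {A N} {e : Subset N} {h} → Injection A e h → Injection A (outside ∷ e) (nothing ∷ h)
  use  : ∀ {A N} {e : Subset N} {h c} → c ∈ₛ A → Injection (A without c) e h →
    Injection A (inside ∷ e) (just c ∷ h)

∈-injections : ∀ {q N} A (e : Subset N) {h : Partial q N} → h ∈ injections A e → Injection A e h
∈-injections A []            (here refl) = []
∈-injections A (outside ∷ e) h∈ with ∈-map⁻ (nothing ∷_) h∈
... | h , h∈′ , refl = skip (∈-injections A e h∈′)
∈-injections {q} A (inside ∷ e) h∈
  with find (∈-concatMap⁻ (λ c → map (just c ∷_) (injections (A without c) e)) {xs = filter (_∈? A) (allFin q)} h∈)
... | c , c∈ , h∈′ with ∈-map⁻ (just c ∷_) h∈′
...   | h , h∈″ , refl = use (proj₂ (∈-filter⁻ (_∈? A) {xs = allFin q} c∈)) (∈-injections (A without c) e h∈″)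

size-injection : ∀ {q N A} {e : Subset N} {h : Partial q N} → Injection A e h → size h ≡ ∣ e ∣
size-injection []        = refl
size-injection (skip i)  = size-injection i
size-injection (use _ i) = cong suc (size-injection i)

dom : ∀ {q N} → Partial q N → Subset N
dom = Vec.map is-just

∣dom∣ : ∀ {q N} (T : Partial q N) → ∣ dom T ∣ ≡ size T
∣dom∣ []            = refl
∣dom∣ (nothing ∷ T) = ∣dom∣ T
∣dom∣ (just _ ∷ T)  = cong suc (∣dom∣ T)

dom-⊆ : ∀ {q N A} {e : Subset N} {h T : Partial q N} → Injection A e h → T ⊑ h → dom T ⊆ e
dom-⊆ {T = nothing ∷ T} (skip i)  p (there x∈) = there (dom-⊆ i (p ∘ suc) x∈)
dom-⊆ {T = just _ ∷ T}  (skip i)  p x∈         with () ← p zero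
dom-⊆ {T = nothing ∷ T} (use _ i) p (there x∈) = there (dom-⊆ i (p ∘ suc) x∈)
dom-⊆ {T = just _ ∷ T}  (use _ i) p here       = here
dom-⊆ {T = just _ ∷ T}  (use _ i) p (there x∈) = there (dom-⊆ i (p ∘ suc) x∈)

length-injections : ∀ {q N} A (e : Subset N) → (∑[ _ ← injections {q} A e ] 1) ≡ falling ∣ A ∣ ∣ e ∣
length-injections A []            = refl
length-injections A (outside ∷ e) = trans (∑-map (nothing ∷_) (injections A e) _) (length-injections A e)
length-injections {q} A (inside ∷ e) = begin
  (∑[ _ ← injections A (inside ∷ e) ] 1)
    ≡⟨ ∑-injections A e (λ _ → 1) ⟩
  (∑[ c ← allFin q ] ind (c ∈? A) * (∑[ _ ← injections (A without c) e ] 1))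
    ≡⟨ ∑-cong (allFin q) step ⟩
  (∑[ c ← allFin q ] ind (c ∈? A) * falling (∣ A ∣ ∸ 1) ∣ e ∣)
    ≡⟨ ∑-*ʳ (allFin q) (falling (∣ A ∣ ∸ 1) ∣ e ∣) (λ c → ind (c ∈? A)) ⟩
  (∑[ c ← allFin q ] ind (c ∈? A)) * falling (∣ A ∣ ∸ 1) ∣ e ∣
    ≡⟨ cong (_* falling (∣ A ∣ ∸ 1) ∣ e ∣) (∑-∈? A) ⟩
  ∣ A ∣ * falling (∣ A ∣ ∸ 1) ∣ e ∣
    ≡⟨ falling-suc ∣ A ∣ ∣ e ∣ ⟩
  falling ∣ A ∣ (suc ∣ e ∣) ∎
  where
  open ≡-Reasoning
  step : ∀ c → ind (c ∈? A) * (∑[ _ ← injections (A without c) e ] 1) ≡ ind (c ∈? A) * falling (∣ A ∣ ∸ 1) ∣ e ∣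
  step c with c ∈? A
  ... | yes c∈ = cong (1 *_) (trans (length-injections (A without c) e) (cong (λ n → falling n ∣ e ∣) (∣without∣ A c∈)))
  ... | no _   = refl

-- Colors are struck from `A` as they are used, so this indicates that `T` is injective with colors
-- in `A`. It is a number because it enters products.
injectiveInto : ∀ {q N} → Subset q → Partial q N → ℕ
injectiveInto A []            = 1
injectiveInto A (nothing ∷ T) = injectiveInto A T
injectiveInto A (just c ∷ T)  = ind (c ∈? A) * injectiveInto (A without c) T

injectiveInto≤1 : ∀ {q N} A (T : Partial q N) → injectiveInto A T ≤ 1
injectiveInto≤1 A []            = ≤-refl
injectiveInto≤1 A (nothing ∷ T) = injectiveInto≤1 A T
injectiveInto≤1 A (just c ∷ T)  = *-mono-≤ (ind≤1 (c ∈? A)) (injectiveInto≤1 (A without c) T)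

-- If `T` is injective into `A`, the surviving `c` are the colors of `A` that `T` does not use. The
-- induction moves the removal of `c` past that of the first color `d` of `T`, as the two differ.
unused-colors : ∀ {q N} A (T : Partial q N) →
  (∑[ c ← allFin q ] ind (c ∈? A) * injectiveInto (A without c) T) ≤ injectiveInto A T * (∣ A ∣ ∸ size T)
unused-colors {q} A [] = ≤-reflexive (trans (∑-cong (allFin q) λ c → *-identityʳ _)
  (trans (∑-∈? A) (sym (*-identityˡ _))))
unused-colors A (nothing ∷ T) = unused-colors A T
unused-colors {q} A (just d ∷ T) = begin
  (∑[ c ← allFin q ] ind (c ∈? A) * (ind (d ∈? (A without c)) * injectiveInto (A without c without d) T))
    ≤⟨ ∑-mono (allFin q) (λ c _ → exchange c) ⟩
  (∑[ c ← allFin q ] ind (d ∈? A) * (ind (c ∈? (A without d)) * injectiveInto (A without d without c) T))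
    ≡⟨ ∑-*ˡ (allFin q) (ind (d ∈? A)) _ ⟩
  ind (d ∈? A) * (∑[ c ← allFin q ] ind (c ∈? (A without d)) * injectiveInto (A without d without c) T)
    ≤⟨ *-monoʳ-≤ (ind (d ∈? A)) (unused-colors (A without d) T) ⟩
  ind (d ∈? A) * (injectiveInto (A without d) T * (∣ A without d ∣ ∸ size T))
    ≡⟨ final ⟩
  ind (d ∈? A) * injectiveInto (A without d) T * (∣ A ∣ ∸ suc (size T)) ∎
  where
  open ≤-Reasoning
  exchange : ∀ c → ind (c ∈? A) * (ind (d ∈? (A without c)) * injectiveInto (A without c without d) T)
    ≤ ind (d ∈? A) * (ind (c ∈? (A without d)) * injectiveInto (A without d without c) T)
  exchange c = ind-elim (c ∈? A) λ c∈ → ind-elim (d ∈? (A without c)) λ d∈ →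
    let (d∈A , d≢c) = ∈-without⁻ {A = A} d∈ in ≤-reflexive (sym (begin-equality
      ind (d ∈? A) * (ind (c ∈? (A without d)) * injectiveInto (A without d without c) T)
        ≡⟨ cong₂ (λ x y → x * (y * injectiveInto (A without d without c) T))
             (ind-yes (d ∈? A) d∈A) (ind-yes (c ∈? (A without d)) (∈-without⁺ c∈ (d≢c ∘ sym))) ⟩
      1 * (1 * injectiveInto (A without d without c) T)
        ≡⟨ trans (*-identityˡ _) (*-identityˡ _) ⟩
      injectiveInto (A without d without c) T
        ≡⟨ cong (λ B → injectiveInto B T) ([]≔-commutes A d c d≢c) ⟩
      injectiveInto (A without c without d) T ∎))
  final : ind (d ∈? A) * (injectiveInto (A without d) T * (∣ A without d ∣ ∸ size T))
    ≡ ind (d ∈? A) * injectiveInto (A without d) T * (∣ A ∣ ∸ suc (size T))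
  final with d ∈? A
  ... | yes d∈ = trans (sym (*-assoc 1 (injectiveInto (A without d) T) _))
    (cong (1 * injectiveInto (A without d) T *_) (trans (cong (_∸ size T) (∣without∣ A d∈)) (∸-+-assoc ∣ A ∣ 1 (size T))))
  ... | no _   = refl

free : ∀ {q N} → Subset N → Partial q N → ℕ
free []            []            = 0
free (outside ∷ e) (_ ∷ T)       = free e T
free (inside ∷ e)  (nothing ∷ T) = suc (free e T)
free (inside ∷ e)  (just _ ∷ T)  = free e T

free-size : ∀ {q N} (e : Subset N) (T : Partial q N) → dom T ⊆ e → size T + free e T ≡ ∣ e ∣
free-size []            []            p = refl
free-size (outside ∷ e) (nothing ∷ T) p = free-size e T (drop-∷-⊆ p)
free-size (outside ∷ e) (just _ ∷ T)  p with () ← p here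
free-size (inside ∷ e)  (nothing ∷ T) p = trans (+-suc (size T) (free e T)) (cong suc (free-size e T (drop-∷-⊆ p)))
free-size (inside ∷ e)  (just _ ∷ T)  p = cong suc (free-size e T (drop-∷-⊆ p))

-- An injective `T` leaves `∣ A ∣ ∸ size T` colors, and the free vertices of `e` take distinct ones
-- among them.
extensions : ∀ {q N} A (e : Subset N) (T : Partial q N) →
  (∑[ h ← injections A e ] ind (T ⊑? h)) ≤ injectiveInto A T * falling (∣ A ∣ ∸ size T) (free e T)
extensions A []            []            = ≤-refl
extensions A (outside ∷ e) (t ∷ T) = ≤-trans (≤-reflexive (∑-map (nothing ∷_) (injections A e) _)) (go t)
  where
  go : ∀ t → (∑[ h ← injections A e ] ind ((t ∷ T) ⊑? (nothing ∷ h)))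
    ≤ injectiveInto A (t ∷ T) * falling (∣ A ∣ ∸ size (t ∷ T)) (free e T)
  go nothing  = ≤-trans
    (∑-mono (injections A e) λ h _ → ind-mono ((nothing ∷ T) ⊑? (nothing ∷ h)) (T ⊑? h) (_∘ suc))
    (extensions A e T)
  go (just d) = ≤-trans (≤-reflexive (trans (∑-cong (injections A e) λ h →
    ind-no ((just d ∷ T) ⊑? (nothing ∷ h)) λ p → absurd (p zero)) (∑-0 (injections A e)))) z≤n
    where
    absurd : ¬ (just d ≼ nothing)
    absurd ()
extensions {q} A (inside ∷ e) (nothing ∷ T) = begin
  (∑[ h ← injections A (inside ∷ e) ] ind ((nothing ∷ T) ⊑? h))
    ≡⟨ ∑-injections A e (λ h → ind ((nothing ∷ T) ⊑? h)) ⟩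
  (∑[ c ← allFin q ] ind (c ∈? A) * (∑[ h ← injections (A without c) e ] ind ((nothing ∷ T) ⊑? (just c ∷ h))))
    ≤⟨ ∑-mono (allFin q) (λ c _ → ≤-trans (step c)
         (≤-reflexive (sym (*-assoc (ind (c ∈? A)) (injectiveInto (A without c) T) F)))) ⟩
  (∑[ c ← allFin q ] ind (c ∈? A) * injectiveInto (A without c) T * F)
    ≡⟨ ∑-*ʳ (allFin q) F (λ c → ind (c ∈? A) * injectiveInto (A without c) T) ⟩
  (∑[ c ← allFin q ] ind (c ∈? A) * injectiveInto (A without c) T) * F
    -- The color of this free vertex must also avoid the colors that `T` has at later vertices.
    ≤⟨ *-monoˡ-≤ F (unused-colors A T) ⟩
  injectiveInto A T * (∣ A ∣ ∸ size T) * F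
    ≡⟨ *-assoc (injectiveInto A T) _ F ⟩
  injectiveInto A T * ((∣ A ∣ ∸ size T) * F)
    ≡⟨ cong (λ n → injectiveInto A T * ((∣ A ∣ ∸ size T) * falling n (free e T))) (∸-swap ∣ A ∣ (size T)) ⟩
  injectiveInto A T * ((∣ A ∣ ∸ size T) * falling (∣ A ∣ ∸ size T ∸ 1) (free e T))
    ≡⟨ cong (injectiveInto A T *_) (falling-suc (∣ A ∣ ∸ size T) (free e T)) ⟩
  injectiveInto A T * falling (∣ A ∣ ∸ size T) (suc (free e T)) ∎
  where
  open ≤-Reasoning
  F : ℕ
  F = falling (∣ A ∣ ∸ 1 ∸ size T) (free e T)
  ∸-swap : ∀ a t → a ∸ 1 ∸ t ≡ a ∸ t ∸ 1
  ∸-swap a t = trans (∸-+-assoc a 1 t) (trans (cong (a ∸_) (+-comm 1 t)) (sym (∸-+-assoc a t 1)))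
  step : ∀ c → ind (c ∈? A) * (∑[ h ← injections (A without c) e ] ind ((nothing ∷ T) ⊑? (just c ∷ h)))
    ≤ ind (c ∈? A) * (injectiveInto (A without c) T * F)
  step c with c ∈? A
  ... | no _   = z≤n
  ... | yes c∈ = *-monoʳ-≤ 1 (≤-trans
    (∑-mono (injections (A without c) e) λ h _ → ind-mono ((nothing ∷ T) ⊑? (just c ∷ h)) (T ⊑? h) (_∘ suc))
    (≤-trans (extensions (A without c) e T)
      (≤-reflexive (cong (λ n → injectiveInto (A without c) T * falling (n ∸ size T) (free e T)) (∣without∣ A c∈)))))
extensions {q} A (inside ∷ e) (just d ∷ T) = begin
  (∑[ h ← injections A (inside ∷ e) ] ind ((just d ∷ T) ⊑? h))
    ≡⟨ ∑-injections A e (λ h → ind ((just d ∷ T) ⊑? h)) ⟩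
  (∑[ c ← allFin q ] ind (c ∈? A) * (∑[ h ← injections (A without c) e ] ind ((just d ∷ T) ⊑? (just c ∷ h))))
    ≤⟨ ∑-mono (allFin q) (λ c _ → step c) ⟩
  (∑[ c ← allFin q ] ind (c Fin.≟ d) * (injectiveInto A (just d ∷ T) * F))
    ≡⟨ ∑-*ʳ (allFin q) (injectiveInto A (just d ∷ T) * F) (λ c → ind (c Fin.≟ d)) ⟩
  (∑[ c ← allFin q ] ind (c Fin.≟ d)) * (injectiveInto A (just d ∷ T) * F)
    ≤⟨ *-monoˡ-≤ (injectiveInto A (just d ∷ T) * F) (∑-δ q d) ⟩
  1 * (injectiveInto A (just d ∷ T) * F)
    ≡⟨ *-identityˡ _ ⟩
  injectiveInto A (just d ∷ T) * F ∎
  where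
  open ≤-Reasoning
  F : ℕ
  F = falling (∣ A ∣ ∸ suc (size T)) (free e T)
  step : ∀ c → ind (c ∈? A) * (∑[ h ← injections (A without c) e ] ind ((just d ∷ T) ⊑? (just c ∷ h)))
    ≤ ind (c Fin.≟ d) * (injectiveInto A (just d ∷ T) * F)
  step c with c Fin.≟ d
  ... | no c≢d = ≤-reflexive (trans (cong (ind (c ∈? A) *_) (trans (∑-cong (injections (A without c) e) λ h →
    ind-no ((just d ∷ T) ⊑? (just c ∷ h)) λ p → absurd (p zero)) (∑-0 (injections (A without c) e)))) (*-zeroʳ (ind (c ∈? A))))
    where
    absurd : ¬ (just d ≼ just c)
    absurd just≼ = c≢d refl
  ... | yes refl with c ∈? A
  ...   | no _   = z≤n
  ...   | yes c∈ = begin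
    1 * (∑[ h ← injections (A without c) e ] ind ((just c ∷ T) ⊑? (just c ∷ h)))
      ≤⟨ *-monoʳ-≤ 1 (∑-mono (injections (A without c) e) λ h _ → ind-mono ((just c ∷ T) ⊑? (just c ∷ h)) (T ⊑? h) (_∘ suc)) ⟩
    1 * (∑[ h ← injections (A without c) e ] ind (T ⊑? h))
      ≤⟨ *-monoʳ-≤ 1 (extensions (A without c) e T) ⟩
    1 * (injectiveInto (A without c) T * falling (∣ A without c ∣ ∸ size T) (free e T))
      ≡⟨ cong (λ n → 1 * (injectiveInto (A without c) T * falling n (free e T)))
           (trans (cong (_∸ size T) (∣without∣ A c∈)) (∸-+-assoc ∣ A ∣ 1 (size T))) ⟩
    1 * (injectiveInto (A without c) T * F)
      ≡⟨ cong (λ x → 1 * (x * F)) (*-identityˡ (injectiveInto (A without c) T)) ⟨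
    1 * (1 * injectiveInto (A without c) T * F) ∎

-- The spread family of colored edges

visible : ∀ {q N} → Subset N → Coloring q N → Partial q N
visible = zipWith λ s c → if s then just c else nothing

visible-∈ : ∀ {q N A} {e : Subset N} {h} (M : Subset N) (c : Coloring q N) →
  Injection A e h → h ⊑ visible M c → ∀ {x} → x ∈ₛ e → x ∈ₛ M × lookup c x ∈ₛ A
visible-∈ (_ ∷ M)       (_ ∷ c) (skip i)   p (there x∈) = let (m , a) = visible-∈ M c i (p ∘ suc) x∈ in there m , a
visible-∈ (inside ∷ M)  (_ ∷ c) (use c∈ i) p here with just≼ ← p zero = here , c∈
visible-∈ (outside ∷ M) (_ ∷ c) (use c∈ i) p here with () ← p zero
visible-∈ {A = A} (_ ∷ M) (_ ∷ c) (use c∈ i) p (there x∈) =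
  let (m , a) = visible-∈ M c i (p ∘ suc) x∈ in there m , proj₁ (∈-without⁻ {A = A} a)

-- A color used at one vertex is removed from `A` for the later ones, whose visible colors lie in
-- the reduced set by `visible-∈`.
visible-rainbow : ∀ {q N A} {e : Subset N} {h} (M : Subset N) (c : Coloring q N) →
  Injection A e h → h ⊑ visible M c → Rainbow c e
visible-rainbow (_ ∷ M) (_ ∷ c) (skip i) p (suc x) (suc y) (there x∈) (there y∈) eq =
  cong suc (visible-rainbow M c i (p ∘ suc) x y x∈ y∈ eq)
visible-rainbow (_ ∷ M) (_ ∷ c) (use _ i) p zero zero x∈ y∈ eq = refl
visible-rainbow (_ ∷ M) (_ ∷ c) (use _ i) p (suc x) (suc y) (there x∈) (there y∈) eq =
  cong suc (visible-rainbow M c i (p ∘ suc) x y x∈ y∈ eq)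
visible-rainbow {A = A} (inside ∷ M) (_ ∷ c) (use _ i) p zero (suc y) x∈ (there y∈) eq with just≼ ← p zero =
  contradiction (sym eq) (proj₂ (∈-without⁻ {A = A} (proj₂ (visible-∈ M c i (p ∘ suc) y∈))))
visible-rainbow {A = A} (inside ∷ M) (_ ∷ c) (use _ i) p (suc x) zero (there x∈) y∈ eq with just≼ ← p zero =
  contradiction eq (proj₂ (∈-without⁻ {A = A} (proj₂ (visible-∈ M c i (p ∘ suc) x∈))))
visible-rainbow (outside ∷ M) (_ ∷ c) (use _ i) p zero (suc y) x∈ y∈ eq with () ← p zero
visible-rainbow (outside ∷ M) (_ ∷ c) (use _ i) p (suc x) zero x∈ y∈ eq with () ← p zero

module ColoredEdges {N : ℕ} (H : Hypergraph N) (q r k : ℕ) (r≤q : r ≤ q) (bounded : Bounded r H)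
  (spread : ∀ S → degree H S * k ^ ∣ S ∣ ≤ length (edges H)) where

  coloredEdges : List (Subset N × Partial q N)
  coloredEdges = concatMap (λ e → map (e ,_) (injections ⊤ e)) (edges H)

  ∈-coloredEdges : ∀ {e h} → (e , h) ∈ coloredEdges → e ∈ edges H × Injection ⊤ e h
  ∈-coloredEdges {e} {h} p with find (∈-concatMap⁻ (λ e → map (e ,_) (injections ⊤ e)) {xs = edges H} p)
  ... | e , e∈ , h∈ with ∈-map⁻ (e ,_) h∈
  ...   | h , h∈′ , refl = e∈ , ∈-injections ⊤ e h∈′

  ∑-coloredEdges : (f : Subset N × Partial q N → ℕ) →
    ∑ coloredEdges f ≡ (∑[ e ← edges H ] ∑[ h ← injections ⊤ e ] f (e , h))
  ∑-coloredEdges f = trans (∑-concatMap _ (edges H) f)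
    (∑-cong (edges H) λ e → ∑-map (e ,_) (injections ⊤ e) f)

  -- Chosen so that every edge gets the same total multiplicity falling q r.
  multiplicity : Subset N → ℕ
  multiplicity e = falling (q ∸ ∣ e ∣) (r ∸ ∣ e ∣)

  falling-multiplicity : ∀ e → e ∈ edges H → falling q ∣ e ∣ * multiplicity e ≡ falling q r
  falling-multiplicity e e∈ = trans (sym (falling-+ q ∣ e ∣ (r ∸ ∣ e ∣)))
    (cong (falling q) (m+[n∸m]≡n (All.lookup bounded e∈)))

  μ₀ : ℕ
  μ₀ = length (edges H) * falling q r

  -- Among the injective colorings of `e`, a share of at most 1 / `falling q t` extends `T`, where t
  -- is its size, and `power≤falling` turns this into (4 / q) ^ t. The multiplicity brings all edges
  -- to the common total `falling q r`.
  edge-extensions : ∀ T e → e ∈ edges H →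
    (∑[ h ← injections {q} ⊤ e ] ind (T ⊑? h)) * multiplicity e * q ^ size T
      ≤ ind (dom T ⊆? e) * (4 ^ size T * falling q r)
  edge-extensions T e e∈ with dom T ⊆? e
  ... | no ⊈ = ≤-reflexive (cong (λ s → s * multiplicity e * q ^ size T) (n≤0⇒n≡0 (≤-trans
    (∑-mono (injections ⊤ e) λ h h∈ → ≤-reflexive
      (ind-no (T ⊑? h) λ p → ⊈ (dom-⊆ (∈-injections ⊤ e h∈) p)))
    (≤-reflexive (∑-0 (injections ⊤ e))))))
  ... | yes ⊆e = begin
    (∑[ h ← injections ⊤ e ] ind (T ⊑? h)) * multiplicity e * q ^ t
      ≤⟨ *-monoˡ-≤ (q ^ t) (*-monoˡ-≤ (multiplicity e) (≤-trans (extensions ⊤ e T)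
           (≤-trans (*-monoˡ-≤ _ (injectiveInto≤1 ⊤ T)) (≤-reflexive (*-identityˡ _))))) ⟩
    falling (∣ ⊤ {q} ∣ ∸ t) f * multiplicity e * q ^ t
      ≡⟨ cong (λ n → falling (n ∸ t) f * multiplicity e * q ^ t) (∣⊤∣≡n q) ⟩
    falling (q ∸ t) f * multiplicity e * q ^ t
      ≤⟨ *-monoʳ-≤ (falling (q ∸ t) f * multiplicity e) (power≤falling q t t≤q) ⟩
    falling (q ∸ t) f * multiplicity e * (4 ^ t * falling q t)
      ≡⟨ r₁ (falling (q ∸ t) f) (multiplicity e) (4 ^ t) (falling q t) ⟩
    4 ^ t * (falling q t * falling (q ∸ t) f * multiplicity e)
      ≡⟨ cong (λ x → 4 ^ t * (x * multiplicity e)) (trans (sym (falling-+ q t f)) (cong (falling q) t+f)) ⟩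
    4 ^ t * (falling q ∣ e ∣ * multiplicity e)
      ≡⟨ cong (4 ^ t *_) (falling-multiplicity e e∈) ⟩
    4 ^ t * falling q r
      ≡⟨ *-identityˡ _ ⟨
    1 * (4 ^ t * falling q r) ∎
    where
    open ≤-Reasoning
    t f : ℕ
    t = size T
    f = free e T
    t+f : t + f ≡ ∣ e ∣
    t+f = free-size e T ⊆e
    t≤q : t ≤ q
    t≤q = ≤-trans (m≤m+n t f) (≤-trans (≤-reflexive t+f) (≤-trans (All.lookup bounded e∈) r≤q))
    r₁ : ∀ a b c d → a * b * (c * d) ≡ c * (d * a * b)
    r₁ = solve-∀

  -- An edge must contain the vertices of `T`, which by the spread of `H` costs a factor k for each,
  -- and its coloring must agree with `T`, which costs q / 4 for each. Hence `K` is `k * q` and `B`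
  -- is 4.
  family : Family q N (k * q) 4 μ₀ r
  family = record
    { indices = coloredEdges
    ; μ       = multiplicity ∘ proj₁
    ; ed      = proj₂
    ; bounded = λ _ p → let (e∈ , i) = ∈-coloredEdges p in
                  ≤-trans (≤-reflexive (size-injection i)) (All.lookup bounded e∈)
    ; spread  = family-spread
    }
    where
    family-spread : ∀ T → (∑[ a ← coloredEdges ] ind (T ⊑? proj₂ a) * multiplicity (proj₁ a)) * (k * q) ^ size T
      ≤ μ₀ * 4 ^ size T
    family-spread T = begin
      (∑[ a ← coloredEdges ] ind (T ⊑? proj₂ a) * multiplicity (proj₁ a)) * (k * q) ^ t
        ≡⟨ cong₂ _*_ (∑-coloredEdges _) (^-distrib-* t k q) ⟩
      (∑[ e ← edges H ] ∑[ h ← injections ⊤ e ] ind (T ⊑? h) * multiplicity e) * (k ^ t * q ^ t)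
        ≡⟨ cong (_* (k ^ t * q ^ t)) (∑-cong (edges H) λ e → ∑-*ʳ (injections ⊤ e) (multiplicity e) (λ h → ind (T ⊑? h))) ⟩
      (∑[ e ← edges H ] X e * multiplicity e) * (k ^ t * q ^ t)
        ≡⟨ r₁ (∑[ e ← edges H ] X e * multiplicity e) (k ^ t) (q ^ t) ⟩
      (∑[ e ← edges H ] X e * multiplicity e) * q ^ t * k ^ t
        ≡⟨ cong (_* k ^ t) (∑-*ʳ (edges H) (q ^ t) (λ e → X e * multiplicity e)) ⟨
      (∑[ e ← edges H ] (X e * multiplicity e * q ^ t)) * k ^ t
        ≤⟨ *-monoˡ-≤ (k ^ t) (∑-mono (edges H) (edge-extensions T)) ⟩
      (∑[ e ← edges H ] (ind (dom T ⊆? e) * (4 ^ t * falling q r))) * k ^ t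
        ≡⟨ cong (_* k ^ t) (trans (∑-*ʳ (edges H) (4 ^ t * falling q r) (λ e → ind (dom T ⊆? e)))
             (cong (_* (4 ^ t * falling q r)) (sym (length-filter-∑ (dom T ⊆?_) (edges H))))) ⟩
      degree H (dom T) * (4 ^ t * falling q r) * k ^ t
        ≡⟨ cong (λ s → degree H (dom T) * (4 ^ t * falling q r) * k ^ s) (∣dom∣ T) ⟨
      degree H (dom T) * (4 ^ t * falling q r) * k ^ ∣ dom T ∣
        ≡⟨ r₂ (degree H (dom T)) (4 ^ t) (falling q r) (k ^ ∣ dom T ∣) ⟩
      degree H (dom T) * k ^ ∣ dom T ∣ * (falling q r * 4 ^ t)
        ≤⟨ *-monoˡ-≤ (falling q r * 4 ^ t) (spread (dom T)) ⟩
      length (edges H) * (falling q r * 4 ^ t)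
        ≡⟨ *-assoc (length (edges H)) (falling q r) (4 ^ t) ⟨
      μ₀ * 4 ^ t ∎
      where
      open ≤-Reasoning
      t : ℕ
      t = size T
      X : Subset N → ℕ
      X e = ∑[ h ← injections ⊤ e ] ind (T ⊑? h)
      r₁ : ∀ s x y → s * (x * y) ≡ s * y * x
      r₁ = solve-∀
      r₂ : ∀ d a f x → d * (a * f) * x ≡ d * x * (f * a)
      r₂ = solve-∀

  mass-family : Round.mass family ≡ μ₀
  mass-family = begin
    ∑ coloredEdges (multiplicity ∘ proj₁)
      ≡⟨ ∑-coloredEdges (multiplicity ∘ proj₁) ⟩
    (∑[ e ← edges H ] ∑[ _ ← injections {q} ⊤ e ] multiplicity e)
      ≡⟨ ∑-cong (edges H) (λ e → trans (∑-cong (injections {q} ⊤ e) λ _ → sym (*-identityˡ (multiplicity e)))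
           (trans (∑-*ʳ (injections {q} ⊤ e) (multiplicity e) (λ _ → 1)) (cong (_* multiplicity e)
             (trans (length-injections {q} ⊤ e) (cong (λ n → falling n ∣ e ∣) (∣⊤∣≡n q)))))) ⟩
    (∑[ e ← edges H ] falling q ∣ e ∣ * multiplicity e)
      ≡⟨ ≤-antisym (∑-mono (edges H) λ e e∈ → ≤-reflexive (falling-multiplicity e e∈))
           (∑-mono (edges H) λ e e∈ → ≤-reflexive (sym (falling-multiplicity e e∈))) ⟩
    (∑[ e ← edges H ] falling q r)
      ≡⟨ ∑-const (edges H) (falling q r) ⟩
    μ₀ ∎
    where open ≡-Reasoning

  hit⇒rainbow : ∀ M c → Round.Hit family (visible M c) → ContainsRainbowEdge H (M , c)
  hit⇒rainbow M c hit with find hit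
  ... | (e , h) , p , h⊑ = let (e∈ , i) = ∈-coloredEdges p in
    lose e∈ ((λ x∈ → proj₁ (visible-∈ M c i h⊑ x∈)) , visible-rainbow M c i h⊑)

-- From binomial random subsets to subsets of size m

sides : List Bool
sides = inside ∷ outside ∷ []

subsets : ∀ N → List (Subset N)
subsets = allVecs sides

∑-subsets : ∀ N (f : Subset (suc N) → ℕ) →
  ∑ (subsets (suc N)) f ≡ (∑[ M ← subsets N ] f (inside ∷ M)) + (∑[ M ← subsets N ] f (outside ∷ M))
∑-subsets N f = trans (∑-allVecs sides N f) (cong ((∑[ M ← subsets N ] f (inside ∷ M)) +_) (+-identityʳ _))

sideWeight : ℕ → ℕ → Bool → ℕ
sideWeight a b s = if s then a else b

subsetWeight : ∀ {N} → ℕ → ℕ → Subset N → ℕ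
subsetWeight a b = weight (sideWeight a b)

-- A vertex outside `M` has weight `b` for each of its `q` hidden colors, which together make up the
-- weight `q * b` of `nothing`.
∑-visible : ∀ q N a b (f : Partial q N → ℕ) →
  (∑[ M ← subsets N ] subsetWeight a b M * (∑[ c ← colorings q N ] f (visible M c)))
    ≡ (∑[ W ← partials q N ] wt a (q * b) W * f W)
∑-visible q zero    a b f = base (f [])
  where
  base : ∀ y → 1 * (y + 0) + 0 ≡ 1 * y + 0
  base = solve-∀
∑-visible q (suc N) a b f = begin
  (∑[ M ← subsets (suc N) ] subsetWeight a b M * (∑[ c ← colorings q (suc N) ] f (visible M c)))
    ≡⟨ ∑-weight (sideWeight a b) sides N _ ⟩
  (∑[ s ← sides ] sideWeight a b s *
    (∑[ M ← subsets N ] subsetWeight a b M * (∑[ c ← colorings q (suc N) ] f (visible (s ∷ M) c))))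
    ≡⟨ ∑-cong sides (λ s → cong (sideWeight a b s *_) (side s)) ⟩
  (∑[ s ← sides ] sideWeight a b s * (∑[ c₀ ← allFin q ] Z (if s then just c₀ else nothing)))
    ≡⟨ cong₂ (λ x y → a * x + (b * y + 0)) refl (∑-allFin-const q (Z nothing)) ⟩
  a * (∑[ c₀ ← allFin q ] Z (just c₀)) + (b * (q * Z nothing) + 0)
    ≡⟨ rearrange a b q (∑[ c₀ ← allFin q ] Z (just c₀)) (Z nothing) ⟩
  q * b * Z nothing + a * (∑[ c₀ ← allFin q ] Z (just c₀))
    ≡⟨ cong (q * b * Z nothing +_) (∑-*ˡ (allFin q) a (Z ∘ just)) ⟨
  q * b * Z nothing + (∑[ c₀ ← allFin q ] a * Z (just c₀))
    ≡⟨ ∑-states q (λ w → stateWeight a (q * b) w * Z w) ⟨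
  (∑[ w ← states q ] stateWeight a (q * b) w * Z w)
    ≡⟨ ∑-weight (stateWeight a (q * b)) (states q) N f ⟨
  (∑[ W ← partials q (suc N) ] wt a (q * b) W * f W) ∎
  where
  open ≡-Reasoning
  Z : Maybe (Fin q) → ℕ
  Z w = ∑[ W ← partials q N ] wt a (q * b) W * f (w ∷ W)
  rearrange : ∀ a b q s z → a * s + (b * (q * z) + 0) ≡ q * b * z + a * s
  rearrange = solve-∀
  side : ∀ s → (∑[ M ← subsets N ] subsetWeight a b M * (∑[ c ← colorings q (suc N) ] f (visible (s ∷ M) c)))
    ≡ (∑[ c₀ ← allFin q ] Z (if s then just c₀ else nothing))
  side s = begin
    (∑[ M ← subsets N ] subsetWeight a b M * (∑[ c ← colorings q (suc N) ] f (visible (s ∷ M) c)))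
      ≡⟨ ∑-cong (subsets N) (λ M → trans (cong (subsetWeight a b M *_) (∑-allVecs (allFin q) N (λ c → f (visible (s ∷ M) c))))
           (sym (∑-*ˡ (allFin q) (subsetWeight a b M) _))) ⟩
    (∑[ M ← subsets N ] ∑[ c₀ ← allFin q ] subsetWeight a b M *
      (∑[ c ← colorings q N ] f ((if s then just c₀ else nothing) ∷ visible M c)))
      ≡⟨ ∑-swap (subsets N) (allFin q) _ ⟩
    (∑[ c₀ ← allFin q ] ∑[ M ← subsets N ] subsetWeight a b M *
      (∑[ c ← colorings q N ] f ((if s then just c₀ else nothing) ∷ visible M c)))
      ≡⟨ ∑-cong (allFin q) (λ c₀ → ∑-visible q N a b (λ W → f ((if s then just c₀ else nothing) ∷ W))) ⟩
    (∑[ c₀ ← allFin q ] Z (if s then just c₀ else nothing)) ∎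

-- Averages over the subsets of a given size

level : ∀ {N} → (Subset N → ℕ) → ℕ → ℕ
level {N} f k = ∑[ M ← subsets N ] ind (∣ M ∣ ≟ k) * f M

level-zero : ∀ {N} (f : Subset (suc N) → ℕ) → level f 0 ≡ level (f ∘ (outside ∷_)) 0
level-zero {N} f = trans (∑-subsets N (λ M → ind (∣ M ∣ ≟ 0) * f M)) (cong (_+ level (f ∘ (outside ∷_)) 0) (∑-0 (subsets N)))

level-suc : ∀ {N} (f : Subset (suc N) → ℕ) k →
  level f (suc k) ≡ level (f ∘ (inside ∷_)) k + level (f ∘ (outside ∷_)) (suc k)
level-suc {N} f k = trans (∑-subsets N (λ M → ind (∣ M ∣ ≟ suc k) * f M))
  (cong (_+ level (f ∘ (outside ∷_)) (suc k)) (∑-cong (subsets N) λ M →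
    cong (_* f (inside ∷ M)) (ind-cong (suc ∣ M ∣ ≟ suc k) (∣ M ∣ ≟ k) suc-injective (cong suc))))

Antitone : ∀ {N} → (Subset N → ℕ) → Set
Antitone f = ∀ {M M′} → M ⊆ M′ → f M′ ≤ f M

-- The local LYM inequality (k + 1) level (k + 1) ≤ (N − k) level k, with both
-- sides moved so that no subtraction occurs.
level-antitone : ∀ {N} (f : Subset N → ℕ) → Antitone f → ∀ k →
  suc k * level f (suc k) + k * level f k ≤ N * level f k
level-antitone {zero} f anti zero    = ≤-refl
level-antitone {zero} f anti (suc k) = ≤-reflexive (cong₂ _+_ (*-zeroʳ (suc (suc k))) (*-zeroʳ (suc k)))
level-antitone {suc N} f anti k = go k
  where
  open ≤-Reasoning
  fᵢ fₒ : Subset N → ℕ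
  fᵢ = f ∘ (inside ∷_)
  fₒ = f ∘ (outside ∷_)
  in≤out : ∀ k → level fᵢ k ≤ level fₒ k
  in≤out k = ∑-mono (subsets N) λ M _ → *-monoʳ-≤ (ind (∣ M ∣ ≟ k)) (anti (out⊆ ⊆-refl))
  go : ∀ k → suc k * level f (suc k) + k * level f k ≤ suc N * level f k
  go zero = begin
    1 * level f 1 + 0
      ≡⟨ cong (λ x → 1 * x + 0) (level-suc f 0) ⟩
    1 * (level fᵢ 0 + level fₒ 1) + 0
      ≡⟨ r (level fᵢ 0) (level fₒ 1) ⟩
    level fᵢ 0 + (1 * level fₒ 1 + 0)
      ≤⟨ +-mono-≤ (in≤out 0) (level-antitone fₒ (λ p → anti (s⊆s p)) 0) ⟩
    level fₒ 0 + N * level fₒ 0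
      ≡⟨ cong (suc N *_) (level-zero f) ⟨
    suc N * level f 0 ∎
    where
    r : ∀ x y → 1 * (x + y) + 0 ≡ x + (1 * y + 0)
    r = solve-∀
  go (suc j) = begin
    suc (suc j) * level f (suc (suc j)) + suc j * level f (suc j)
      ≡⟨ cong₂ (λ x y → suc (suc j) * x + suc j * y) (level-suc f (suc j)) (level-suc f j) ⟩
    suc (suc j) * (level fᵢ (suc j) + level fₒ (suc (suc j))) + suc j * (level fᵢ j + level fₒ (suc j))
      ≡⟨ r₁ j (level fᵢ (suc j)) (level fₒ (suc (suc j))) (level fᵢ j) (level fₒ (suc j)) ⟩
    (suc j * level fᵢ (suc j) + j * level fᵢ j) + level fᵢ j + level fᵢ (suc j)
      + (suc (suc j) * level fₒ (suc (suc j)) + suc j * level fₒ (suc j))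
      -- Beside the two induction hypotheses, one copy of `level fᵢ (suc j)` is left over; by
      -- antitonicity it is at most the copy of `level fₒ (suc j)` still missing on the right.
      ≤⟨ +-mono-≤ (+-mono-≤ (+-monoˡ-≤ (level fᵢ j) (level-antitone fᵢ (λ p → anti (s⊆s p)) j)) (in≤out (suc j)))
           (level-antitone fₒ (λ p → anti (s⊆s p)) (suc j)) ⟩
    N * level fᵢ j + level fᵢ j + level fₒ (suc j) + N * level fₒ (suc j)
      ≡⟨ r₂ N (level fᵢ j) (level fₒ (suc j)) ⟩
    suc N * (level fᵢ j + level fₒ (suc j))
      ≡⟨ cong (suc N *_) (level-suc f j) ⟨
    suc N * level f (suc j) ∎
    where
    r₁ : ∀ j a b c d → (2 + j) * (a + b) + (1 + j) * (c + d)
      ≡ ((1 + j) * a + j * c) + c + a + ((2 + j) * b + (1 + j) * d)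
    r₁ = solve-∀
    r₂ : ∀ N c d → N * c + c + d + N * d ≡ (1 + N) * (c + d)
    r₂ = solve-∀

binomial : ℕ → ℕ → ℕ
binomial N = level {N} (λ _ → 1)

-- The case of equality in `level-antitone`.
binomial-step : ∀ N k → suc k * binomial N (suc k) + k * binomial N k ≡ N * binomial N k
binomial-step zero    zero    = refl
binomial-step zero    (suc k) = cong₂ _+_ (*-zeroʳ (suc (suc k))) (*-zeroʳ (suc k))
binomial-step (suc N) zero    = begin
  1 * binomial (suc N) 1 + 0
    ≡⟨ cong (λ x → 1 * x + 0) (level-suc {N} (λ _ → 1) 0) ⟩
  1 * (binomial N 0 + binomial N 1) + 0
    ≡⟨ r (binomial N 0) (binomial N 1) ⟩
  binomial N 0 + (1 * binomial N 1 + 0)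
    ≡⟨ cong (binomial N 0 +_) (binomial-step N 0) ⟩
  suc N * binomial N 0
    ≡⟨ cong (suc N *_) (level-zero {N} (λ _ → 1)) ⟨
  suc N * binomial (suc N) 0 ∎
  where
  open ≡-Reasoning
  r : ∀ x y → 1 * (x + y) + 0 ≡ x + (1 * y + 0)
  r = solve-∀
binomial-step (suc N) (suc j) = begin
  suc (suc j) * binomial (suc N) (suc (suc j)) + suc j * binomial (suc N) (suc j)
    ≡⟨ cong₂ (λ x y → suc (suc j) * x + suc j * y) (level-suc {N} (λ _ → 1) (suc j)) (level-suc {N} (λ _ → 1) j) ⟩
  suc (suc j) * (binomial N (suc j) + binomial N (suc (suc j))) + suc j * (binomial N j + binomial N (suc j))
    ≡⟨ r₁ j (binomial N (suc j)) (binomial N (suc (suc j))) (binomial N j) ⟩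
  (suc j * binomial N (suc j) + j * binomial N j) + binomial N j + binomial N (suc j)
    + (suc (suc j) * binomial N (suc (suc j)) + suc j * binomial N (suc j))
    ≡⟨ cong₂ (λ x y → x + binomial N j + binomial N (suc j) + y) (binomial-step N j) (binomial-step N (suc j)) ⟩
  N * binomial N j + binomial N j + binomial N (suc j) + N * binomial N (suc j)
    ≡⟨ r₂ N (binomial N j) (binomial N (suc j)) ⟩
  suc N * (binomial N j + binomial N (suc j))
    ≡⟨ cong (suc N *_) (level-suc {N} (λ _ → 1) j) ⟨
  suc N * binomial (suc N) (suc j) ∎
  where
  open ≡-Reasoning
  r₁ : ∀ j a b c → (2 + j) * (a + b) + (1 + j) * (c + a) ≡ ((1 + j) * a + j * c) + c + a + ((2 + j) * b + (1 + j) * a)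
  r₁ = solve-∀
  r₂ : ∀ N c d → N * c + c + d + N * d ≡ (1 + N) * (c + d)
  r₂ = solve-∀

binomial-pos : ∀ {N k} → k ≤ N → 0 < binomial N k
binomial-pos {zero}  z≤n = s≤s z≤n
binomial-pos {suc N} {zero} z≤n = ≤-trans (binomial-pos {N} z≤n) (≤-reflexive (sym (level-zero {N} (λ _ → 1))))
binomial-pos {suc N} {suc k} (s≤s k≤N) = ≤-trans (binomial-pos k≤N)
  (≤-trans (m≤m+n _ _) (≤-reflexive (sym (level-suc {N} (λ _ → 1) k))))

-- Dividing `level-antitone` by the equality `binomial-step` shows that averages over a level
-- decrease with its size; here the denominators are cleared.
level-ratio-step : ∀ {N} (f : Subset N → ℕ) → Antitone f → ∀ k →
  level f (suc k) * binomial N k ≤ level f k * binomial N (suc k)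
level-ratio-step {N} f anti k = *-cancelˡ-≤ (suc k) (+-cancelʳ-≤ (k * L * C) _ _ (begin
  suc k * (L′ * C) + k * L * C
    ≡⟨ r₁ (suc k) L′ C (k * L) ⟩
  (suc k * L′ + k * L) * C
    ≤⟨ *-monoˡ-≤ C (level-antitone f anti k) ⟩
  N * L * C
    ≡⟨ r₂ N L C ⟩
  L * (N * C)
    ≡⟨ cong (L *_) (binomial-step N k) ⟨
  L * (suc k * C′ + k * C)
    ≡⟨ r₃ L (suc k) C′ k C ⟩
  suc k * (L * C′) + k * L * C ∎))
  where
  open ≤-Reasoning
  L L′ C C′ : ℕ
  L  = level f k
  L′ = level f (suc k)
  C  = binomial N k
  C′ = binomial N (suc k)
  r₁ : ∀ s x c y → s * (x * c) + y * c ≡ (s * x + y) * c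
  r₁ = solve-∀
  r₂ : ∀ n l c → n * l * c ≡ l * (n * c)
  r₂ = solve-∀
  r₃ : ∀ l s x k c → l * (s * x + k * c) ≡ s * (l * x) + k * l * c
  r₃ = solve-∀

level-ratio : ∀ {N} (f : Subset N → ℕ) → Antitone f → ∀ k d → k + d ≤ N →
  level f (k + d) * binomial N k ≤ level f k * binomial N (k + d)
level-ratio {N} f anti k zero    _ rewrite +-identityʳ k = ≤-refl
level-ratio {N} f anti k (suc d) h rewrite +-suc k d =
  -- The binomial coefficient of the level in between is cancelled; it is positive because `k + d`
  -- is at most `N`.
  *-cancelʳ-≤ _ _ (binomial N (k + d)) {{>-nonZero (binomial-pos k+d≤N)}} (begin
    level f (suc (k + d)) * binomial N k * binomial N (k + d)
      ≡⟨ r (level f (suc (k + d))) (binomial N k) (binomial N (k + d)) ⟩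
    level f (suc (k + d)) * binomial N (k + d) * binomial N k
      ≤⟨ *-monoˡ-≤ (binomial N k) (level-ratio-step f anti (k + d)) ⟩
    level f (k + d) * binomial N (suc (k + d)) * binomial N k
      ≡⟨ r (level f (k + d)) (binomial N (suc (k + d))) (binomial N k) ⟩
    level f (k + d) * binomial N k * binomial N (suc (k + d))
      ≤⟨ *-monoˡ-≤ (binomial N (suc (k + d))) (level-ratio f anti k d k+d≤N) ⟩
    level f k * binomial N (k + d) * binomial N (suc (k + d))
      ≡⟨ r (level f k) (binomial N (k + d)) (binomial N (suc (k + d))) ⟩
    level f k * binomial N (suc (k + d)) * binomial N (k + d) ∎)
  where
  open ≤-Reasoning
  k+d≤N : k + d ≤ N
  k+d≤N = ≤-trans (n≤1+n (k + d)) h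
  r : ∀ x y z → x * y * z ≡ x * z * y
  r = solve-∀

-- Sizes of binomial random subsets

subsetWeight-size : ∀ {N} a b (M : Subset N) → subsetWeight a b M ≡ a ^ ∣ M ∣ * b ^ (N ∸ ∣ M ∣)
subsetWeight-size a b []            = refl
subsetWeight-size {suc N} a b (inside ∷ M) =
  trans (cong (a *_) (subsetWeight-size a b M)) (sym (*-assoc a (a ^ ∣ M ∣) (b ^ (N ∸ ∣ M ∣))))
subsetWeight-size {suc N} a b (outside ∷ M) = trans (cong (b *_) (subsetWeight-size a b M))
  (trans (r b (a ^ ∣ M ∣) (b ^ (N ∸ ∣ M ∣))) (cong (λ e → a ^ ∣ M ∣ * b ^ e) (sym (+-∸-assoc 1 (∣p∣≤n M)))))
  where
  r : ∀ b x y → b * (x * y) ≡ x * (b * y)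
  r = solve-∀

∑-subsetWeight : ∀ N a b → ∑ (subsets N) (subsetWeight a b) ≡ (a + b) ^ N
∑-subsetWeight N a b = trans (∑-weight-1 (sideWeight a b) sides N) (cong (λ x → (a + x) ^ N) (+-identityʳ b))

mean-size : ∀ N a b → (a + b) * (∑[ M ← subsets N ] subsetWeight a b M * ∣ M ∣) ≡ N * a * (a + b) ^ N
mean-size zero    a b = *-zeroʳ (a + b)
mean-size (suc N) a b = begin
  (a + b) * (∑[ M ← subsets (suc N) ] subsetWeight a b M * ∣ M ∣)
    ≡⟨ cong ((a + b) *_) (∑-weight (sideWeight a b) sides N ∣_∣) ⟩
  (a + b) * (a * (∑[ M ← subsets N ] subsetWeight a b M * suc ∣ M ∣) + (b * E + 0))
    ≡⟨ cong (λ x → (a + b) * (a * x + (b * E + 0))) (trans (∑-cong (subsets N) λ M → *-suc (subsetWeight a b M) ∣ M ∣)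
         (trans (∑-+ (subsets N) (subsetWeight a b) _) (cong (_+ E) (∑-subsetWeight N a b)))) ⟩
  (a + b) * (a * ((a + b) ^ N + E) + (b * E + 0))
    ≡⟨ r₁ a b E ((a + b) ^ N) ⟩
  (a + b) * ((a + b) * E) + a * ((a + b) * (a + b) ^ N)
    ≡⟨ cong (λ x → (a + b) * x + a * ((a + b) * (a + b) ^ N)) (mean-size N a b) ⟩
  (a + b) * (N * a * (a + b) ^ N) + a * ((a + b) * (a + b) ^ N)
    ≡⟨ r₂ (a + b) N a ((a + b) ^ N) ⟩
  suc N * a * ((a + b) * (a + b) ^ N) ∎
  where
  open ≡-Reasoning
  E : ℕ
  E = ∑[ M ← subsets N ] subsetWeight a b M * ∣ M ∣
  r₁ : ∀ a b e p → (a + b) * (a * (p + e) + (b * e + 0)) ≡ (a + b) * ((a + b) * e) + a * ((a + b) * p)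
  r₁ = solve-∀
  r₂ : ∀ s n a p → s * (n * a * p) + a * (s * p) ≡ (1 + n) * a * (s * p)
  r₂ = solve-∀

-- Markov's inequality for the size of M.
small-half : ∀ N a b m → .{{_ : NonZero (a + b)}} → 2 * (N * a) ≤ m * (a + b) →
  (a + b) ^ N ≤ 2 * (∑[ M ← subsets N ] subsetWeight a b M * ind (∣ M ∣ ≤? m))
small-half N a b m mean = +-cancelʳ-≤ (2 * bad) _ _ (begin
  s ^ N + 2 * bad
    ≤⟨ +-monoʳ-≤ (s ^ N) bad≤ ⟩
  s ^ N + s ^ N
    ≡⟨ cong (s ^ N +_) (+-identityʳ (s ^ N)) ⟨
  2 * s ^ N
    ≡⟨ cong (2 *_) total ⟨
  2 * (good + bad)
    ≡⟨ *-distribˡ-+ 2 good bad ⟩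
  2 * good + 2 * bad ∎)
  where
  open ≤-Reasoning
  s good bad E : ℕ
  s    = a + b
  good = ∑[ M ← subsets N ] subsetWeight a b M * ind (∣ M ∣ ≤? m)
  bad  = ∑[ M ← subsets N ] subsetWeight a b M * ind (¬? (∣ M ∣ ≤? m))
  E    = ∑[ M ← subsets N ] subsetWeight a b M * ∣ M ∣
  total : good + bad ≡ s ^ N
  total = trans (sym (∑-+ (subsets N) _ _)) (trans (∑-cong (subsets N) λ M →
    trans (sym (*-distribˡ-+ (subsetWeight a b M) (ind (∣ M ∣ ≤? m)) _))
      (trans (cong (subsetWeight a b M *_) (ind+ind¬ (∣ M ∣ ≤? m))) (*-identityʳ _))) (∑-subsetWeight N a b))
  markov : suc m * bad ≤ E
  markov = ≤-trans (≤-reflexive (trans (sym (∑-*ˡ (subsets N) (suc m) _))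
      (∑-cong (subsets N) λ M → r (suc m) (subsetWeight a b M) (ind (¬? (∣ M ∣ ≤? m))))))
    (∑-mono (subsets N) λ M _ → *-monoʳ-≤ (subsetWeight a b M) (ind-elim (¬? (∣ M ∣ ≤? m)) ≰⇒>))
    where
    r : ∀ m w i → m * (w * i) ≡ w * (i * m)
    r = solve-∀
  -- The mean size is at most m / 2, and bad sets have at least m + 1 elements, so their probability
  -- is at most m / (2 (m + 1)).
  bad≤ : 2 * bad ≤ s ^ N
  bad≤ = *-cancelˡ-≤ (suc m) (*-cancelˡ-≤ s (begin
    s * (suc m * (2 * bad))
      ≡⟨ r₁ s (suc m) bad ⟩
    2 * (s * (suc m * bad))
      ≤⟨ *-monoʳ-≤ 2 (*-monoʳ-≤ s markov) ⟩
    2 * (s * E)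
      ≡⟨ cong (2 *_) (mean-size N a b) ⟩
    2 * (N * a * s ^ N)
      ≡⟨ *-assoc 2 (N * a) (s ^ N) ⟨
    2 * (N * a) * s ^ N
      ≤⟨ *-monoˡ-≤ (s ^ N) mean ⟩
    m * s * s ^ N
      ≡⟨ r₂ m s (s ^ N) ⟩
    s * (m * s ^ N)
      ≤⟨ *-monoʳ-≤ s (*-monoˡ-≤ (s ^ N) (n≤1+n m)) ⟩
    s * (suc m * s ^ N) ∎))
    where
    r₁ : ∀ s m b → s * (m * (2 * b)) ≡ 2 * (s * (m * b))
    r₁ = solve-∀
    r₂ : ∀ m s p → m * s * p ≡ s * (m * p)
    r₂ = solve-∀

∑-≟ : ∀ n m → (∑[ k ← allFin (suc m) ] ind (n ≟ toℕ k)) ≡ ind (n ≤? m)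
∑-≟ n m = go (n ≤? m)
  where
  go : (d : Dec (n ≤ m)) → (∑[ k ← allFin (suc m) ] ind (n ≟ toℕ k)) ≡ ind d
  go (yes n≤m) = ≤-antisym
    (≤-trans (∑-mono (allFin (suc m)) λ k _ → ind-mono (n ≟ toℕ k) (k Fin.≟ fromℕ< (s≤s n≤m))
      λ eq → Fin.toℕ-injective (trans (sym eq) (sym (Fin.toℕ-fromℕ< (s≤s n≤m))))) (∑-δ (suc m) (fromℕ< (s≤s n≤m))))
    (≤-trans (≤-reflexive (sym (ind-yes (n ≟ toℕ (fromℕ< (s≤s n≤m))) (sym (Fin.toℕ-fromℕ< (s≤s n≤m))))))
      (∑-∈ (λ k → ind (n ≟ toℕ k)) (∈-allFin (fromℕ< (s≤s n≤m)))))
  go (no n≰m) = trans (∑-cong (allFin (suc m)) λ k →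
    ind-no (n ≟ toℕ k) λ { refl → n≰m (s≤s⁻¹ (Fin.toℕ<n k)) }) (∑-0 (allFin (suc m)))

-- The weight of `M` depends on its size alone, so the sum can be sorted by size.
∑-levels : ∀ {N} a b m (f : Subset N → ℕ) →
  (∑[ M ← subsets N ] subsetWeight a b M * ind (∣ M ∣ ≤? m) * f M)
    ≡ (∑[ k ← allFin (suc m) ] a ^ toℕ k * b ^ (N ∸ toℕ k) * level f (toℕ k))
∑-levels {N} a b m f = begin
  (∑[ M ← subsets N ] subsetWeight a b M * ind (∣ M ∣ ≤? m) * f M)
    ≡⟨ ∑-cong (subsets N) (λ M → trans (cong (λ x → subsetWeight a b M * x * f M) (sym (∑-≟ ∣ M ∣ m)))
         (trans (cong (_* f M) (sym (∑-*ˡ (allFin (suc m)) (subsetWeight a b M) _)))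
           (sym (∑-*ʳ (allFin (suc m)) (f M) (λ k → subsetWeight a b M * ind (∣ M ∣ ≟ toℕ k)))))) ⟩
  (∑[ M ← subsets N ] ∑[ k ← allFin (suc m) ] subsetWeight a b M * ind (∣ M ∣ ≟ toℕ k) * f M)
    ≡⟨ ∑-swap (subsets N) (allFin (suc m)) _ ⟩
  (∑[ k ← allFin (suc m) ] ∑[ M ← subsets N ] subsetWeight a b M * ind (∣ M ∣ ≟ toℕ k) * f M)
    ≡⟨ ∑-cong (allFin (suc m)) (λ k → trans (∑-cong (subsets N) (same (toℕ k)))
         (∑-*ˡ (subsets N) (a ^ toℕ k * b ^ (N ∸ toℕ k)) _)) ⟩
  (∑[ k ← allFin (suc m) ] a ^ toℕ k * b ^ (N ∸ toℕ k) * level f (toℕ k)) ∎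
  where
  open ≡-Reasoning
  same : ∀ k M → subsetWeight a b M * ind (∣ M ∣ ≟ k) * f M ≡ a ^ k * b ^ (N ∸ k) * (ind (∣ M ∣ ≟ k) * f M)
  same k M = go (∣ M ∣ ≟ k)
    where
    go : (d : Dec (∣ M ∣ ≡ k)) → subsetWeight a b M * ind d * f M ≡ a ^ k * b ^ (N ∸ k) * (ind d * f M)
    go (yes refl) = trans (*-assoc (subsetWeight a b M) 1 (f M)) (cong (_* (1 * f M)) (subsetWeight-size a b M))
    go (no _)     = trans (*-assoc (subsetWeight a b M) 0 (f M))
      (trans (*-zeroʳ (subsetWeight a b M)) (sym (*-zeroʳ (a ^ k * b ^ (N ∸ k)))))

-- Only the sizes k ≤ m are kept: they carry half of the weight, and the average
-- of f at level k is at least the one at level m.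
level-transfer : ∀ {N} a b m (f : Subset N → ℕ) → .{{_ : NonZero (a + b)}} → Antitone f → m ≤ N → 2 * (N * a) ≤ m * (a + b) →
  (a + b) ^ N * level f m ≤ 2 * binomial N m * (∑[ M ← subsets N ] subsetWeight a b M * f M)
level-transfer {N} a b m f anti m≤N mean = begin
  (a + b) ^ N * level f m
    ≤⟨ *-monoˡ-≤ (level f m) (small-half N a b m mean) ⟩
  2 * (∑[ M ← subsets N ] subsetWeight a b M * ind (∣ M ∣ ≤? m)) * level f m
    ≡⟨ cong (λ x → 2 * x * level f m) (trans (∑-cong (subsets N) λ M → sym (*-identityʳ _)) (∑-levels {N} a b m (λ _ → 1))) ⟩
  2 * (∑[ k ← allFin (suc m) ] g (toℕ k) * binomial N (toℕ k)) * level f m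
    ≡⟨ trans (*-assoc 2 (∑[ k ← allFin (suc m) ] g (toℕ k) * binomial N (toℕ k)) (level f m))
         (cong (2 *_) (sym (∑-*ʳ (allFin (suc m)) (level f m) (λ k → g (toℕ k) * binomial N (toℕ k))))) ⟩
  2 * (∑[ k ← allFin (suc m) ] g (toℕ k) * binomial N (toℕ k) * level f m)
    ≤⟨ *-monoʳ-≤ 2 (∑-mono (allFin (suc m)) λ k _ → term (toℕ k) (s≤s⁻¹ (Fin.toℕ<n k))) ⟩
  2 * (∑[ k ← allFin (suc m) ] binomial N m * (g (toℕ k) * level f (toℕ k)))
    ≡⟨ trans (cong (2 *_) (∑-*ˡ (allFin (suc m)) (binomial N m) _)) (sym (*-assoc 2 (binomial N m) _)) ⟩
  2 * binomial N m * (∑[ k ← allFin (suc m) ] g (toℕ k) * level f (toℕ k))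
    ≡⟨ cong (2 * binomial N m *_) (∑-levels a b m f) ⟨
  2 * binomial N m * (∑[ M ← subsets N ] subsetWeight a b M * ind (∣ M ∣ ≤? m) * f M)
    ≤⟨ *-monoʳ-≤ (2 * binomial N m) (∑-mono (subsets N) λ M _ → *-monoˡ-≤ (f M)
         (≤-trans (*-monoʳ-≤ (subsetWeight a b M) (ind≤1 (∣ M ∣ ≤? m))) (≤-reflexive (*-identityʳ (subsetWeight a b M))))) ⟩
  2 * binomial N m * (∑[ M ← subsets N ] subsetWeight a b M * f M) ∎
  where
  open ≤-Reasoning
  g : ℕ → ℕ
  g k = a ^ k * b ^ (N ∸ k)
  r : ∀ g c l → g * c * l ≡ g * (l * c)
  r = solve-∀
  r′ : ∀ g l c → g * (l * c) ≡ c * (g * l)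
  r′ = solve-∀
  term : ∀ k → k ≤ m → g k * binomial N k * level f m ≤ binomial N m * (g k * level f k)
  term k k≤m = begin
    g k * binomial N k * level f m
      ≡⟨ r (g k) (binomial N k) (level f m) ⟩
    g k * (level f m * binomial N k)
      ≤⟨ *-monoʳ-≤ (g k) (subst (λ n → level f n * binomial N k ≤ level f k * binomial N n) (m+[n∸m]≡n k≤m)
           (level-ratio f anti k (m ∸ k) (≤-trans (≤-reflexive (m+[n∸m]≡n k≤m)) m≤N))) ⟩
    g k * (level f k * binomial N m)
      ≡⟨ r′ (g k) (level f k) (binomial N m) ⟩
    binomial N m * (g k * level f k) ∎

-- Counting the failures

visible-mono : ∀ {q N} {M M′ : Subset N} (c : Coloring q N) → M ⊆ M′ → visible M c ⊑ visible M′ c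
visible-mono {M = outside ∷ M} {_ ∷ M′}       (_ ∷ c) p zero    = nothing≼
visible-mono {M = inside ∷ M}  {inside ∷ M′}  (_ ∷ c) p zero    = just≼
visible-mono {M = inside ∷ M}  {outside ∷ M′} (_ ∷ c) p zero    with () ← p here
visible-mono {M = _ ∷ M}       {_ ∷ M′}       (_ ∷ c) p (suc x) = visible-mono c (drop-∷-⊆ p) x

colorings-length : ∀ q N → length (colorings q N) ≡ q ^ N
colorings-length q N = trans (length-∑ (colorings q N)) (trans (ones (allVecs (allFin q) N))
  (trans (∑-weight-1 (λ _ → 1) (allFin q) N) (cong (_^ N) (trans (∑-allFin-const q 1) (*-identityʳ q)))))
  where
  weight-1 : ∀ {A : Set} {n} (v : Vec A n) → weight (λ _ → 1) v ≡ 1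
  weight-1 []      = refl
  weight-1 (x ∷ v) = trans (+-identityʳ _) (weight-1 v)
  ones : ∀ {A : Set} {n} (xs : List (Vec A n)) → (∑[ _ ← xs ] 1) ≡ ∑ xs (weight (λ _ → 1))
  ones xs = ∑-cong xs (λ v → sym (weight-1 v))

∑-outcomes : ∀ N q m (f : Subset N → Coloring q N → ℕ) →
  (∑[ ω ← outcomes N q m ] f (proj₁ ω) (proj₂ ω)) ≡ level (λ M → ∑ (colorings q N) (f M)) m
∑-outcomes N q m f = trans (∑-cartesianProductWith _,_ (subsetsOfSize N m) (colorings q N) _)
  (∑-filter (λ M → ∣ M ∣ ≟ m) (subsets N) _)

length-outcomes : ∀ N q m → length (outcomes N q m) ≡ binomial N m * q ^ N
length-outcomes N q m = begin
  length (outcomes N q m)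
    ≡⟨ length-∑ (outcomes N q m) ⟩
  (∑[ _ ← outcomes N q m ] 1)
    ≡⟨ ∑-outcomes N q m (λ _ _ → 1) ⟩
  level {N} (λ _ → ∑[ _ ← colorings q N ] 1) m
    ≡⟨ ∑-cong (subsets N) (λ M → cong (ind (∣ M ∣ ≟ m) *_) (trans (sym (length-∑ (colorings q N))) (colorings-length q N))) ⟩
  (∑[ M ← subsets N ] ind (∣ M ∣ ≟ m) * q ^ N)
    ≡⟨ ∑-*ʳ (subsets N) (q ^ N) (λ M → ind (∣ M ∣ ≟ m)) ⟩
  (∑[ M ← subsets N ] ind (∣ M ∣ ≟ m)) * q ^ N
    ≡⟨ cong (_* q ^ N) (∑-cong (subsets N) λ M → *-identityʳ (ind (∣ M ∣ ≟ m))) ⟨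
  binomial N m * q ^ N ∎
  where open ≡-Reasoning

failures : ∀ {N} → Hypergraph N → ℕ → ℕ → ℕ
failures {N} H q m = ∑[ ω ← outcomes N q m ] ind (¬? (containsRainbowEdge? H ω))

-- 136 = (16 + 1) · 8: there are ℓ rounds with c = 16 and one with c = ℓ, and u = 8 N.
few-failures-nonZero : ∀ s ℓ → 2 ^ (2 ^ suc s) * 2 ^ suc s ≤ ℓ →
  ∀ N q m k r (H : Hypergraph N) .{{_ : NonZero N}} .{{_ : NonZero q}} .{{_ : NonZero k}} → Bounded r H →
  (∀ S → degree H S * k ^ ∣ S ∣ ≤ length (edges H)) →
  r ≤ q → r ≤ 2 ^ (suc s + ℓ) → m ≤ N → 136 * ℓ * N ≤ m * k →
  2 ^ suc s * failures H q m ≤ 4 * length (outcomes N q m)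
few-failures-nonZero s ℓ large N q m k r H bounded spread r≤q r≤ m≤N enough =
  *-cancelʳ-≤ _ _ (t ^ N) {{m^n≢0 t N {{t≢0}}}} (begin
    2 ^ suc s * failures H q m * t ^ N
      ≤⟨ *-monoˡ-≤ (t ^ N) (*-monoʳ-≤ (2 ^ suc s) fail≤) ⟩
    2 ^ suc s * level f m * t ^ N
      ≡⟨ r₁ (2 ^ suc s) (level f m) (t ^ N) ⟩
    2 ^ suc s * (t ^ N * level f m)
      ≤⟨ *-monoʳ-≤ (2 ^ suc s) transferred ⟩
    2 ^ suc s * (2 * binomial N m * miss)
      ≡⟨ r₂ (2 ^ suc s) (binomial N m) miss ⟩
    2 * binomial N m * (2 ^ suc s * miss)
      ≤⟨ *-monoʳ-≤ (2 * binomial N m) (missWeight-bound q N (k * q) 4 μ₀ τ (8 * N)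
           {{m*n≢0 k q}} {{m*n≢0 q t {{it}} {{t≢0}}}} dense s ℓ large ℓ r≤ a (q * b) τ≡ rounds family mass-family {{μ₀≢0}}) ⟩
    2 * binomial N m * (2 * τ ^ N)
      ≡⟨ cong (λ x → 2 * binomial N m * (2 * x)) (^-distrib-* N q t) ⟩
    2 * binomial N m * (2 * (q ^ N * t ^ N))
      ≡⟨ r₃ (binomial N m) (q ^ N) (t ^ N) ⟩
    4 * (binomial N m * q ^ N) * t ^ N
      ≡⟨ cong (λ x → 4 * x * t ^ N) (length-outcomes N q m) ⟨
    4 * length (outcomes N q m) * t ^ N ∎)
  where
  open ≤-Reasoning
  open ColoredEdges H q r k r≤q bounded spread
  a b t τ miss : ℕ
  -- The inclusion probability a / t is m / (2 N), for a mean size of m / 2. The common factor `k`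
  -- makes the condition `dense` an equality with the integer 8 N as the unit of weight.
  a = m * k
  b = (2 * N ∸ m) * k
  t = 2 * N * k
  τ = q * t
  miss = Round.missWeight family a (q * b)
  f : Subset N → ℕ
  f M = ∑[ c ← colorings q N ] Round.miss family (visible M c)
  t≢0 : NonZero t
  t≢0 = m*n≢0 (2 * N) k {{m*n≢0 2 N}}
  a+b : a + b ≡ t
  a+b = trans (sym (*-distribʳ-+ k m (2 * N ∸ m))) (cong (_* k) (m+[n∸m]≡n (≤-trans m≤N (m≤m+n N (N + 0)))))
  μ₀≢0 : NonZero μ₀
  μ₀≢0 = m*n≢0 (length (edges H)) (falling q r) {{length≢0 (edges H) (nonempty H)}} {{falling-pos r≤q}}
    where
    length≢0 : ∀ {A : Set} (xs : List A) → xs ≢ [] → NonZero (length xs)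
    length≢0 []       p = contradiction refl p
    length≢0 (_ ∷ xs) p = _
  dense : 4 * τ ≤ 8 * N * (k * q)
  dense = ≤-reflexive (r₀ q N k)
    where
    r₀ : ∀ q N k → 4 * (q * (2 * N * k)) ≡ 8 * N * (k * q)
    r₀ = solve-∀
  τ≡ : q * b + q * a ≡ τ
  τ≡ = trans (sym (*-distribˡ-+ q b a)) (cong (q *_) (trans (+-comm b a) a+b))
  rounds : (ℓ * 16 + ℓ) * (8 * N) ≤ a
  rounds = ≤-trans (≤-reflexive (r₀ ℓ N)) enough
    where
    r₀ : ∀ ℓ N → (ℓ * 16 + ℓ) * (8 * N) ≡ 136 * ℓ * N
    r₀ = solve-∀
  fail≤ : failures H q m ≤ level f m
  fail≤ = ≤-trans (∑-mono (outcomes N q m) λ (M , c) _ →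
      ind-mono (¬? (containsRainbowEdge? H (M , c))) (¬? (Round.hit? family (visible M c))) (_∘ hit⇒rainbow M c))
    (≤-reflexive (∑-outcomes N q m (λ M c → Round.miss family (visible M c))))
  antitone : Antitone f
  antitone {M} {M′} p = ∑-mono (colorings q N) λ c _ →
    ind-mono (¬? (Round.hit? family (visible M′ c))) (¬? (Round.hit? family (visible M c)))
      (_∘ Any.map λ {e} h → ⊑-trans {g = proj₂ e} {visible M c} {visible M′ c} h (visible-mono c p))
  transferred : t ^ N * level f m ≤ 2 * binomial N m * miss
  transferred = begin
    t ^ N * level f m
      ≡⟨ cong (λ x → x ^ N * level f m) a+b ⟨
    (a + b) ^ N * level f m
      ≤⟨ level-transfer a b m f {{subst NonZero (sym a+b) t≢0}} antitone m≤N mean ⟩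
    2 * binomial N m * (∑[ M ← subsets N ] subsetWeight a b M * f M)
      ≡⟨ cong (2 * binomial N m *_) (∑-visible q N a b (Round.miss family)) ⟩
    2 * binomial N m * miss ∎
    where
    mean : 2 * (N * a) ≤ m * (a + b)
    mean = ≤-reflexive (trans (r₀ N m k) (cong (m *_) (sym a+b)))
      where
      r₀ : ∀ N m k → 2 * (N * (m * k)) ≡ m * (2 * N * k)
      r₀ = solve-∀
  r₁ : ∀ x y z → x * y * z ≡ x * (z * y)
  r₁ = solve-∀
  r₂ : ∀ x y z → x * (2 * y * z) ≡ 2 * y * (x * z)
  r₂ = solve-∀
  r₃ : ∀ x y z → 2 * x * (2 * (y * z)) ≡ 4 * (x * y) * z
  r₃ = solve-∀

-- Without vertices every edge is empty, hence contained and rainbow. The case is separate because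
-- the total weight 2 N k of a vertex would vanish.
failures-empty : ∀ (H : Hypergraph 0) q m → failures H q m ≡ 0
failures-empty H q m = trans
  (∑-cong (outcomes 0 q m) λ ω → ind-no (¬? (containsRainbowEdge? H ω)) λ ¬c → ¬c (contains ω))
  (∑-0 (outcomes 0 q m))
  where
  contains : ∀ ω → ContainsRainbowEdge H ω
  contains ω = go (edges H) (nonempty H)
    where
    go : ∀ es → es ≢ [] → Any (λ e → e ⊆ proj₁ ω × Rainbow (proj₂ ω) e) es
    go []       p = contradiction refl p
    go (e ∷ es) p = here ((λ { {()} }) , λ ())

few-failures : ∀ s ℓ → 2 ^ (2 ^ suc s) * 2 ^ suc s ≤ ℓ →
  ∀ N q m k r (H : Hypergraph N) .{{_ : NonZero q}} .{{_ : NonZero k}} → Bounded r H →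
  (∀ S → degree H S * k ^ ∣ S ∣ ≤ length (edges H)) →
  r ≤ q → r ≤ 2 ^ (suc s + ℓ) → m ≤ N → 136 * ℓ * N ≤ m * k →
  2 ^ suc s * failures H q m ≤ 4 * length (outcomes N q m)
few-failures s ℓ large N q m k r H bounded spread r≤q r≤ m≤N enough = go (N ≟ 0)
  where
  go : Dec (N ≡ 0) → 2 ^ suc s * failures H q m ≤ 4 * length (outcomes N q m)
  go (yes refl) = ≤-trans (≤-reflexive (trans (cong (2 ^ suc s *_) (failures-empty H q m)) (*-zeroʳ (2 ^ suc s)))) z≤n
  go (no N≢0)   = few-failures-nonZero s ℓ large N q m k r H {{≢-nonZero N≢0}} bounded spread r≤q r≤ m≤N enough

-- Reals

frac-* : ∀ a b c d .{{_ : NonZero b}} .{{_ : NonZero d}} →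
  (ℤ.+ a ℚ./ b) ℚ.* (ℤ.+ c ℚ./ d) ≡ ℚ._/_ (ℤ.+ (a * c)) (b * d) {{m*n≢0 b d}}
frac-* a b@(suc _) c d@(suc _) = ℚ.toℚᵘ-injective (begin
  toℚᵘ ((ℤ.+ a ℚ./ b) ℚ.* (ℤ.+ c ℚ./ d))              ≈⟨ ℚ.toℚᵘ-homo-* (ℤ.+ a ℚ./ b) (ℤ.+ c ℚ./ d) ⟩
  toℚᵘ (ℤ.+ a ℚ./ b) ℚᵘ.* toℚᵘ (ℤ.+ c ℚ./ d)
    ≈⟨ ℚᵘ.*-cong (ℚ.toℚᵘ-fromℚᵘ (ℚᵘ.mkℚᵘ (ℤ.+ a) _)) (ℚ.toℚᵘ-fromℚᵘ (ℚᵘ.mkℚᵘ (ℤ.+ c) _)) ⟩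
  ℚᵘ.mkℚᵘ (ℤ.+ a) (pred b) ℚᵘ.* ℚᵘ.mkℚᵘ (ℤ.+ c) (pred d) ≈⟨ ℚᵘ.*≡* (cong (ℤ._* (ℤ.+ (b * d))) (sym (ℤ.pos-* a c))) ⟩
  ℚᵘ.mkℚᵘ (ℤ.+ (a * c)) (pred (b * d))             ≈⟨ ℚᵘ.≃-sym (ℚ.toℚᵘ-fromℚᵘ (ℚᵘ.mkℚᵘ (ℤ.+ (a * c)) (pred (b * d)))) ⟩
  toℚᵘ (ℤ.+ (a * c) ℚ./ (b * d))                  ∎)
  where open ℚᵘ.≃-Reasoning

embed : ℕ → ℚ
embed n = ℤ.+ n ℚ./ 1

embed-+ : ∀ m n → embed (m + n) ≡ embed m ℚ.+ embed n
embed-+ m n = frac-+ m n 1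

embed-* : ∀ m n → embed (m * n) ≡ embed m ℚ.* embed n
embed-* m n = sym (frac-* m 1 n 1)

embed-mono : ∀ {m n} → m ≤ n → embed m ℚ.≤ embed n
embed-mono {m} {n} m≤n = frac-≤ m 1 n 1 (*-monoˡ-≤ 1 m≤n)

embed-nonNeg : ∀ n → ℚ.NonNegative (embed n)
embed-nonNeg n = ℚ.nonNegative (embed-mono {0} {n} z≤n)

½<1 : ½ ℚ.< 1ℚ
½<1 = ℚ.*<* (ℤ.+<+ (s≤s (s≤s z≤n)))

-- An inequality of reals comes with an error ε. At ε = ½ it is still exact between naturals, since
-- n < m means n + 1 ≤ m.
embed-cancel : ∀ m n → embed m ℚ.≤ embed n ℚ.+ ½ → m ≤ n
embed-cancel m n h = ≮⇒≥ λ n<m → ℚ.<-irrefl refl (ℚ.<-≤-trans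
  (ℚ.+-monoʳ-< (embed n) ½<1)
  (ℚ.≤-trans (ℚ.≤-reflexive (trans (sym (embed-+ n 1)) (cong embed (+-comm n 1)))) (ℚ.≤-trans (embed-mono n<m) h)))

p+r-r : ∀ p r → (p ℚ.+ r) ℚ.- r ≡ p
p+r-r p r = trans (ℚ.+-assoc p r (ℚ.- r)) (trans (cong (p ℚ.+_) (ℚ.+-inverseʳ r)) (ℚ.+-identityʳ p))

≤+⇒-≤ : ∀ {p q} r → p ℚ.≤ q ℚ.+ r → p ℚ.- r ℚ.≤ q
≤+⇒-≤ {p} {q} r h = subst (p ℚ.- r ℚ.≤_) (p+r-r q r) (ℚ.+-monoˡ-≤ (ℚ.- r) h)

+-cancelʳ-≤ℚ : ∀ {p q} r → p ℚ.+ r ℚ.≤ q ℚ.+ r → p ℚ.≤ q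
+-cancelʳ-≤ℚ {p} {q} r h = subst (ℚ._≤ q) (p+r-r p r) (≤+⇒-≤ r h)

*-mono-≤ℚ : ∀ {p q r s} → 0ℚ ℚ.≤ r → 0ℚ ℚ.≤ q → p ℚ.≤ q → r ℚ.≤ s → p ℚ.* r ℚ.≤ q ℚ.* s
*-mono-≤ℚ {p} {q} {r} {s} 0≤r 0≤q p≤q r≤s = ℚ.≤-trans
  (ℚ.*-monoʳ-≤-nonNeg r {{ℚ.nonNegative 0≤r}} p≤q)
  (ℚ.*-monoˡ-≤-nonNeg q {{ℚ.nonNegative 0≤q}} r≤s)

floor-bounds : ∀ x → 0ℚ ℚ.≤ x → ∃[ j ] (embed j ℚ.≤ x × x ℚ.≤ embed (suc j))
floor-bounds x@(mkℚ ℤ.-[1+ _ ] _ _) 0≤x = contradiction (ℚ.nonNegative 0≤x) λ ()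
floor-bounds x@(mkℚ (ℤ.+ n) d-1 _) 0≤x = n / suc d-1
  , subst (embed (n / suc d-1) ℚ.≤_) (ℚ.↥p/↧p≡p x)
      (frac-≤ (n / suc d-1) 1 n (suc d-1) (≤-trans (m/n*n≤m n (suc d-1)) (≤-reflexive (sym (*-identityʳ n)))))
  , subst (ℚ._≤ embed (suc (n / suc d-1))) (ℚ.↥p/↧p≡p x)
      (frac-≤ n (suc d-1) (suc (n / suc d-1)) 1 (≤-trans (≤-reflexive (trans (*-identityʳ n) (m≡m%n+[m/n]*n n (suc d-1))))
        (+-monoˡ-≤ (n / suc d-1 * suc d-1) (<⇒≤ (m%n<n n (suc d-1))))))

-- The real κ is replaced by a natural number within a factor 2: the lower bound preserves the
-- spread, the upper one the size of m.
natural-scale : ∀ κ → ∃[ K ] (∀ n → K ≤ n → embed 5 ℚ.≤ seq κ n) →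
  ∃[ k ] (1 ≤ k × ∃[ K ] (∀ n → K ≤ n → embed k ℚ.≤ seq κ n × seq κ n ℚ.≤ embed (2 * k)))
natural-scale κ (K₁ , big) = result (floor-bounds x (ℚ.≤-trans (embed-mono {0} {5} z≤n) 5≤x))
  where
  K₂ n₀ : ℕ
  K₂ = proj₁ (cauchy κ 1ℚ 0<1)
  n₀ = K₁ ⊔ K₂
  x : ℚ
  x = seq κ n₀
  5≤x : embed 5 ℚ.≤ x
  5≤x = big n₀ (m≤m⊔n K₁ K₂)
  abs : ∀ n → K₁ ≤ n → ℚ.∣ seq κ n ∣ ≡ seq κ n
  abs n h = ℚ.0≤p⇒∣p∣≡p (ℚ.≤-trans (embed-mono {0} {5} z≤n) (big n h))
  near : ∀ i j → K₁ ≤ i → K₂ ≤ i → K₁ ≤ j → K₂ ≤ j → seq κ i ℚ.≤ seq κ j ℚ.+ 1ℚ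
  near i j a b c d = subst₂ (λ p q → p ℚ.≤ q ℚ.+ 1ℚ) (abs i a) (abs j c)
    (ℚ.≤-trans (∣p∣≤∣q∣+∣p-q∣ (seq κ i) (seq κ j))
      (ℚ.+-monoʳ-≤ ℚ.∣ seq κ j ∣ (ℚ.<⇒≤ (proj₂ (cauchy κ 1ℚ 0<1) i j b d))))
  result : ∃[ j ] (embed j ℚ.≤ x × x ℚ.≤ embed (suc j)) →
    ∃[ k ] (1 ≤ k × ∃[ K ] (∀ n → K ≤ n → embed k ℚ.≤ seq κ n × seq κ n ℚ.≤ embed (2 * k)))
  result (j , j≤x , x≤j+1) = choose j j≤x x≤j+1 (embed-cancel 5 (suc j) (ℚ.≤-trans (ℚ.≤-trans 5≤x x≤j+1)
    (ℚ.≤-trans (ℚ.≤-reflexive (sym (ℚ.+-identityʳ _))) (ℚ.+-monoʳ-≤ (embed (suc j)) (ℚ.<⇒≤ (ℚ.positive⁻¹ ½))))))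
    where
    choose : ∀ j → embed j ℚ.≤ x → x ℚ.≤ embed (suc j) → 5 ≤ suc j →
      ∃[ k ] (1 ≤ k × ∃[ K ] (∀ n → K ≤ n → embed k ℚ.≤ seq κ n × seq κ n ℚ.≤ embed (2 * k)))
    -- Here j = k + 1, and 5 ≤ j + 1 gives k ≥ 3. From `n₀` on, the terms of κ differ from `x` by at
    -- most 1, so they lie between j - 1 = k and j + 2 = k + 3 ≤ 2 k.
    choose (suc k) j≤x x≤j+1 (s≤s (s≤s 3≤k)) =
     k , ≤-trans (s≤s z≤n) 3≤k , n₀ , λ n h →
      let K₁≤n = ≤-trans (m≤m⊔n K₁ K₂) h
          K₂≤n = ≤-trans (m≤n⊔m K₁ K₂) h
      in +-cancelʳ-≤ℚ 1ℚ (ℚ.≤-trans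
           (ℚ.≤-trans (ℚ.≤-reflexive (trans (sym (embed-+ k 1)) (cong embed (+-comm k 1)))) j≤x)
           (near n₀ n (m≤m⊔n K₁ K₂) (m≤n⊔m K₁ K₂) K₁≤n K₂≤n))
       , ℚ.≤-trans (near n n₀ K₁≤n K₂≤n (m≤m⊔n K₁ K₂) (m≤n⊔m K₁ K₂))
           (ℚ.≤-trans (ℚ.+-monoˡ-≤ 1ℚ x≤j+1) (ℚ.≤-trans (ℚ.≤-reflexive (sym (embed-+ (suc (suc k)) 1)))
             (embed-mono (≤-trans (≤-reflexive (+-comm (2 + k) 1))
               (≤-trans (+-monoˡ-≤ k 3≤k) (≤-reflexive (cong (k +_) (sym (+-identityʳ k)))))))))

module _ (κ : ℝ) (k K : ℕ) (approx : ∀ n → K ≤ n → embed k ℚ.≤ seq κ n × seq κ n ℚ.≤ embed (2 * k)) where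

  0≤κ : ∀ n → K ≤ n → 0ℚ ℚ.≤ seq κ n
  0≤κ n h = ℚ.≤-trans (embed-mono {0} {k} z≤n) (proj₁ (approx n h))

  embed-^ : ∀ s n → K ≤ n → embed (k ^ s) ℚ.≤ seq (κ ^ℝ s) n
  embed-^ zero    n h = ℚ.≤-refl
  embed-^ (suc s) n h = ℚ.≤-trans (ℚ.≤-reflexive (embed-* k (k ^ s)))
    (*-mono-≤ℚ (embed-mono {0} {k ^ s} z≤n) (0≤κ n h) (proj₁ (approx n h)) (embed-^ s n h))

  spread-natural : ∀ {N} (H : Hypergraph N) → Spread κ H → ∀ S → degree H S * k ^ ∣ S ∣ ≤ length (edges H)
  spread-natural H sp S = let (K′ , h) = sp S ½ (ℚ.positive⁻¹ ½) in embed-cancel _ _ (ℚ.≤-trans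
    (ℚ.≤-trans (ℚ.≤-reflexive (embed-* (degree H S) (k ^ ∣ S ∣)))
      (ℚ.*-monoˡ-≤-nonNeg (embed (degree H S)) {{embed-nonNeg (degree H S)}} (embed-^ ∣ S ∣ (K ⊔ K′) (m≤m⊔n K K′))))
    (h (K ⊔ K′) (m≤n⊔m K K′)))

  -- From 2 ^ ⌊log₂ r⌋ ≤ r, every term of the sequence for log₂ r is at least ⌊log₂ r⌋, without an
  -- error.
  ⌊log₂⌋≤log₂ : ∀ r .{{_ : NonZero r}} n → embed ⌊log₂ r ⌋ ℚ.≤ seq (log₂ r) n
  ⌊log₂⌋≤log₂ r n = frac-≤ ⌊log₂ r ⌋ 1 ⌊log₂ r ^ suc n ⌋ (suc n) (≤-trans
    (≤-trans (≤-reflexive (sym (⌊log₂[2^n]⌋≡n (⌊log₂ r ⌋ * suc n))))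
      (⌊log₂⌋-mono-≤ (≤-trans (≤-reflexive (sym (^-*-assoc 2 ⌊log₂ r ⌋ (suc n))))
        (^-monoˡ-≤ (suc n) (⌊log₂n⌋≡l⇒2^l≤n ⌊log₂ r ⌋ r refl)))))
    (≤-reflexive (sym (*-identityʳ _))))

  size-natural : ∀ c r .{{_ : NonZero r}} N m → (fromℕ c *ℝ log₂ r) *ℝ fromℕ N ≤ℝ fromℕ m *ℝ κ →
    c * ⌊log₂ r ⌋ * N ≤ m * (2 * k)
  size-natural c r N m h = embed-cancel _ _ (begin
    embed (c * ⌊log₂ r ⌋ * N)
      ≡⟨ trans (embed-* (c * ⌊log₂ r ⌋) N) (cong (ℚ._* embed N) (embed-* c ⌊log₂ r ⌋)) ⟩
    embed c ℚ.* embed ⌊log₂ r ⌋ ℚ.* embed N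
      ≤⟨ ℚ.*-monoʳ-≤-nonNeg (embed N) {{embed-nonNeg N}}
           (ℚ.*-monoˡ-≤-nonNeg (embed c) {{embed-nonNeg c}} (⌊log₂⌋≤log₂ r n)) ⟩
    embed c ℚ.* seq (log₂ r) n ℚ.* embed N
      ≤⟨ proj₂ (h ½ (ℚ.positive⁻¹ ½)) n (m≤n⊔m K K′) ⟩
    embed m ℚ.* seq κ n ℚ.+ ½
      ≤⟨ ℚ.+-monoˡ-≤ ½ (ℚ.*-monoˡ-≤-nonNeg (embed m) {{embed-nonNeg m}} (proj₂ (approx n (m≤m⊔n K K′)))) ⟩
    embed m ℚ.* embed (2 * k) ℚ.+ ½
      ≡⟨ cong (ℚ._+ ½) (embed-* m (2 * k)) ⟨
    embed (m * (2 * k)) ℚ.+ ½ ∎)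
    where
    open ℚ.≤-Reasoning
    K′ n : ℕ
    K′ = proj₁ (h ½ (ℚ.positive⁻¹ ½))
    n = K ⊔ K′

-- Probabilities and the limit

ℙ-bound : ∀ {a p} {A : Set a} {P : Pred A p} (Ω : List A) (P? : Decidable P) ε E →
  0 < length Ω → suc E * (∑[ ω ← Ω ] ind (¬? (P? ω))) ≤ length Ω → ℤ.+ 1 ℚ./ suc E ℚ.≤ ε → 1ℚ ℚ.- ε ℚ.≤ ℙ Ω P?
ℙ-bound Ω@(x ∷ xs) P? ε E _ few E≤ε = ≤+⇒-≤ ε (begin
  1ℚ
    ≤⟨ frac-≤ 1 1 T T (≤-reflexive (*-comm 1 T)) ⟩
  ℤ.+ T ℚ./ T
    ≡⟨ cong (λ t → ℤ.+ t ℚ./ T) T≡ ⟩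
  ℤ.+ (succ + fail) ℚ./ T
    ≡⟨ frac-+ succ fail T ⟩
  ℤ.+ succ ℚ./ T ℚ.+ ℤ.+ fail ℚ./ T
    ≤⟨ ℚ.+-monoʳ-≤ (ℤ.+ succ ℚ./ T) (ℚ.≤-trans (frac-≤ fail T 1 (suc E)
         (≤-trans (≤-reflexive (*-comm fail (suc E))) (≤-trans few (≤-reflexive (sym (*-identityˡ T)))))) E≤ε) ⟩
  ℙ Ω P? ℚ.+ ε ∎)
  where
  open ℚ.≤-Reasoning
  T succ fail : ℕ
  T = length Ω
  succ = length (filter P? Ω)
  fail = ∑[ ω ← Ω ] ind (¬? (P? ω))
  T≡ : T ≡ succ + fail
  T≡ = trans (length-∑ Ω) (trans (∑-cong Ω λ ω → sym (ind+ind¬ (P? ω)))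
    (trans (∑-+ Ω (λ ω → ind (P? ω)) (λ ω → ind (¬? (P? ω)))) (cong (_+ fail) (sym (length-filter-∑ P? Ω)))))

eventually-large : ∀ (L : ℝ) → 0ℝ <ℝ L →
  ∃[ R ] (∀ r → R ≤ r → ∀ κ → L *ℝ fromℕ r ≤ℝ κ → ∃[ K ] (∀ n → K ≤ n → embed 5 ℚ.≤ seq κ n))
eventually-large L (ε , 0<ε , K₀ , lower) with archimedes ε 0<ε
-- Eventually L exceeds 1 / (d + 1), so this bound on r gives L r ≥ 6. The error 1 allowed in L r ≤
-- κ leaves the 5 that `natural-scale` asks for.
... | d , small = 6 * suc d , λ r R≤r κ h →
  let (K₁ , h₁) = h 1ℚ 0<1
      δ = ℤ.+ 1 ℚ./ suc d
  in K₀ ⊔ K₁ , λ n K≤n → +-cancelʳ-≤ℚ 1ℚ (begin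
    embed 5 ℚ.+ 1ℚ
      ≡⟨ embed-+ 5 1 ⟨
    embed 6
      ≤⟨ frac-≤ 6 1 (1 * r) (suc d * 1) (≤-trans (≤-reflexive (cong (6 *_) (*-identityʳ (suc d))))
           (≤-trans R≤r (≤-reflexive (sym (trans (*-identityʳ (1 * r)) (*-identityˡ r)))))) ⟩
    ℤ.+ (1 * r) ℚ./ (suc d * 1)
      ≡⟨ frac-* 1 (suc d) r 1 ⟨
    δ ℚ.* embed r
      ≤⟨ ℚ.*-monoʳ-≤-nonNeg (embed r) {{embed-nonNeg r}} (ℚ.≤-trans (ℚ.<⇒≤ (small d ≤-refl))
           (ℚ.≤-trans (ℚ.≤-reflexive (sym (ℚ.+-identityˡ ε))) (lower n (≤-trans (m≤m⊔n K₀ K₁) K≤n)))) ⟩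
    seq L n ℚ.* embed r
      ≤⟨ h₁ n (≤-trans (m≤n⊔m K₀ K₁) K≤n) ⟩
    seq κ n ℚ.+ 1ℚ ∎)
  where open ℚ.≤-Reasoning

ℙ-natural : ∀ s ℓ E ε → 2 ^ (2 ^ suc s) * 2 ^ suc s ≤ ℓ → 4 * suc E ≤ 2 ^ suc s → ℤ.+ 1 ℚ./ suc E ℚ.≤ ε →
  ∀ N q m k r (H : Hypergraph N) .{{_ : NonZero q}} .{{_ : NonZero k}} → Bounded r H →
  (∀ S → degree H S * k ^ ∣ S ∣ ≤ length (edges H)) →
  r ≤ q → r < 2 ^ suc ℓ → m ≤ N → 272 * ℓ * N ≤ m * (2 * k) →
  1ℚ ℚ.- ε ℚ.≤ ℙ (outcomes N q m) (containsRainbowEdge? H)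
ℙ-natural s ℓ E ε large 4E≤ E≤ε N q m k r H bounded spread r≤q r< m≤N enough =
  ℙ-bound (outcomes N q m) (containsRainbowEdge? H) ε E
    (≤-trans (*-mono-≤ (binomial-pos m≤N) (m^n>0 q N)) (≤-reflexive (sym (length-outcomes N q m))))
    (*-cancelˡ-≤ 4 (≤-trans (≤-reflexive (sym (*-assoc 4 (suc E) (failures H q m))))
      (≤-trans (*-monoˡ-≤ (failures H q m) 4E≤) count)))
    E≤ε
  where
  -- The factor 2 in 272 = 2 · 136 pays for κ ≤ 2 k. In 136 = 17 · 8, the 8 consists of the spread
  -- constant 4 and of the 2 lost by taking a binomial subset of mean size m / 2.
  enough′ : 136 * ℓ * N ≤ m * k
  enough′ = *-cancelˡ-≤ 2 (begin
    2 * (136 * ℓ * N) ≡⟨ *-assoc 2 (136 * ℓ) N ⟨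
    2 * (136 * ℓ) * N ≡⟨ cong (_* N) (*-assoc 2 136 ℓ) ⟨
    272 * ℓ * N       ≤⟨ enough ⟩
    m * (2 * k)       ≡⟨ r₁ m k ⟩
    2 * (m * k)       ∎)
    where
    open ≤-Reasoning
    r₁ : ∀ m k → m * (2 * k) ≡ 2 * (m * k)
    r₁ = solve-∀
  count : 2 ^ suc s * failures H q m ≤ 4 * length (outcomes N q m)
  count = few-failures s ℓ large N q m k r H bounded spread r≤q
    (≤-trans (<⇒≤ r<) (^-monoʳ-≤ 2 (+-monoˡ-≤ ℓ {1} {suc s} (s≤s z≤n)))) m≤N enough′

ℙ-asymptotic : ∀ s ℓ₀ E ε → 2 ^ (2 ^ suc s) * 2 ^ suc s ≤ ℓ₀ → 4 * suc E ≤ 2 ^ suc s → ℤ.+ 1 ℚ./ suc E ℚ.≤ ε →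
  ∀ r N q m κ (H : Hypergraph N) → 2 ^ ℓ₀ ≤ r → Bounded r H → Spread κ H → r ≤ q →
  ∃[ K ] (∀ n → K ≤ n → embed 5 ℚ.≤ seq κ n) → m ≤ N →
  (fromℕ 272 *ℝ log₂ r) *ℝ fromℕ N ≤ℝ fromℕ m *ℝ κ →
  1ℚ ℚ.- ε ℚ.≤ ℙ (outcomes N q m) (containsRainbowEdge? H)
ℙ-asymptotic s ℓ₀ E ε large 4E≤ E≤ε r N q m κ H 2^ℓ₀≤r bounded spread r≤q big m≤N enough =
  let (k , 1≤k , K , approx) = natural-scale κ big in
  ℙ-natural s ⌊log₂ r ⌋ E ε (≤-trans large ℓ₀≤ℓ) 4E≤ E≤ε N q m k r H {{q≢0}} {{>-nonZero 1≤k}} bounded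
    (spread-natural κ k K approx H spread) r≤q (n<2^[1+⌊log₂n⌋] r) m≤N
    (size-natural κ k K approx 272 r {{r≢0}} N m enough)
  where
  r≢0 : NonZero r
  r≢0 = >-nonZero (≤-trans (m^n>0 2 ℓ₀) 2^ℓ₀≤r)
  q≢0 : NonZero q
  q≢0 = >-nonZero (≤-trans (>-nonZero⁻¹ r {{r≢0}}) r≤q)
  ℓ₀≤ℓ : ℓ₀ ≤ ⌊log₂ r ⌋
  ℓ₀≤ℓ = ≤-trans (≤-reflexive (sym (⌊log₂[2^n]⌋≡n ℓ₀))) (⌊log₂⌋-mono-≤ 2^ℓ₀≤r)

theorem2 : (L : ℝ) → 0ℝ <ℝ L →
    ∃[ C ] (0ℝ <ℝ C ×
    ((ε : ℚ) → 0ℚ <ℚ ε →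
    ∃[ R ] ((r : ℕ) → R ≤ r →
    (N q m : ℕ) (κ : ℝ) (H : Hypergraph N) →
    Bounded r H → Spread κ H →
    r ≤ q →
    L *ℝ fromℕ r ≤ℝ κ →
    fromℕ N *ℝ (ln r ^ℝ 5) ≤ℝ (κ ^ℝ 2) *ℝ fromℕ r →
    m ≤ N →
    (C *ℝ log₂ r) *ℝ fromℕ N ≤ℝ fromℕ m *ℝ κ →
    1ℚ -ℚ ε ≤ℚ ℙ (outcomes N q m) (containsRainbowEdge? H))))
theorem2 L 0<L = fromℕ 272 , (1ℚ , 0<1 , 0 , λ _ _ → embed-mono {1} {272} (s≤s z≤n)) ,
  λ ε 0<ε → threshold ε (archimedes ε 0<ε)
  where
  R₁ : ℕ
  R₁ = proj₁ (eventually-large L 0<L)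
  -- With s = E + 2, the failure probability 4 / 2 ^ (s + 1) is at most 1 / (E + 1), and `ℓ₀ E` is
  -- the least value that the last round allows for this s.
  ℓ₀ : ℕ → ℕ
  ℓ₀ E = 2 ^ (2 ^ (3 + E)) * 2 ^ (3 + E)
  4E≤ : ∀ E → 4 * suc E ≤ 2 ^ (3 + E)
  4E≤ E = ≤-trans (*-monoʳ-≤ 4 (<⇒≤ (n<2^n (suc E)))) (≤-reflexive (r (2 ^ suc E)))
    where
    r : ∀ x → 4 * x ≡ 2 * (2 * x)
    r = solve-∀
  threshold : ∀ ε → ∃[ E ] (∀ n → E ≤ n → ℤ.+ 1 ℚ./ suc n ℚ.< ε) → _
  -- The first summand makes ⌊log₂ r⌋ at least `ℓ₀ E`, the second one ensures κ ≥ 5.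
  threshold ε (E , small) = 2 ^ ℓ₀ E + R₁ , λ r R≤r N q m κ H bounded spread r≤q Lr≤κ _ m≤N enough →
    ℙ-asymptotic (suc (suc E)) (ℓ₀ E) E ε ≤-refl (4E≤ E) (ℚ.<⇒≤ (small E ≤-refl)) r N q m κ H
      (≤-trans (m≤m+n (2 ^ ℓ₀ E) R₁) R≤r) bounded spread r≤q
      (proj₂ (eventually-large L 0<L) r (≤-trans (m≤n+m R₁ (2 ^ ℓ₀ E)) R≤r) κ Lr≤κ) m≤N enough
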